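{- Let $n$ be a non-zero integer. Let $D_{3,n}(N)$ be the number of $D(n)$-triples with all elements in $\{1,2,\dots,N\}$ and $D_{2,n}(N)$ the number of $D(n)$-pairs with both elements in $\{1,2,\dots,N\}$. Then $D_{3,n}(N)\sim \frac{D_{2,n}(N)}{2}$ as $N\to\infty$.
   Context: For a non-zero integer $n$ and $m\ge2$, a $D(n)$-$m$-tuple is a set $\{a_1,\dots,a_m\}$ of $m$ distinct positive integers such that $a_ia_j+n$ is a perfect square for all $1\le i<j\le m$; $D(n)$-pairs and $D(n)$-triples are the cases $m=2$ and $m=3$. -}

module Defs where

open import Data.Nat using (ℕ; zero; suc; _+_; _*_; _≤_; _<_; z≤n; s≤s; _≟_)
open import Data.Nat.Properties using (m≤m*n)
open import Data.Integer as ℤ using (ℤ; +_; -[1+_])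
open import Data.Fin using (Fin; toℕ; fromℕ<)
open import Data.Fin.Properties using (any?; toℕ-fromℕ<)
open import Data.List using (List; []; _∷_; length; filter; concatMap; upTo; map)
open import Data.Product using (∃; _×_; _,_; proj₁; proj₂)
open import Data.Product.Properties using ()
open import Relation.Nullary using (Dec; yes; no; ¬_)
open import Relation.Nullary.Decidable using (_×-dec_)
open import Relation.Binary.PropositionalEquality using (_≡_; refl; subst; sym; trans; cong)

-- An integer m is a perfect square if m = k² for some integer k
-- (equivalently some natural number k, since k² = |k|²).
IsSquare : ℤ → Set
IsSquare m = ∃ λ (k : ℕ) → + (k * k) ≡ m

private
  sq-bound : ∀ k m → k * k ≡ m → k < suc m
  sq-bound zero m _ = s≤s z≤n
  sq-bound (suc k) m eq = s≤s (subst (suc k ≤_) eq (m≤m*n (suc k) (suc k)))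

isSquare? : (m : ℤ) → Dec (IsSquare m)
isSquare? -[1+ m ] = no λ { (k , ()) }
isSquare? (+ m) with any? {n = suc m} (λ (i : Fin (suc m)) → toℕ i * toℕ i ≟ m)
... | yes (i , eq) = yes (toℕ i , cong +_ eq)
... | no ¬p = no λ { (k , refl) → ¬p (fromℕ< (sq-bound k (k * k) refl) ,
                       subst (λ x → x * x ≡ k * k) (sym (toℕ-fromℕ< (sq-bound k (k * k) refl))) refl) }

DCond : ℤ → ℕ → ℕ → Set
DCond n a b = IsSquare (+ (a * b) ℤ.+ n)

DCond? : (n : ℤ) → (a b : ℕ) → Dec (DCond n a b)
DCond? n a b = isSquare? (+ (a * b) ℤ.+ n)

range : ℕ → List ℕ
range N = map suc (upTo N)

-- all (a , b) with 1 ≤ a < b ≤ N  (each 2-element subset of {1..N} exactly once)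
pairsUpTo : ℕ → List (ℕ × ℕ)
pairsUpTo N = concatMap (λ b → map (λ a → (suc a , b)) (upTo (b Data.Nat.∸ 1))) (range N)

-- all (a , b , c) with 1 ≤ a < b < c ≤ N  (each 3-element subset exactly once)
triplesUpTo : ℕ → List (ℕ × ℕ × ℕ)
triplesUpTo N = concatMap (λ c → map (λ p → (proj₁ p , proj₂ p , c)) (pairsUpTo (c Data.Nat.∸ 1))) (range N)

D₂ : ℤ → ℕ → ℕ
D₂ n N = length (filter (λ p → DCond? n (proj₁ p) (proj₂ p)) (pairsUpTo N))

D₃ : ℤ → ℕ → ℕ
D₃ n N = length (filter (λ t → DCond? n (proj₁ t) (proj₁ (proj₂ t))
                           ×-dec DCond? n (proj₁ t) (proj₂ (proj₂ t))
                           ×-dec DCond? n (proj₁ (proj₂ t)) (proj₂ (proj₂ t)))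
                        (triplesUpTo N))

{-# OPTIONS --safe #-}
module Submission where

-- Fix c.  The solutions s of s² ≡ n modulo c with 0 < s < c correspond to the pairs {a, c}
-- with a < c, via a = (s² − n)/c, and s ↦ c − s is an involution on them.  If a and b are
-- exchanged by it, then ab + n = (a − s)², so {a, b, c} is a triple; call such triples regular.
-- Apart from c ∣ 4n and, for square n, one pair per c, each c thus has half as many regular
-- triples as pairs.
--
-- For an irregular triple a < b < c with roots r, s, t of ab + n, ac + n, bc + n, the integer
-- e = n(a + b + c) + 2abc − 2rst is positive (for large c), ae + n², be + n² and ce + n² are
-- squares, abe is O(c), and a, b, e determine c up to four choices of signs.  Counting triples
-- (a, b, e) with abe ≤ X by their smallest member gives O(X^{5/6} log² X).
--
-- Finally the primitive values of a quadratic form of discriminant 4n with nonnegative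
-- coefficients provide at least a constant times N pairs, and more than any multiple of N
-- if n is a square.

-- The identity e(e + 4rst) = n²((a + c - b)² - 4s²) governs the irregular triples. Its right side
-- vanishes exactly for b + 2s = a + c, and it forces e to be small against c, so that a triple with
-- c ≤ N shrinks to (a, b, e) with product O(N).
--
-- These are counted without any estimate for the divisor function. The smallest member p is
-- O(N^{1/3}). Given p, one of the other two is read off from a root ρ, the other from a root x with
-- x² ≡ n² modulo p, and x is described by a divisor j ≤ √p of p and a quotient z. As j(ρ + 1)(z +
-- 1) = O(√N), there are O(√N log² N) choices, whence the exponent 5/6 = 1/3 + 1/2.
--
-- The exceptional pairs of a square n are those with conjugate 0, and there may be about N of them.
-- A linear lower bound for the number of pairs does not absorb this loss, so square n is treated
-- apart: there the form splits as y(y + 2kv), and counting under a hyperbola gains a logarithm.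
--
-- For positive nonsquare n the form is indefinite and has infinitely many automorphs. The
-- restriction to y, v ≥ 1 leaves at most one representation of c for each root s modulo c.

open import Defs
open import Data.Bool using (Bool; true; false; if_then_else_)
open import Data.Nat using (ℕ; zero; suc; _+_; _*_; _∸_; _^_; _/_; _%_; _≤_; _<_; z≤n; s≤s; NonZero; >-nonZero; _≟_; _≤?_; _<?_; ∣_-_∣)
open import Data.Nat.Properties hiding (_≟_; _≤?_; _<?_)
open import Data.Nat.Divisibility hiding (quotient)
open import Data.Nat.DivMod using (m≡m%n+[m/n]*n; m%n<n; m/n*n≤m; /-monoˡ-≤; m*n/n≡m)
open import Data.Nat.GCD using (gcd; gcd[m,n]∣m; gcd[m,n]∣n; gcd[m,n]≢0; c*gcd[m,n]≡gcd[cm,cn]; module Bézout)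
open import Data.Nat.Coprimality as Coprimality using (Coprime; gcd≡1⇒coprime; coprime-divisor; coprime-Bézout)
open import Data.Nat.Tactic.RingSolver using () renaming (solve-∀ to ℕ-solve)
open import Data.Integer as ℤ using (ℤ; +_; -[1+_]; 0ℤ)
import Data.Integer.Properties as ℤₚ
import Data.Integer.Divisibility.Signed as ℤ∣
open import Data.Integer.Tactic.RingSolver using () renaming (solve-∀ to ℤ-solve)
open import Data.List using (List; []; _∷_; _++_; length; map; concatMap; upTo; cartesianProduct; filter)
open import Data.List.Properties using (length-map; length-++; length-upTo; length-filter)
open import Data.List.Membership.Propositional using (_∈_; find; lose)
open import Data.List.Membership.Propositional.Properties
open import Data.List.Relation.Unary.Any using (here; there)
open import Data.List.Relation.Unary.All as All using ([]; _∷_)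
open import Data.List.Relation.Unary.AllPairs using ([]; _∷_)
open import Data.List.Relation.Unary.Unique.Propositional using (Unique)
import Data.List.Relation.Unary.Unique.Propositional.Properties as Uniqueₚ
open import Data.Product using (∃; ∃₂; _×_; _,_; proj₁; proj₂)
open import Data.Sign using (Sign)
open import Data.Sum using (_⊎_; inj₁; inj₂)
open import Data.Empty using (⊥)
open import Relation.Nullary using (¬_; contradiction; yes; no)
open import Relation.Nullary.Decidable using (_×-dec_)
open import Relation.Binary.Definitions using (tri<; tri≈; tri>)
open import Relation.Binary.PropositionalEquality hiding (J)

-- Counting by injection

-- A relation instead of a function: each `x` may take any partner, and injectivity of `R` alone
-- keeps the others off that partner, so it can be deleted from `ys` before recursing. In the counts
-- below `R` is a data type with one constructor for each way of encoding.
length-≤-by-injection : {A B : Set} (R : A → B → Set) (xs : List A) (ys : List B) → Unique xs →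
  (∀ {x} → x ∈ xs → ∃ λ y → y ∈ ys × R x y) →
  (∀ {x x′ y} → x ∈ xs → x′ ∈ xs → R x y → R x′ y → x ≡ x′) →
  length xs ≤ length ys
length-≤-by-injection R [] ys _ _ _ = z≤n
length-≤-by-injection R (x ∷ xs) ys (x∉ ∷ u) tot inj with tot (here refl)
... | y , y∈ , Rxy with ∈-∃++ y∈
... | as , bs , refl = begin
  suc (length xs)
    ≤⟨ s≤s (length-≤-by-injection R xs (as ++ bs) u tot′ λ p q → inj (there p) (there q)) ⟩
  suc (length (as ++ bs))      ≡⟨ cong suc (length-++ as) ⟩
  suc (length as + length bs)  ≡⟨ sym (+-suc _ _) ⟩
  length as + suc (length bs)  ≡⟨ sym (length-++ as) ⟩
  length (as ++ y ∷ bs)        ∎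
  where
  open ≤-Reasoning
  tot′ : ∀ {x′} → x′ ∈ xs → ∃ λ y′ → y′ ∈ as ++ bs × R x′ y′
  tot′ p with tot (there p)
  ... | y′ , y′∈ , Rx′y′ with ∈-++⁻ as y′∈
  ... | inj₁ q = y′ , ∈-++⁺ˡ q , Rx′y′
  ... | inj₂ (there q) = y′ , ∈-++⁺ʳ as q , Rx′y′
  ... | inj₂ (here refl) = contradiction (inj (here refl) (there p) Rxy Rx′y′) (All.lookup x∉ p)

concatMap-unique : {A B : Set} (f : A → List B) {xs : List A} → Unique xs →
  (∀ x → Unique (f x)) → (∀ {x x′ z} → z ∈ f x → z ∈ f x′ → x ≡ x′) →
  Unique (concatMap f xs)
concatMap-unique f [] uf dis = []
concatMap-unique f {x ∷ xs} (x∉ ∷ u) uf dis =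
  Uniqueₚ.++⁺ (uf x) (concatMap-unique f u uf dis) λ { (p , q) → disjoint p (find (∈-concatMap⁻ f q)) }
  where
  disjoint : ∀ {z} → z ∈ f x → ¬ (∃ λ x′ → x′ ∈ xs × z ∈ f x′)
  disjoint p (x′ , q , r) = All.lookup x∉ q (dis p r)

∈-concatMap-intro : {A B : Set} (f : A → List B) {xs : List A} {x : A} {y : B} →
  x ∈ xs → y ∈ f x → y ∈ concatMap f xs
∈-concatMap-intro f x∈ y∈ = ∈-concatMap⁺ f (lose x∈ y∈)

length-concatMap-≤ : {A B : Set} (f : A → List B) (xs : List A) (K : ℕ) →
  (∀ {x} → x ∈ xs → length (f x) ≤ K) → length (concatMap f xs) ≤ length xs * K
length-concatMap-≤ f [] K h = z≤n
length-concatMap-≤ f (x ∷ xs) K h = begin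
  length (f x ++ concatMap f xs)         ≡⟨ length-++ (f x) ⟩
  length (f x) + length (concatMap f xs)
    ≤⟨ +-mono-≤ (h (here refl)) (length-concatMap-≤ f xs K (λ p → h (there p))) ⟩
  K + length xs * K                      ∎
  where open ≤-Reasoning

length-cartesianProduct : {A B : Set} (xs : List A) (ys : List B) →
  length (cartesianProduct xs ys) ≡ length xs * length ys
length-cartesianProduct [] ys = refl
length-cartesianProduct (x ∷ xs) ys =
  trans (length-++ (map (x ,_) ys)) (cong₂ _+_ (length-map _ ys) (length-cartesianProduct xs ys))

∈-range⁺ : ∀ {N a} → 1 ≤ a → a ≤ N → a ∈ range N
∈-range⁺ {a = suc a} _ a≤N = ∈-map⁺ suc (∈-upTo⁺ a≤N)

∈-range⁻ : ∀ {N a} → a ∈ range N → 1 ≤ a × a ≤ N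
∈-range⁻ p with ∈-map⁻ suc p
... | _ , q , refl = s≤s z≤n , ∈-upTo⁻ q

range-unique : ∀ N → Unique (range N)
range-unique N = Uniqueₚ.map⁺ suc-injective (Uniqueₚ.upTo⁺ N)

length-range : ∀ N → length (range N) ≡ N
length-range N = trans (length-map suc (upTo N)) (length-upTo N)

-- Membership in the enumerations of pairs and triples

pairsBelow : ℕ → List (ℕ × ℕ)
pairsBelow b = map (λ a → (suc a , b)) (upTo (b ∸ 1))

triplesBelow : ℕ → List (ℕ × ℕ × ℕ)
triplesBelow c = map (λ p → (proj₁ p , proj₂ p , c)) (pairsUpTo (c ∸ 1))

∈-pairsUpTo⁺ : ∀ {N a b} → 1 ≤ a → a < b → b ≤ N → (a , b) ∈ pairsUpTo N
∈-pairsUpTo⁺ {N} {suc a} {suc b} _ (s≤s a<b) b≤N =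
  ∈-concatMap-intro pairsBelow {range N} (∈-range⁺ (s≤s z≤n) b≤N)
    (∈-map⁺ (λ a → (suc a , suc b)) (∈-upTo⁺ a<b))

∈-pairsUpTo⁻ : ∀ {N a b} → (a , b) ∈ pairsUpTo N → 1 ≤ a × a < b × b ≤ N
∈-pairsUpTo⁻ {N} p with find (∈-concatMap⁻ pairsBelow {xs = range N} p)
... | b , b∈ , q with ∈-range⁻ {N} b∈ | ∈-map⁻ (λ a → (suc a , b)) q
... | s≤s z≤n , b≤N | a , a∈ , refl = s≤s z≤n , s≤s (∈-upTo⁻ a∈) , b≤N

pairsUpTo-unique : ∀ N → Unique (pairsUpTo N)
pairsUpTo-unique N = concatMap-unique pairsBelow (range-unique N)
  (λ b → Uniqueₚ.map⁺ (λ { refl → refl }) (Uniqueₚ.upTo⁺ _))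
  same
  where
  same : ∀ {b b′ z} → z ∈ pairsBelow b → z ∈ pairsBelow b′ → b ≡ b′
  same {b} {b′} p q with ∈-map⁻ (λ a → (suc a , b)) p | ∈-map⁻ (λ a → (suc a , b′)) q
  ... | _ , _ , refl | _ , _ , refl = refl

∈-triplesUpTo⁺ : ∀ {N a b c} → 1 ≤ a → a < b → b < c → c ≤ N → (a , b , c) ∈ triplesUpTo N
∈-triplesUpTo⁺ {N} {c = suc c} 1≤a a<b (s≤s b≤c) c≤N =
  ∈-concatMap-intro triplesBelow {range N} (∈-range⁺ (s≤s z≤n) c≤N)
    (∈-map⁺ (λ p → (proj₁ p , proj₂ p , suc c)) (∈-pairsUpTo⁺ {c} 1≤a a<b b≤c))

∈-triplesUpTo⁻ : ∀ {N a b c} → (a , b , c) ∈ triplesUpTo N → 1 ≤ a × a < b × b < c × c ≤ N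
∈-triplesUpTo⁻ {N} p with find (∈-concatMap⁻ triplesBelow {xs = range N} p)
... | c , c∈ , q with ∈-range⁻ {N} c∈ | ∈-map⁻ (λ p → (proj₁ p , proj₂ p , c)) q
... | s≤s z≤n , c≤N | _ , ab∈ , refl with ∈-pairsUpTo⁻ {c ∸ 1} ab∈
... | 1≤a , a<b , b≤c = 1≤a , a<b , s≤s b≤c , c≤N

triplesUpTo-unique : ∀ N → Unique (triplesUpTo N)
triplesUpTo-unique N = concatMap-unique triplesBelow (range-unique N)
  (λ c → Uniqueₚ.map⁺ (λ { refl → refl }) (pairsUpTo-unique (c ∸ 1)))
  same
  where
  same : ∀ {c c′ z} → z ∈ triplesBelow c → z ∈ triplesBelow c′ → c ≡ c′
  same {c} {c′} p q with ∈-map⁻ (λ p → (proj₁ p , proj₂ p , c)) p | ∈-map⁻ (λ p → (proj₁ p , proj₂ p , c′)) q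
  ... | _ , _ , refl | _ , _ , refl = refl

-- Identities that hold modulo hypotheses are proved by a certificate of ideal membership: `u - v`
-- is a combination of the differences of the hypotheses, and this combination is a pure ring
-- identity, left to the solver. The versions below take two and three hypotheses.
linear₁ : ∀ {u v l r} p → l ≡ r → u ℤ.- v ≡ p ℤ.* (l ℤ.- r) → u ≡ v
linear₁ {l = l} p refl e = ℤₚ.i-j≡0⇒i≡j _ _ (trans e (trans (cong (p ℤ.*_) (ℤₚ.+-inverseʳ l)) (ℤₚ.*-zeroʳ p)))

linear₂ : ∀ {u v l r l′ r′} p p′ → l ≡ r → l′ ≡ r′ →
  u ℤ.- v ≡ p ℤ.* (l ℤ.- r) ℤ.+ p′ ℤ.* (l′ ℤ.- r′) → u ≡ v
linear₂ {l = l} {l′ = l′} p p′ refl refl e = ℤₚ.i-j≡0⇒i≡j _ _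
  (trans e (cong₂ ℤ._+_ (zeroˡ p l) (zeroˡ p′ l′)))
  where
  zeroˡ : ∀ p l → p ℤ.* (l ℤ.- l) ≡ 0ℤ
  zeroˡ p l = trans (cong (p ℤ.*_) (ℤₚ.+-inverseʳ l)) (ℤₚ.*-zeroʳ p)

linear₃ : ∀ {u v l r l′ r′ l″ r″} p p′ p″ → l ≡ r → l′ ≡ r′ → l″ ≡ r″ →
  u ℤ.- v ≡ p ℤ.* (l ℤ.- r) ℤ.+ p′ ℤ.* (l′ ℤ.- r′) ℤ.+ p″ ℤ.* (l″ ℤ.- r″) → u ≡ v
linear₃ {l = l} {l′ = l′} {r′} {l″} {r″} p p′ p″ refl eq′ eq″ e = linear₂ p′ p″ eq′ eq″
  (trans e (cong (ℤ._+ p″ ℤ.* (l″ ℤ.- r″))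
    (trans (cong (ℤ._+ p′ ℤ.* (l′ ℤ.- r′)) (trans (cong (p ℤ.*_) (ℤₚ.+-inverseʳ l)) (ℤₚ.*-zeroʳ p)))
      (ℤₚ.+-identityˡ (p′ ℤ.* (l′ ℤ.- r′))))))

pos-sq : ∀ x → + (x * x) ≡ + x ℤ.* + x
pos-sq x = ℤₚ.pos-* x x

-- The sign of `n` is unknown, so a root equation in ℤ is used as two inequalities in ℕ, with the
-- absolute value on one side or the other.
pos-≤ : ∀ {x y} z → + x ≡ + y ℤ.+ z → x ≤ y + ℤ.∣ z ∣
pos-≤ {x} {y} z e = subst (_≤ y + ℤ.∣ z ∣) (sym (cong ℤ.∣_∣ e)) (ℤₚ.∣i+j∣≤∣i∣+∣j∣ (+ y) z)

pos-≥ : ∀ {x y} z → + x ≡ + y ℤ.+ z → y ≤ x + ℤ.∣ z ∣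
pos-≥ {x} {y} z e = subst (_≤ x + ℤ.∣ z ∣) (sym (cong ℤ.∣_∣ e′)) (ℤₚ.∣i-j∣≤∣i∣+∣j∣ (+ x) z)
  where
  e′ : + y ≡ + x ℤ.- z
  e′ = linear₁ (ℤ.- + 1) e (lemma (+ x) (+ y) z)
    where
    lemma : ∀ x y z → y ℤ.- (x ℤ.- z) ≡ (ℤ.- + 1) ℤ.* (x ℤ.- (y ℤ.+ z))
    lemma = ℤ-solve

square-injective : ∀ {x y} → x * x ≡ y * y → x ≡ y
square-injective {x} {y} e with <-cmp x y
... | tri< x<y _ _ = contradiction e (<⇒≢ (*-mono-< x<y x<y))
... | tri≈ _ eq _ = eq
... | tri> _ _ y<x = contradiction (sym e) (<⇒≢ (*-mono-< y<x y<x))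

square-cancel-< : ∀ {x y} → x * x < y * y → x < y
square-cancel-< {x} {y} lt with x <? y
... | yes p = p
... | no ¬p = contradiction (*-mono-≤ (≮⇒≥ ¬p) (≮⇒≥ ¬p)) (<⇒≱ lt)

square-cancel-≤ : ∀ {x y} → x * x ≤ y * y → x ≤ y
square-cancel-≤ {x} {y} le with x ≤? y
... | yes p = p
... | no ¬p = contradiction (*-mono-< (≰⇒> ¬p) (≰⇒> ¬p)) (≤⇒≯ le)

∣∣-square : ∀ z → + (ℤ.∣ z ∣ * ℤ.∣ z ∣) ≡ z ℤ.* z
∣∣-square (+ zero) = refl
∣∣-square (+ suc k) = refl
∣∣-square -[1+ k ] = refl

bools : List Bool
bools = true ∷ false ∷ []

∈-bools : ∀ t → t ∈ bools
∈-bools true = here refl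
∈-bools false = there (here refl)

length-bools× : {A : Set} (xs : List A) → length (cartesianProduct bools xs) ≡ 2 * length xs
length-bools× xs = length-cartesianProduct bools xs

sum-list : {A B : Set} → List A → List B → List (A ⊎ B)
sum-list xs ys = map inj₁ xs ++ map inj₂ ys

∈-sumˡ : {A B : Set} {xs : List A} {ys : List B} {x : A} → x ∈ xs → inj₁ x ∈ sum-list xs ys
∈-sumˡ p = ∈-++⁺ˡ (∈-map⁺ inj₁ p)

∈-sumʳ : {A B : Set} {xs : List A} {ys : List B} {y : B} → y ∈ ys → inj₂ y ∈ sum-list xs ys
∈-sumʳ {xs = xs} q = ∈-++⁺ʳ (map inj₁ xs) (∈-map⁺ inj₂ q)

length-sum : {A B : Set} (xs : List A) (ys : List B) → length (sum-list xs ys) ≡ length xs + length ys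
length-sum xs ys = trans (length-++ (map inj₁ xs)) (cong₂ _+_ (length-map inj₁ xs) (length-map inj₂ ys))

∣∣-sign-injective : ∀ {i j} → ℤ.∣ i ∣ ≡ ℤ.∣ j ∣ → ℤ.sign i ≡ ℤ.sign j → i ≡ j
∣∣-sign-injective {i} {j} p q = trans (sym (ℤₚ.◃-inverse i)) (trans (cong₂ ℤ._◃_ q p) (ℤₚ.◃-inverse j))

cofactor-unique : ∀ {p q q′ u v} → 1 ≤ p → u ≡ p * q + v → u ≡ p * q′ + v → q ≡ q′
cofactor-unique {p} {q} {q′} {u} {v} 1≤p e e′ =
  *-cancelˡ-≡ q q′ p {{>-nonZero 1≤p}} (+-cancelʳ-≡ v (p * q) (p * q′) (trans (sym e) e′))

-- Divisor bounds

pos-+* : ∀ x y z → + (x * y + z) ≡ + x ℤ.* + y ℤ.+ + z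
pos-+* x y z = trans (ℤₚ.pos-+ (x * y) z) (cong (ℤ._+ + z) (ℤₚ.pos-* x y))

-- If x² ≡ m² modulo p then p = gh with g ∣ x − m and h ∣ x + m.  Given p, the pair (g, h) is
-- determined by one of its members j, which can be chosen ≤ √p, and then x by z = ⌊2mx/p⌋.
record ResidueCode (m p x : ℕ) (tag : Bool) (j z : ℕ) : Set where
  field
    g h i k : ℕ
    p≡gh    : p ≡ g * h
    x≡gi+m  : x ≡ g * i + m
    x+m≡hk  : x + m ≡ h * k
    j-tag   : j ≡ (if tag then g else h)
    z-lower : z * p ≤ 2 * m * x
    z-upper : 2 * m * x < suc z * p

multiple-in-window : ∀ {p z u v} (q : ℤ.ℤ) → z * p ≤ u → u < suc z * p → z * p ≤ v → v < suc z * p →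
  + u ℤ.- + v ≡ + p ℤ.* q → u ≡ v
multiple-in-window {p} {z} {u} {v} q zu uz zv vz e = go ℤ.∣ q ∣ refl
  where
  bound : ∀ {x y} → y ≤ x → z * p ≤ y → x < suc z * p → ℤ.∣ x ℤ.⊖ y ∣ < p
  bound {x} {y} y≤x zy xz = begin-strict
    ℤ.∣ x ℤ.⊖ y ∣            ≡⟨ cong ℤ.∣_∣ (ℤₚ.⊖-≥ y≤x) ⟩
    x ∸ y                    ≤⟨ ∸-monoʳ-≤ x zy ⟩
    x ∸ z * p                <⟨ ∸-monoˡ-< xz (≤-trans zy y≤x) ⟩
    p + z * p ∸ z * p        ≡⟨ m+n∸n≡m p (z * p) ⟩
    p                        ∎
    where open ≤-Reasoning
  ∣u-v∣<p : ℤ.∣ + u ℤ.- + v ∣ < p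
  ∣u-v∣<p with ≤-total v u
  ... | inj₁ v≤u = subst (_< p) (cong ℤ.∣_∣ (sym (ℤₚ.m-n≡m⊖n u v))) (bound v≤u zv uz)
  ... | inj₂ u≤v = subst (_< p) (trans (ℤₚ.∣m⊖n∣≡∣n⊖m∣ v u) (cong ℤ.∣_∣ (sym (ℤₚ.m-n≡m⊖n u v)))) (bound u≤v zu vz)
  go : ∀ k → ℤ.∣ q ∣ ≡ k → u ≡ v
  go zero eq = ℤₚ.+-injective (ℤₚ.i-j≡0⇒i≡j _ _
    (trans e (trans (cong (+ p ℤ.*_) (ℤₚ.∣i∣≡0⇒i≡0 {q} eq)) (ℤₚ.*-zeroʳ (+ p)))))
  go (suc k) eq = contradiction p≤∣u-v∣ (<⇒≱ ∣u-v∣<p)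
    where
    p≤∣u-v∣ : p ≤ ℤ.∣ + u ℤ.- + v ∣
    p≤∣u-v∣ = subst (p ≤_) (sym (trans (cong ℤ.∣_∣ e) (trans (ℤₚ.abs-* (+ p) q) (cong (p *_) eq)))) (m≤m*n p (suc k))

-- The congruences x ≡ m modulo g and x ≡ -m modulo h fix x only modulo lcm(g, h). Since gcd(g, h)
-- divides 2m, they do fix 2mx modulo gh = p, which is why `z` is the quotient of 2mx and not of x.
residueCode-injective : ∀ {m p x x′ tag j z} → 1 ≤ m → 1 ≤ p →
  ResidueCode m p x tag j z → ResidueCode m p x′ tag j z → x ≡ x′
residueCode-injective {m} {p} {x} {x′} {tag} {j} {z} 1≤m 1≤p C C′ =
  *-cancelˡ-≡ x x′ (2 * m) {{>-nonZero (≤-trans 1≤m (m≤m+n m _))}}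
    (multiple-in-window {p} {z} q (z-lower C) (z-upper C) (z-lower C′) (z-upper C′) q-eq)
  where
  open ResidueCode
  same-gh : ∀ t {j} → j ≡ (if t then g C else h C) → j ≡ (if t then g C′ else h C′) → g C ≡ g C′ × h C ≡ h C′
  same-gh true {j} refl e′ = e′ , *-cancelˡ-≡ (h C) (h C′) (g C) {{g≢0}} (trans (sym (p≡gh C)) (trans (p≡gh C′) (cong (_* h C′) (sym e′))))
    where
    g≢0 : NonZero (g C)
    g≢0 = >-nonZero (n≢0⇒n>0 λ g≡0 → <⇒≢ 1≤p (sym (trans (p≡gh C) (cong (_* h C) g≡0))))
  same-gh false {j} refl e′ = *-cancelʳ-≡ (g C) (g C′) (h C) {{h≢0}} (trans (sym (p≡gh C)) (trans (p≡gh C′) (cong (g C′ *_) (sym e′)))) , e′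
    where
    h≢0 : NonZero (h C)
    h≢0 = >-nonZero (n≢0⇒n>0 λ h≡0 → <⇒≢ 1≤p (sym (trans (p≡gh C) (trans (cong (g C *_) h≡0) (*-zeroʳ (g C))))))
  gh = same-gh tag (j-tag C) (j-tag C′)
  q : ℤ.ℤ
  q = + k C ℤ.* (+ i C ℤ.- + i C′) ℤ.- + i C ℤ.* (+ k C ℤ.- + k C′)
  -- 2m(x − x′) = (hk − gi)(x − x′), where x − x′ = g(i − i′) = h(k − k′).
  q-eq : + (2 * m * x) ℤ.- + (2 * m * x′) ≡ + p ℤ.* q
  q-eq = trans (cong₂ ℤ._-_ (pos x) (pos x′)) (identity (+ m) (+ g C) (+ h C) (+ i C) (+ i C′) (+ k C) (+ k C′)
      (trans (cong +_ (x≡gi+m C)) (pos-+* (g C) (i C) m))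
      (trans (cong +_ (trans (x≡gi+m C′) (cong (λ g → g * i C′ + m) (sym (proj₁ gh))))) (pos-+* (g C) (i C′) m))
      (trans (sym (ℤₚ.pos-+ x m)) (trans (cong +_ (x+m≡hk C)) (ℤₚ.pos-* (h C) (k C))))
      (trans (sym (ℤₚ.pos-+ x′ m)) (trans (cong +_ (trans (x+m≡hk C′) (cong (_* k C′) (sym (proj₂ gh))))) (ℤₚ.pos-* (h C) (k C′))))
      (trans (cong +_ (p≡gh C)) (ℤₚ.pos-* (g C) (h C))))
    where
    pos : ∀ x → + (2 * m * x) ≡ + 2 ℤ.* + m ℤ.* + x
    pos x = trans (ℤₚ.pos-* (2 * m) x) (cong (ℤ._* + x) (ℤₚ.pos-* 2 m))
    identity : ∀ m g h i i′ k k′ {x x′ p} → x ≡ g ℤ.* i ℤ.+ m → x′ ≡ g ℤ.* i′ ℤ.+ m →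
      x ℤ.+ m ≡ h ℤ.* k → x′ ℤ.+ m ≡ h ℤ.* k′ → p ≡ g ℤ.* h →
      + 2 ℤ.* m ℤ.* x ℤ.- + 2 ℤ.* m ℤ.* x′ ≡ p ℤ.* (k ℤ.* (i ℤ.- i′) ℤ.- i ℤ.* (k ℤ.- k′))
    identity m g h i i′ k k′ refl refl e e′ refl =
      linear₂ (g ℤ.* (i ℤ.- i′) ℤ.- g ℤ.* i) (g ℤ.* i) e e′ (lemma m g h i i′ k k′)
      where
      lemma : ∀ m g h i i′ k k′ →
        + 2 ℤ.* m ℤ.* (g ℤ.* i ℤ.+ m) ℤ.- + 2 ℤ.* m ℤ.* (g ℤ.* i′ ℤ.+ m)
          ℤ.- g ℤ.* h ℤ.* (k ℤ.* (i ℤ.- i′) ℤ.- i ℤ.* (k ℤ.- k′)) ≡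
        (g ℤ.* (i ℤ.- i′) ℤ.- g ℤ.* i) ℤ.* (g ℤ.* i ℤ.+ m ℤ.+ m ℤ.- h ℤ.* k)
          ℤ.+ (g ℤ.* i) ℤ.* (g ℤ.* i′ ℤ.+ m ℤ.+ m ℤ.- h ℤ.* k′)
      lemma = ℤ-solve

-- Take g = gcd(p, x - m) and h = p/g. In pw = (x - m)(x + m) the number h is coprime to (x - m)/g,
-- so it divides x + m. The smaller of g and h has square at most p.
residueCode-exists : ∀ {m p x w} → 1 ≤ p → 1 ≤ m → x * x ≡ p * w + m * m →
  ∃ λ tag → ∃₂ λ j z → ResidueCode m p x tag j z × j * j ≤ p × z * p ≤ 2 * m * x
residueCode-exists {m} {p@(suc _)} {x} {w} 1≤p 1≤m x² =
  choose (gcd[m,n]∣m p (x ∸ m)) (gcd[m,n]∣n p (x ∸ m)) refl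
  where
  m≤x : m ≤ x
  m≤x = square-cancel-≤ (subst (m * m ≤_) (sym x²) (m≤n+m (m * m) (p * w)))
  x-m : x ≡ x ∸ m + m
  x-m = sym (m∸n+n≡m m≤x)
  z : ℕ
  z = 2 * m * x / p
  z-lo : z * p ≤ 2 * m * x
  z-lo = m/n*n≤m (2 * m * x) p
  z-up : 2 * m * x < suc z * p
  z-up = subst (_< suc z * p) (sym (m≡m%n+[m/n]*n (2 * m * x) p)) (+-monoˡ-< (z * p) (m%n<n (2 * m * x) p))
  choose : ∀ {g} → g ∣ p → g ∣ x ∸ m → g ≡ gcd p (x ∸ m) →
    ∃ λ tag → ∃₂ λ j z → ResidueCode m p x tag j z × j * j ≤ p × z * p ≤ 2 * m * x
  choose {g} (divides h p≡hg) (divides i d≡ig) g≡gcd with h∣x+m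
    where
    p≡gh : p ≡ g * h
    p≡gh = trans p≡hg (*-comm h g)
    instance
      g≢0 : NonZero g
      g≢0 = >-nonZero (n≢0⇒n>0 λ g≡0 → <⇒≢ 1≤p (sym (trans p≡gh (cong (_* h) g≡0))))
    h⊥i : Coprime h i
    h⊥i = gcd≡1⇒coprime (*-cancelˡ-≡ (gcd h i) 1 g (begin
      g * gcd h i          ≡⟨ c*gcd[m,n]≡gcd[cm,cn] g h i ⟩
      gcd (g * h) (g * i)  ≡⟨ cong₂ gcd (sym p≡gh) (trans (*-comm g i) (sym d≡ig)) ⟩
      gcd p (x ∸ m)        ≡⟨ sym g≡gcd ⟩
      g                    ≡⟨ sym (*-identityʳ g) ⟩
      g * 1                ∎))
      where open ≡-Reasoning
    hw≡ : h * w ≡ i * (x + m)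
    hw≡ = *-cancelˡ-≡ (h * w) (i * (x + m)) g (+-cancelʳ-≡ (m * m) _ _ (begin
      g * (h * w) + m * m          ≡⟨ cong (_+ m * m) (trans (sym (*-assoc g h w)) (cong (_* w) (sym p≡gh))) ⟩
      p * w + m * m                ≡⟨ sym x² ⟩
      x * x                        ≡⟨ cong (λ x → x * x) x-m ⟩
      (x ∸ m + m) * (x ∸ m + m)    ≡⟨ difference-of-squares (x ∸ m) m ⟩
      (x ∸ m) * (x ∸ m + m + m) + m * m
        ≡⟨ cong₂ (λ d y → d * (y + m) + m * m) (trans d≡ig (*-comm i g)) (sym x-m) ⟩
      g * i * (x + m) + m * m      ≡⟨ cong (_+ m * m) (*-assoc g i (x + m)) ⟩
      g * (i * (x + m)) + m * m    ∎))
      where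
      open ≡-Reasoning
      difference-of-squares : ∀ d m → (d + m) * (d + m) ≡ d * (d + m + m) + m * m
      difference-of-squares = ℕ-solve
    h∣x+m : h ∣ x + m
    h∣x+m = coprime-divisor h⊥i (subst (h ∣_) hw≡ (divides w (*-comm h w)))
  ... | divides k x+m≡kh with ≤-total g h
  ... | inj₁ g≤h = true , g , z , record
    { g = g ; h = h ; i = i ; k = k ; p≡gh = p≡gh ; x≡gi+m = x≡gi+m ; x+m≡hk = trans x+m≡kh (*-comm k h)
    ; j-tag = refl ; z-lower = z-lo ; z-upper = z-up } , subst (g * g ≤_) (sym p≡gh) (*-monoʳ-≤ g g≤h) , z-lo
    where
    p≡gh = trans p≡hg (*-comm h g)
    x≡gi+m = trans x-m (cong (_+ m) (trans d≡ig (*-comm i g)))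
  ... | inj₂ h≤g = false , h , z , record
    { g = g ; h = h ; i = i ; k = k ; p≡gh = p≡gh ; x≡gi+m = x≡gi+m ; x+m≡hk = trans x+m≡kh (*-comm k h)
    ; j-tag = refl ; z-lower = z-lo ; z-upper = z-up } , subst (h * h ≤_) (sym p≡gh) (*-monoˡ-≤ h h≤g) , z-lo
    where
    p≡gh = trans p≡hg (*-comm h g)
    x≡gi+m = trans x-m (cong (_+ m) (trans d≡ig (*-comm i g)))

residueCode-positive : ∀ {m p x tag j z} → 1 ≤ p → ResidueCode m p x tag j z → 1 ≤ j
residueCode-positive {tag = tag} {j} 1≤p C = go tag (ResidueCode.j-tag C)
  where
  open ResidueCode C using (g; h; p≡gh)
  go : ∀ t → j ≡ (if t then g else h) → 1 ≤ j
  go true refl = n≢0⇒n>0 λ g≡0 → <⇒≢ 1≤p (sym (trans p≡gh (cong (_* h) g≡0)))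
  go false refl = n≢0⇒n>0 λ h≡0 → <⇒≢ 1≤p (sym (trans p≡gh (trans (cong (g *_) h≡0) (*-zeroʳ g))))

-- Dyadic covering of a hyperbolic region

n<2^n : ∀ n → n < 2 ^ n
n<2^n zero = s≤s z≤n
n<2^n (suc n) = begin-strict
  suc n          <⟨ s≤s (n<2^n n) ⟩
  1 + 2 ^ n      ≤⟨ +-monoˡ-≤ (2 ^ n) (m^n>0 2 n) ⟩
  2 ^ n + 2 ^ n  ≡⟨ cong (λ z → 2 ^ n + z) (sym (+-identityʳ (2 ^ n))) ⟩
  2 ^ suc n      ∎
  where open ≤-Reasoning

dyadic : ∀ j → 1 ≤ j → ∃ λ i → 2 ^ i ≤ j × j < 2 ^ suc i
dyadic (suc zero) _ = 0 , s≤s z≤n , s≤s (s≤s z≤n)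
dyadic (suc (suc j)) _ with dyadic (suc j) (s≤s z≤n)
... | i , lo , hi with suc (suc j) <? 2 ^ suc i
... | yes lt = i , m≤n⇒m≤1+n lo , lt
... | no ≮ = suc i , ≮⇒≥ ≮ , ≤-<-trans hi (^-monoʳ-< 2 (s≤s (s≤s z≤n)) (n<1+n (suc i)))

-- If j is of size 2^i and ρ + 1 of size 2^k, then z lies below 2^(L - i - k). Each box has 2^(L +
-- 2) points, and the at most L² choices of (i, k) are the source of the squared logarithm.
hyperbolic-box : ℕ → ℕ → ℕ → List (ℕ × ℕ × ℕ)
hyperbolic-box L i k =
  cartesianProduct (upTo (2 ^ suc i)) (cartesianProduct (upTo (2 ^ suc k)) (upTo (2 ^ (L ∸ (i + k)))))

hyperbolic : ℕ → List (ℕ × ℕ × ℕ)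
hyperbolic L = concatMap (λ i → concatMap (hyperbolic-box L i) (upTo (L ∸ i))) (upTo L)

-- The roots and quotients may be 0, hence the shifts: `dyadic` wants a positive argument, and a
-- product with factor z = 0 would put no bound on j and ρ.
∈-hyperbolic : ∀ {L j ρ z} → 1 ≤ j → j * suc ρ * suc z < 2 ^ L → (j , ρ , z) ∈ hyperbolic L
∈-hyperbolic {L} {j} {ρ} {z} 1≤j lt with dyadic j 1≤j | dyadic (suc ρ) (s≤s z≤n)
... | i , i-lo , i-hi | k , k-lo , k-hi =
  ∈-concatMap-intro _ (∈-upTo⁺ (≤-<-trans (m≤m+n i k) i+k<L))
    (∈-concatMap-intro _ (∈-upTo⁺ k<L∸i)
      (∈-cartesianProduct⁺ (∈-upTo⁺ i-hi) (∈-cartesianProduct⁺ (∈-upTo⁺ (<-trans (n<1+n ρ) k-hi)) (∈-upTo⁺ z<))))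
  where
  2^i+k≤ : 2 ^ (i + k) ≤ j * suc ρ
  2^i+k≤ = subst (_≤ j * suc ρ) (sym (^-distribˡ-+-* 2 i k)) (*-mono-≤ i-lo k-lo)
  i+k<L : i + k < L
  i+k<L with i + k <? L
  ... | yes p = p
  ... | no ≮ = contradiction (≤-trans (^-monoʳ-≤ 2 (≮⇒≥ ≮)) (≤-trans 2^i+k≤ (m≤m*n (j * suc ρ) (suc z)))) (<⇒≱ lt)
  k<L∸i : k < L ∸ i
  k<L∸i = subst (_≤ L ∸ i) (m+n∸m≡n i (suc k)) (∸-monoˡ-≤ i (subst (_≤ L) (sym (+-suc i k)) i+k<L))
  z< : z < 2 ^ (L ∸ (i + k))
  z< = *-cancelˡ-< (2 ^ (i + k)) z _ (begin-strict
    2 ^ (i + k) * z                  ≤⟨ *-mono-≤ 2^i+k≤ (n≤1+n z) ⟩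
    j * suc ρ * suc z                <⟨ lt ⟩
    2 ^ L                            ≡⟨ cong (2 ^_) (sym (m+[n∸m]≡n (<⇒≤ i+k<L))) ⟩
    2 ^ (i + k + (L ∸ (i + k)))      ≡⟨ ^-distribˡ-+-* 2 (i + k) _ ⟩
    2 ^ (i + k) * 2 ^ (L ∸ (i + k))  ∎)
    where open ≤-Reasoning

length-hyperbolic : ∀ L → length (hyperbolic L) ≤ L * (L * 2 ^ (2 + L))
length-hyperbolic L = subst (λ k → length (hyperbolic L) ≤ k * (L * 2 ^ (2 + L))) (length-upTo L)
  (length-concatMap-≤ (λ i → concatMap (hyperbolic-box L i) (upTo (L ∸ i))) (upTo L) (L * 2 ^ (2 + L)) row)
  where
  box : ∀ {i k} → i < L → k < L ∸ i → length (hyperbolic-box L i k) ≤ 2 ^ (2 + L)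
  box {i} {k} i<L k<L∸i = ≤-reflexive (begin
    length (hyperbolic-box L i k)
      ≡⟨ trans (length-cartesianProduct (upTo (2 ^ suc i)) _) (cong₂ _*_ (length-upTo (2 ^ suc i))
           (trans (length-cartesianProduct (upTo (2 ^ suc k)) _) (cong₂ _*_ (length-upTo (2 ^ suc k)) (length-upTo (2 ^ (L ∸ (i + k))))))) ⟩
    2 ^ suc i * (2 ^ suc k * 2 ^ (L ∸ (i + k)))
      ≡⟨ lemma (2 ^ i) (2 ^ k) (2 ^ (L ∸ (i + k))) ⟩
    4 * (2 ^ i * 2 ^ k * 2 ^ (L ∸ (i + k)))
      ≡⟨ cong (4 *_) (trans (cong (_* 2 ^ (L ∸ (i + k))) (sym (^-distribˡ-+-* 2 i k))) (sym (^-distribˡ-+-* 2 (i + k) _))) ⟩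
    4 * 2 ^ (i + k + (L ∸ (i + k)))
      ≡⟨ cong (λ z → 4 * 2 ^ z) (m+[n∸m]≡n i+k≤L) ⟩
    4 * 2 ^ L
      ≡⟨ sym (^-distribˡ-+-* 2 2 L) ⟩
    2 ^ (2 + L) ∎)
    where
    open ≡-Reasoning
    lemma : ∀ x y z → 2 * x * (2 * y * z) ≡ 4 * (x * y * z)
    lemma = ℕ-solve
    i+k≤L : i + k ≤ L
    i+k≤L = subst (i + k ≤_) (m+[n∸m]≡n (<⇒≤ i<L)) (+-monoʳ-≤ i (<⇒≤ k<L∸i))
  row : ∀ {i} → i ∈ upTo L → length (concatMap (hyperbolic-box L i) (upTo (L ∸ i))) ≤ L * 2 ^ (2 + L)
  row {i} i∈ = begin
    length (concatMap (hyperbolic-box L i) (upTo (L ∸ i)))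
      ≤⟨ length-concatMap-≤ (hyperbolic-box L i) (upTo (L ∸ i)) (2 ^ (2 + L)) (λ k∈ → box (∈-upTo⁻ i∈) (∈-upTo⁻ k∈)) ⟩
    length (upTo (L ∸ i)) * 2 ^ (2 + L)
      ≤⟨ *-monoˡ-≤ (2 ^ (2 + L)) (≤-trans (≤-reflexive (length-upTo (L ∸ i))) (m∸n≤m L i)) ⟩
    L * 2 ^ (2 + L) ∎
    where open ≤-Reasoning

-- Size bounds relative to the smallest member

cube-cancel-< : ∀ {x y} → x * x * x < y * y * y → x < y
cube-cancel-< {x} {y} lt with x <? y
... | yes p = p
... | no ≮ = contradiction (*-mono-≤ (*-mono-≤ (≮⇒≥ ≮) (≮⇒≥ ≮)) (≮⇒≥ ≮)) (<⇒≱ lt)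

-- One record for both cases: p is the smallest of a, b, e, the others are q and w, and ρ and x are
-- the roots that belong to pq and pw. The bound on ρ² covers ab + n as well as ea + n², because |n|
-- ≤ n².
record Edges (m N p q w ρ x j z : ℕ) : Set where
  field
    1≤m : 1 ≤ m
    1≤p : 1 ≤ p
    p≤q : p ≤ q
    p≤w : p ≤ w
    pqw≤ : p * q * w ≤ 27 * (m * m) * N
    ρ²≤ : ρ * ρ ≤ p * q + m * m
    x² : x * x ≡ p * w + m * m
    j²≤p : j * j ≤ p
    zp≤ : z * p ≤ 2 * m * x

module _ {m N p q w ρ x j z l : ℕ} (H : Edges m N p q w ρ x j z) (N< : N < 2 ^ (6 * l + 6)) where
  open Edges H
  open ≤-Reasoning

  private
    M = m * m
    1≤M : 1 ≤ M
    1≤M = *-mono-≤ 1≤m 1≤m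
    1≤q : 1 ≤ q
    1≤q = ≤-trans 1≤p p≤q
    1≤w : 1 ≤ w
    1≤w = ≤-trans 1≤p p≤w

  -- p³ ≤ pqw = O(N), so p is O(N^{1/3}), that is, a constant times 2^(2l).
  p-bound : p < 2 ^ (2 * l + m + 4)
  p-bound = cube-cancel-< (begin-strict
    p * p * p                        ≤⟨ *-mono-≤ (*-monoʳ-≤ p p≤q) p≤w ⟩
    p * q * w                        ≤⟨ pqw≤ ⟩
    27 * M * N
      ≤⟨ *-monoˡ-≤ N (*-mono-≤ {27} {32} {M} {2 ^ m * 2 ^ m} (m≤m+n 27 5) (*-mono-≤ m≤2^m m≤2^m)) ⟩
    32 * (2 ^ m * 2 ^ m) * N
      <⟨ *-monoʳ-< (32 * (2 ^ m * 2 ^ m)) {{>-nonZero (*-mono-≤ {1} {32} (s≤s z≤n) (*-mono-≤ (m^n>0 2 m) (m^n>0 2 m)))}} N< ⟩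
    32 * (2 ^ m * 2 ^ m) * 2 ^ (6 * l + 6)
      ≡⟨ cong₂ (λ x y → x * y) (trans (cong (32 *_) (sym (^-distribˡ-+-* 2 m m))) (sym (^-distribˡ-+-* 2 5 (m + m)))) refl ⟩
    2 ^ (5 + (m + m)) * 2 ^ (6 * l + 6)
      ≡⟨ sym (^-distribˡ-+-* 2 (5 + (m + m)) (6 * l + 6)) ⟩
    2 ^ (5 + (m + m) + (6 * l + 6))
      ≤⟨ ^-monoʳ-≤ 2 (subst (5 + (m + m) + (6 * l + 6) ≤_) (lemma l m) (m≤m+n _ (m + 1))) ⟩
    2 ^ (A + A + A)
      ≡⟨ trans (^-distribˡ-+-* 2 (A + A) A) (cong (_* 2 ^ A) (^-distribˡ-+-* 2 A A)) ⟩
    2 ^ A * 2 ^ A * 2 ^ A            ∎)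
    where
    A = 2 * l + m + 4
    m≤2^m : m ≤ 2 ^ m
    m≤2^m = <⇒≤ (n<2^n m)
    lemma : ∀ l m → 5 + (m + m) + (6 * l + 6) + (m + 1) ≡ 2 * l + m + 4 + (2 * l + m + 4) + (2 * l + m + 4)
    lemma = ℕ-solve

  root-bound : suc ρ * suc ρ ≤ 6 * M * (p * q)
  root-bound = begin
    -- Adding the square of ρ - 1 removes the linear term: the sum is 2ρ² + 2. Truncation at ρ = 0
    -- makes this an inequality.
    suc ρ * suc ρ                    ≤⟨ m≤m+n _ ((ρ ∸ 1) * (ρ ∸ 1)) ⟩
    suc ρ * suc ρ + (ρ ∸ 1) * (ρ ∸ 1) ≤⟨ parallelogram ρ ⟩
    2 * (ρ * ρ) + 2                  ≤⟨ +-monoˡ-≤ 2 (*-monoʳ-≤ 2 ρ²≤) ⟩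
    2 * (p * q + M) + 2
      ≤⟨ +-mono-≤ (*-monoʳ-≤ 2 (+-mono-≤ (≤-trans (≤-reflexive (sym (*-identityˡ (p * q)))) (*-monoˡ-≤ (p * q) 1≤M)) M≤)) (*-monoʳ-≤ 2 (*-mono-≤ 1≤M 1≤pq)) ⟩
    2 * (M * (p * q) + M * (p * q)) + 2 * (M * (p * q)) ≡⟨ lemma M (p * q) ⟩
    6 * M * (p * q)                  ∎
    where
    1≤pq : 1 ≤ p * q
    1≤pq = *-mono-≤ 1≤p 1≤q
    M≤ : M ≤ M * (p * q)
    M≤ = ≤-trans (≤-reflexive (sym (*-identityʳ M))) (*-monoʳ-≤ M 1≤pq)
    lemma : ∀ M r → 2 * (M * r + M * r) + 2 * (M * r) ≡ 6 * M * r
    lemma = ℕ-solve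
    parallelogram : ∀ ρ → suc ρ * suc ρ + (ρ ∸ 1) * (ρ ∸ 1) ≤ 2 * (ρ * ρ) + 2
    parallelogram zero = s≤s z≤n
    parallelogram (suc ρ) = ≤-reflexive (lemma′ ρ)
      where
      lemma′ : ∀ ρ → suc (suc ρ) * suc (suc ρ) + ρ * ρ ≡ 2 * (suc ρ * suc ρ) + 2
      lemma′ = ℕ-solve

  -- From p² ≤ pw ≤ x² follows p ≤ x, so passing from z to z + 1 costs at most one more x, and (z +
  -- 1)p ≤ 3mx. Squaring brings in x² = pw + m².
  quotient-bound : suc z * p * (suc z * p) ≤ 18 * (M * M) * (p * w)
  quotient-bound = begin
    suc z * p * (suc z * p)          ≤⟨ *-mono-≤ zp+p≤ zp+p≤ ⟩
    3 * m * x * (3 * m * x)          ≡⟨ lemma m x ⟩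
    9 * M * (x * x)                  ≡⟨ cong (9 * M *_) x² ⟩
    9 * M * (p * w + M)
      ≤⟨ *-monoʳ-≤ (9 * M) (+-mono-≤ (≤-trans (≤-reflexive (sym (*-identityˡ (p * w)))) (*-monoˡ-≤ (p * w) 1≤M)) (≤-trans (≤-reflexive (sym (*-identityʳ M))) (*-monoʳ-≤ M (*-mono-≤ 1≤p 1≤w)))) ⟩
    9 * M * (M * (p * w) + M * (p * w)) ≡⟨ lemma′ M (p * w) ⟩
    18 * (M * M) * (p * w)           ∎
    where
    lemma : ∀ m x → 3 * m * x * (3 * m * x) ≡ 9 * (m * m) * (x * x)
    lemma = ℕ-solve
    lemma′ : ∀ M r → 9 * M * (M * r + M * r) ≡ 18 * (M * M) * r
    lemma′ = ℕ-solve
    p≤x : p ≤ x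
    p≤x = square-cancel-≤ (≤-trans (*-monoʳ-≤ p p≤w) (subst (p * w ≤_) (sym x²) (m≤m+n (p * w) M)))
    zp+p≤ : suc z * p ≤ 3 * m * x
    zp+p≤ = begin
      p + z * p
        ≤⟨ +-mono-≤ (≤-trans p≤x (≤-trans (≤-reflexive (sym (*-identityˡ x))) (*-monoˡ-≤ x 1≤m))) zp≤ ⟩
      m * x + 2 * m * x  ≡⟨ lemma″ m x ⟩
      3 * m * x          ∎
      where
      lemma″ : ∀ m x → m * x + 2 * m * x ≡ 3 * m * x
      lemma″ = ℕ-solve

  -- The bounds j² ≤ p, (ρ + 1)² = O(pq) and ((z + 1)p)² = O(pw) multiply to p² times O(pqw). After
  -- cancelling p² the product is O(√(pqw)) = O(√N).
  product-bound : j * suc ρ * suc z < 2 ^ (3 * l + 4 * m + 9)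
  product-bound = square-cancel-< (*-cancelˡ-< (p * p) _ _ (begin-strict
    p * p * (W * W)                              ≡⟨ lemma₁ p j (suc ρ) (suc z) ⟩
    j * j * (suc ρ * suc ρ) * (suc z * p * (suc z * p))
      ≤⟨ *-mono-≤ (*-mono-≤ j²≤p root-bound) quotient-bound ⟩
    p * (6 * M * (p * q)) * (18 * (M * M) * (p * w)) ≡⟨ lemma₂ p q w M ⟩
    p * p * (108 * (M * M * M) * (p * q * w))    ≤⟨ *-monoʳ-≤ (p * p) (*-monoʳ-≤ (108 * (M * M * M)) pqw≤) ⟩
    p * p * (108 * (M * M * M) * (27 * M * N))   <⟨ *-monoʳ-< (p * p) {{>-nonZero (*-mono-≤ 1≤p 1≤p)}} (begin-strict
      108 * (M * M * M) * (27 * M * N)             ≡⟨ lemma₃ M N ⟩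
      2916 * (M * M * M * M) * N
        ≤⟨ *-monoˡ-≤ N (*-mono-≤ {2916} {4096} {M * M * M * M} {Q * Q * Q * Q} (m≤m+n 2916 1180) (*-mono-≤ (*-mono-≤ (*-mono-≤ M≤Q M≤Q) M≤Q) M≤Q)) ⟩
      4096 * (Q * Q * Q * Q) * N
        <⟨ *-monoʳ-< (4096 * (Q * Q * Q * Q)) {{>-nonZero (*-mono-≤ {1} {4096} (s≤s z≤n) (*-mono-≤ (*-mono-≤ (*-mono-≤ 1≤Q 1≤Q) 1≤Q) 1≤Q))}} N< ⟩
      4096 * (Q * Q * Q * Q) * 2 ^ (6 * l + 6)     ≡⟨ powers ⟩
      2 ^ A * 2 ^ A                                ∎) ⟩
    p * p * (2 ^ A * 2 ^ A)                      ∎))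
    where
    W = j * suc ρ * suc z
    A = 3 * l + 4 * m + 9
    Q = 2 ^ (m + m)
    M≤Q : M ≤ Q
    M≤Q = subst (M ≤_) (sym (^-distribˡ-+-* 2 m m)) (*-mono-≤ (<⇒≤ (n<2^n m)) (<⇒≤ (n<2^n m)))
    1≤Q : 1 ≤ Q
    1≤Q = m^n>0 2 (m + m)
    lemma₁ : ∀ p j r z → p * p * (j * r * z * (j * r * z)) ≡ j * j * (r * r) * (z * p * (z * p))
    lemma₁ = ℕ-solve
    lemma₂ : ∀ p q w M → p * (6 * M * (p * q)) * (18 * (M * M) * (p * w)) ≡ p * p * (108 * (M * M * M) * (p * q * w))
    lemma₂ = ℕ-solve
    lemma₃ : ∀ M N → 108 * (M * M * M) * (27 * M * N) ≡ 2916 * (M * M * M * M) * N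
    lemma₃ = ℕ-solve
    powers : 4096 * (Q * Q * Q * Q) * 2 ^ (6 * l + 6) ≡ 2 ^ A * 2 ^ A
    powers = begin-equality
      4096 * (Q * Q * Q * Q) * 2 ^ (6 * l + 6)
        ≡⟨ cong (λ z → 4096 * z * 2 ^ (6 * l + 6)) (sym (trans (^-distribˡ-+-* 2 (u + u + u) u)
             (cong (_* Q) (trans (^-distribˡ-+-* 2 (u + u) u) (cong (_* Q) (^-distribˡ-+-* 2 u u)))))) ⟩
      4096 * 2 ^ (u + u + u + u) * 2 ^ (6 * l + 6)
        ≡⟨ cong (_* 2 ^ (6 * l + 6)) (sym (^-distribˡ-+-* 2 12 (u + u + u + u))) ⟩
      2 ^ (12 + (u + u + u + u)) * 2 ^ (6 * l + 6)
        ≡⟨ sym (^-distribˡ-+-* 2 (12 + (u + u + u + u)) (6 * l + 6)) ⟩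
      2 ^ (12 + (u + u + u + u) + (6 * l + 6))
        ≡⟨ cong (2 ^_) (lemma₄ l m) ⟩
      2 ^ (A + A)
        ≡⟨ ^-distribˡ-+-* 2 A A ⟩
      2 ^ A * 2 ^ A ∎
      where
      u = m + m
      lemma₄ : ∀ l m → 12 + (m + m + (m + m) + (m + m) + (m + m)) + (6 * l + 6) ≡ 3 * l + 4 * m + 9 + (3 * l + 4 * m + 9)
      lemma₄ = ℕ-solve

-- Coprime pairs

coprimes : ℕ → ℕ → List ℕ
coprimes y L = filter (λ v → gcd y v ≟ 1) (range L)

∈-coprimes⁻ : ∀ {y L v} → v ∈ coprimes y L → (1 ≤ v × v ≤ L) × gcd y v ≡ 1
∈-coprimes⁻ {y} {L} p with ∈-filter⁻ (λ v → gcd y v ≟ 1) {xs = range L} p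
... | q , e = ∈-range⁻ {L} q , e

∈-coprimes⁺ : ∀ {y L v} → 1 ≤ v → v ≤ L → gcd y v ≡ 1 → v ∈ coprimes y L
∈-coprimes⁺ {y} p q e = ∈-filter⁺ (λ v → gcd y v ≟ 1) (∈-range⁺ p q) e

coprimes-unique : ∀ y L → Unique (coprimes y L)
coprimes-unique y L = Uniqueₚ.filter⁺ _ (range-unique L)

length-coprimes-mono : ∀ y {L L′} → L ≤ L′ → length (coprimes y L) ≤ length (coprimes y L′)
length-coprimes-mono y {L} {L′} L≤L′ = length-≤-by-injection _≡_ (coprimes y L) (coprimes y L′) (coprimes-unique y L)
  (λ {v} v∈ → let (1≤v , v≤L) , e = ∈-coprimes⁻ {y} {L} v∈ in v , ∈-coprimes⁺ {y} 1≤v (≤-trans v≤L L≤L′) e , refl)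
  λ { _ _ refl refl → refl }

coprime-region : (ℕ → ℕ) → ℕ → List (ℕ × ℕ)
coprime-region w zero = []
coprime-region w (suc Y) = coprime-region w Y ++ map (λ v → (suc Y , v)) (coprimes (suc Y) (w (suc Y)))

∈-region⁺ : ∀ {w Y y v} → 1 ≤ y → y ≤ Y → 1 ≤ v → v ≤ w y → gcd y v ≡ 1 → (y , v) ∈ coprime-region w Y
∈-region⁺ {w} {suc Y} {y} {v} 1≤y y≤Y 1≤v v≤ e with m≤n⇒m<n∨m≡n y≤Y
... | inj₁ (s≤s y≤) = ∈-++⁺ˡ (∈-region⁺ 1≤y y≤ 1≤v v≤ e)
... | inj₂ refl = ∈-++⁺ʳ (coprime-region w Y) (∈-map⁺ (λ v → (suc Y , v)) (∈-coprimes⁺ {suc Y} 1≤v v≤ e))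
∈-region⁺ {Y = zero} (s≤s z≤n) ()

∈-region⁻ : ∀ {w Y y v} → (y , v) ∈ coprime-region w Y → (1 ≤ y × y ≤ Y) × (1 ≤ v × v ≤ w y) × gcd y v ≡ 1
∈-region⁻ {w} {suc Y} p with ∈-++⁻ (coprime-region w Y) p
... | inj₁ q = let (1≤y , y≤Y) , r = ∈-region⁻ {w} {Y} q in (1≤y , m≤n⇒m≤1+n y≤Y) , r
... | inj₂ q with ∈-map⁻ (λ v → (suc Y , v)) q
... | v , v∈ , refl with ∈-coprimes⁻ {suc Y} {w (suc Y)} v∈
... | b , e = (s≤s z≤n , ≤-refl) , b , e

region-unique : ∀ w Y → Unique (coprime-region w Y)
region-unique w zero = []
region-unique w (suc Y) = Uniqueₚ.++⁺ (region-unique w Y) (Uniqueₚ.map⁺ (λ { refl → refl }) (coprimes-unique (suc Y) (w (suc Y)))) disjoint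
  where
  disjoint : ∀ {z} → ¬ (z ∈ coprime-region w Y × z ∈ map (λ v → (suc Y , v)) (coprimes (suc Y) (w (suc Y))))
  disjoint (p , q) with ∈-map⁻ (λ v → (suc Y , v)) q
  ... | v , _ , refl = contradiction (proj₂ (proj₁ (∈-region⁻ {w} {Y} p))) 1+n≰n

length-region-suc : ∀ w Y → length (coprime-region w (suc Y)) ≡ length (coprime-region w Y) + length (coprimes (suc Y) (w (suc Y)))
length-region-suc w Y = trans (length-++ (coprime-region w Y)) (cong (λ z → length (coprime-region w Y) + z) (length-map {B = ℕ × ℕ} (λ v → (suc Y , v)) (coprimes (suc Y) (w (suc Y)))))

-- The entry (d, i, k) stands for the pair (id, kd), and d runs from 2 to K + 1. These pairs exhaust
-- the noncoprime ones of a Y by L box once K is at least Y.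
common-multiples : ℕ → ℕ → ℕ → List (ℕ × ℕ × ℕ)
common-multiples Y L zero = []
common-multiples Y L (suc K) = common-multiples Y L K ++ map (λ ik → (2 + K , ik)) (cartesianProduct (range (Y / (2 + K))) (range (L / (2 + K))))

∈-common-multiples : ∀ {Y L K d i k} → 2 ≤ d → d ≤ 1 + K → 1 ≤ i → i * d ≤ Y → 1 ≤ k → k * d ≤ L →
  (d , i , k) ∈ common-multiples Y L K
∈-common-multiples {K = zero} (s≤s (s≤s _)) (s≤s ())
∈-common-multiples {Y} {L} {suc K} {d} {i} {k} 2≤d d≤ 1≤i id≤ 1≤k kd≤ with m≤n⇒m<n∨m≡n d≤
... | inj₁ (s≤s d≤′) = ∈-++⁺ˡ (∈-common-multiples 2≤d d≤′ 1≤i id≤ 1≤k kd≤)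
... | inj₂ refl = ∈-++⁺ʳ (common-multiples Y L K) (∈-map⁺ (λ ik → (2 + K , ik))
  (∈-cartesianProduct⁺ (∈-range⁺ 1≤i (quotient id≤)) (∈-range⁺ 1≤k (quotient kd≤))))
  where
  quotient : ∀ {i Y} → i * (2 + K) ≤ Y → i ≤ Y / (2 + K)
  quotient {i} {Y} h = subst (_≤ Y / (2 + K)) (m*n/n≡m i (2 + K)) (/-monoˡ-≤ (2 + K) h)

-- Σ_{d=2}^{K+1} 1/d² ≤ 3/4 − 1/(K+1), cleared of denominators.
length-common-multiples : ∀ Y L K → 4 * (2 + K) * length (common-multiples Y L (suc K)) + 4 * (Y * L) ≤ 3 * (2 + K) * (Y * L)
length-common-multiples Y L K = go K
  where
  open ≤-Reasoning
  W = Y * L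
  f : ℕ → ℕ
  f K = Y / (2 + K) * (L / (2 + K))
  len : ∀ K → length (common-multiples Y L (suc K)) ≡ length (common-multiples Y L K) + f K
  len K = trans (length-++ (common-multiples Y L K)) (cong (λ z → length (common-multiples Y L K) + z)
    (trans (length-map {B = ℕ × ℕ × ℕ} (λ ik → (2 + K , ik)) (cartesianProduct (range (Y / (2 + K))) (range (L / (2 + K)))))
      (trans (length-cartesianProduct (range (Y / (2 + K))) (range (L / (2 + K)))) (cong₂ _*_ (length-range (Y / (2 + K))) (length-range (L / (2 + K)))))))
  f≤ : ∀ K → (2 + K) * (2 + K) * f K ≤ W
  f≤ K = subst (_≤ W) (lemma (Y / (2 + K)) (L / (2 + K)) (2 + K)) (*-mono-≤ (m/n*n≤m Y (2 + K)) (m/n*n≤m L (2 + K)))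
    where
    lemma : ∀ i k d → i * d * (k * d) ≡ d * d * (i * k)
    lemma = ℕ-solve
  go : ∀ K → 4 * (2 + K) * length (common-multiples Y L (suc K)) + 4 * W ≤ 3 * (2 + K) * W
  go zero = begin
    4 * 2 * length (common-multiples Y L 1) + 4 * W ≡⟨ cong (λ z → 4 * 2 * z + 4 * W) (len 0) ⟩
    8 * f 0 + 4 * W      ≡⟨ cong (_+ 4 * W) (lemma (f 0)) ⟩
    2 * (4 * f 0) + 4 * W ≤⟨ +-monoˡ-≤ (4 * W) (*-monoʳ-≤ 2 (f≤ 0)) ⟩
    2 * W + 4 * W        ≡⟨ lemma′ W ⟩
    3 * 2 * W            ∎
    where
    lemma : ∀ x → 8 * x ≡ 2 * (4 * x)
    lemma = ℕ-solve
    lemma′ : ∀ x → 2 * x + 4 * x ≡ 3 * 2 * x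
    lemma′ = ℕ-solve
  -- With D = K + 2 the sum telescopes through 1/(D + 1)² ≤ 1/D - 1/(D + 1).
  go (suc K) = subst (λ z → 4 * (1 + D) * z + 4 * W ≤ 3 * (1 + D) * W) (sym (len (suc K)))
    (*-cancelˡ-≤ D (+-cancelʳ-≤ ((1 + D) * (4 * W)) _ _ (begin
      D * (4 * (1 + D) * (S + F) + 4 * W) + (1 + D) * (4 * W)       ≡⟨ lemma₁ D S F W ⟩
      (1 + D) * (4 * D * S + 4 * W) + 4 * (D * ((1 + D) * F)) + 4 * (D * W)
        ≤⟨ +-monoˡ-≤ (4 * (D * W)) (+-mono-≤ (*-monoʳ-≤ (1 + D) (go K)) (*-monoʳ-≤ 4 D[1+D]F≤W)) ⟩
      (1 + D) * (3 * D * W) + 4 * W + 4 * (D * W)                   ≡⟨ lemma₂ D W ⟩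
      D * (3 * (1 + D) * W) + (1 + D) * (4 * W)                     ∎)))
    where
    D = 2 + K
    S = length (common-multiples Y L (suc K))
    F = f (suc K)
    D[1+D]F≤W : D * ((1 + D) * F) ≤ W
    D[1+D]F≤W = begin
      D * ((1 + D) * F)        ≤⟨ *-monoˡ-≤ ((1 + D) * F) (n≤1+n D) ⟩
      (1 + D) * ((1 + D) * F)  ≡⟨ sym (*-assoc (1 + D) (1 + D) F) ⟩
      (1 + D) * (1 + D) * F    ≤⟨ f≤ (suc K) ⟩
      W                        ∎
    lemma₁ : ∀ D S F W → D * (4 * (1 + D) * (S + F) + 4 * W) + (1 + D) * (4 * W) ≡
      (1 + D) * (4 * D * S + 4 * W) + 4 * (D * ((1 + D) * F)) + 4 * (D * W)
    lemma₁ = ℕ-solve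
    lemma₂ : ∀ D W → (1 + D) * (3 * D * W) + 4 * W + 4 * (D * W) ≡ D * (3 * (1 + D) * W) + (1 + D) * (4 * W)
    lemma₂ = ℕ-solve

data Reduced : ℕ × ℕ → (ℕ × ℕ) ⊎ (ℕ × ℕ × ℕ) → Set where
  coprime : ∀ {x} → Reduced x (inj₁ x)
  multiple : ∀ {y v d i k} → y ≡ i * d → v ≡ k * d → Reduced (y , v) (inj₂ (d , i , k))

coprime-box : ∀ Y L → Y * L ≤ 4 * length (coprime-region (λ _ → L) Y)
coprime-box zero L = z≤n
coprime-box Y@(suc K) L = +-cancelʳ-≤ (3 * (Y * L)) (Y * L) (4 * P) (begin
  Y * L + 3 * (Y * L)        ≡⟨ lemma (Y * L) ⟩
  4 * (Y * L)                ≤⟨ *-monoʳ-≤ 4 all≤ ⟩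
  4 * (P + Q)                ≡⟨ *-distribˡ-+ 4 P Q ⟩
  4 * P + 4 * Q              ≤⟨ +-monoʳ-≤ (4 * P) 4Q≤ ⟩
  4 * P + 3 * (Y * L)        ∎)
  where
  open ≤-Reasoning
  coprime-pairs = coprime-region (λ _ → L) Y
  multiples = common-multiples Y L Y
  P = length coprime-pairs
  Q = length multiples
  lemma : ∀ x → x + 3 * x ≡ 4 * x
  lemma = ℕ-solve
  4Q≤ : 4 * Q ≤ 3 * (Y * L)
  4Q≤ = *-cancelˡ-≤ (2 + K) (begin
    (2 + K) * (4 * Q)                ≡⟨ lemma′ (2 + K) Q ⟩
    4 * (2 + K) * Q                  ≤⟨ m≤m+n _ _ ⟩
    4 * (2 + K) * Q + 4 * (Y * L)    ≤⟨ length-common-multiples Y L K ⟩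
    3 * (2 + K) * (Y * L)            ≡⟨ lemma″ (2 + K) (Y * L) ⟩
    (2 + K) * (3 * (Y * L))          ∎)
    where
    lemma′ : ∀ d q → d * (4 * q) ≡ 4 * d * q
    lemma′ = ℕ-solve
    lemma″ : ∀ d q → 3 * d * q ≡ d * (3 * q)
    lemma″ = ℕ-solve
  targets = sum-list coprime-pairs multiples
  total : ∀ {x} → x ∈ cartesianProduct (range Y) (range L) → ∃ λ t → t ∈ targets × Reduced x t
  total {y , v} x∈ with ∈-cartesianProduct⁻ (range Y) (range L) x∈
  ... | y∈ , v∈ with ∈-range⁻ {Y} y∈ | ∈-range⁻ {L} v∈
  ... | 1≤y , y≤Y | 1≤v , v≤L with gcd y v ≟ 1
  ... | yes e = _ , ∈-sumˡ (∈-region⁺ 1≤y y≤Y 1≤v v≤L e) , coprime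
  ... | no e with gcd[m,n]∣m y v | gcd[m,n]∣n y v
  ... | divides i y≡ | divides k v≡ = _ , ∈-sumʳ {xs = coprime-pairs}
    (∈-common-multiples {Y} {L} {Y} 2≤d d≤ (positive i y≡ 1≤y) (subst (_≤ Y) y≡ y≤Y) (positive k v≡ 1≤v) (subst (_≤ L) v≡ v≤L)) , multiple y≡ v≡
    where
    d = gcd y v
    positive : ∀ {x} i → x ≡ i * d → 1 ≤ x → 1 ≤ i
    positive zero refl ()
    positive (suc i) _ _ = s≤s z≤n
    d≢0 : d ≢ 0
    d≢0 = gcd[m,n]≢0 y v (inj₁ (λ { refl → contradiction 1≤y λ () }))
    2≤d : 2 ≤ d
    2≤d = ≤∧≢⇒< (n≢0⇒n>0 d≢0) (λ e′ → e (sym e′))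
    d≤ : d ≤ 1 + Y
    d≤ = m≤n⇒m≤1+n (≤-trans (∣⇒≤ {{>-nonZero 1≤y}} (gcd[m,n]∣m y v)) y≤Y)
  injective : ∀ {x x′ t} → Reduced x t → Reduced x′ t → x ≡ x′
  injective coprime coprime = refl
  injective (multiple p q) (multiple p′ q′) = cong₂ _,_ (trans p (sym p′)) (trans q (sym q′))
  all≤ : Y * L ≤ P + Q
  all≤ = begin
    Y * L
      ≡⟨ sym (trans (length-cartesianProduct (range Y) (range L)) (cong₂ _*_ (length-range Y) (length-range L))) ⟩
    length (cartesianProduct (range Y) (range L))
      ≤⟨ length-≤-by-injection Reduced _ targets (Uniqueₚ.cartesianProduct⁺ (range-unique Y) (range-unique L)) total (λ _ _ → injective) ⟩
    length targets                                  ≡⟨ length-sum coprime-pairs multiples ⟩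
    P + Q                                           ∎

length-region-box : ∀ L Y → length (coprime-region (λ _ → L) Y) ≤ Y * L
length-region-box L zero = z≤n
length-region-box L (suc Y) = begin
  length (coprime-region (λ _ → L) (suc Y))  ≡⟨ length-region-suc (λ _ → L) Y ⟩
  length (coprime-region (λ _ → L) Y) + length (coprimes (suc Y) L)
    ≤⟨ +-mono-≤ (length-region-box L Y) (≤-trans (length-filter _ (range L)) (≤-reflexive (length-range L))) ⟩
  Y * L + L                                  ≡⟨ +-comm (Y * L) L ⟩
  suc Y * L                                  ∎
  where open ≤-Reasoning

-- The columns beyond Y are at least as high as those of the box of height L, so they hold at least
-- as many coprime pairs. The comparison is additive to avoid truncated subtraction.
region-strip : ∀ w L Y Z → (∀ y → 1 ≤ y → y ≤ Y + Z → L ≤ w y) →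
  length (coprime-region w Y) + length (coprime-region (λ _ → L) (Y + Z)) ≤
  length (coprime-region w (Y + Z)) + length (coprime-region (λ _ → L) Y)
region-strip w L Y zero h rewrite +-identityʳ Y = ≤-refl
region-strip w L Y (suc Z) h rewrite +-suc Y Z = begin
  length (coprime-region w Y) + length (coprime-region c (suc (Y + Z)))
    ≡⟨ cong (λ z → length (coprime-region w Y) + z) (length-region-suc c (Y + Z)) ⟩
  length (coprime-region w Y) + (length (coprime-region c (Y + Z)) + length (coprimes (suc (Y + Z)) L))
    ≡⟨ sym (+-assoc (length (coprime-region w Y)) _ _) ⟩
  length (coprime-region w Y) + length (coprime-region c (Y + Z)) + length (coprimes (suc (Y + Z)) L)
    ≤⟨ +-mono-≤ (region-strip w L Y Z (λ y 1≤y y≤ → h y 1≤y (m≤n⇒m≤1+n y≤))) (length-coprimes-mono (suc (Y + Z)) (h (suc (Y + Z)) (s≤s z≤n) ≤-refl)) ⟩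
  length (coprime-region w (Y + Z)) + length (coprime-region c Y) + length (coprimes (suc (Y + Z)) (w (suc (Y + Z))))
    ≡⟨ lemma (length (coprime-region w (Y + Z))) (length (coprime-region c Y)) _ ⟩
  length (coprime-region w (Y + Z)) + length (coprimes (suc (Y + Z)) (w (suc (Y + Z)))) + length (coprime-region c Y)
    ≡⟨ cong (_+ length (coprime-region c Y)) (sym (length-region-suc w (Y + Z))) ⟩
  length (coprime-region w (suc (Y + Z))) + length (coprime-region c Y) ∎
  where
  open ≤-Reasoning
  c : ℕ → ℕ
  c _ = L
  lemma : ∀ x y z → x + y + z ≡ x + z + y
  lemma = ℕ-solve

-- Coprime pairs under a hyperbola

hyperbola : ℕ → ℕ → ℕ
hyperbola A zero = zero
hyperbola A (suc y) = A / suc y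

hyperbola-≤ : ∀ A y → y * hyperbola A y ≤ A
hyperbola-≤ A zero = z≤n
hyperbola-≤ A (suc y) = subst (_≤ A) (*-comm (A / suc y) (suc y)) (m/n*n≤m A (suc y))

≤-hyperbola : ∀ {A y L} → 1 ≤ y → L * y ≤ A → L ≤ hyperbola A y
≤-hyperbola {A} {suc y} {L} _ h = subst (_≤ A / suc y) (m*n/n≡m L (suc y)) (/-monoˡ-≤ (suc y) h)

-- Each of the J strips 8^j < y ≤ 8^(j+1) below the hyperbola contributes at least M 8^J / 8.
coprime-hyperbola : ∀ M J j → j ≤ J →
  j * (M * 8 ^ J) ≤ 8 * length (coprime-region (hyperbola (M * 8 ^ J)) (8 ^ j))
coprime-hyperbola M J zero _ = z≤n
-- The base 8 is chosen so that something remains: the box of width 8^(j+1) and area A holds at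
-- least A/4 coprime pairs, and at most A/8 of them lie in the columns up to 8^j.
coprime-hyperbola M J (suc j) 1+j≤J = +-cancelʳ-≤ (8 * (8 ^ j * L)) _ _ (begin
  A + j * A + 8 * (8 ^ j * L)                    ≡⟨ cong (λ z → A + j * A + z) 8·8ʲL≡A ⟩
  A + j * A + A                                  ≡⟨ lemma (j * A) A ⟩
  j * A + 2 * A
    ≤⟨ +-mono-≤ (coprime-hyperbola M J j (<⇒≤ 1+j≤J)) (*-monoʳ-≤ 2 box) ⟩
  8 * length (region Y) + 2 * (4 * length (strip Y′))  ≡⟨ lemma′ (length (region Y)) (length (strip Y′)) ⟩
  8 * (length (region Y) + length (strip Y′))    ≤⟨ *-monoʳ-≤ 8 compare ⟩
  8 * (length (region Y′) + length (strip Y))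
    ≤⟨ *-monoʳ-≤ 8 (+-monoʳ-≤ (length (region Y′)) (length-region-box L Y)) ⟩
  8 * (length (region Y′) + Y * L)               ≡⟨ *-distribˡ-+ 8 (length (region Y′)) (Y * L) ⟩
  8 * length (region Y′) + 8 * (Y * L)           ∎)
  where
  open ≤-Reasoning
  A = M * 8 ^ J
  Y = 8 ^ j
  Y′ = 8 ^ suc j
  L = M * 8 ^ (J ∸ suc j)
  region strip : ℕ → List (ℕ × ℕ)
  region = coprime-region (hyperbola A)
  strip = coprime-region (λ _ → L)
  8ʲ⁺¹L≡A : Y′ * L ≡ A
  8ʲ⁺¹L≡A = trans (swap Y′ M (8 ^ (J ∸ suc j))) (cong (M *_) (trans (sym (^-distribˡ-+-* 8 (suc j) (J ∸ suc j))) (cong (8 ^_) (m+[n∸m]≡n 1+j≤J))))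
    where
    swap : ∀ x M y → x * (M * y) ≡ M * (x * y)
    swap = ℕ-solve
  8·8ʲL≡A : 8 * (Y * L) ≡ A
  8·8ʲL≡A = trans (sym (*-assoc 8 Y L)) 8ʲ⁺¹L≡A
  box : A ≤ 4 * length (strip Y′)
  box = subst (_≤ 4 * length (strip Y′)) 8ʲ⁺¹L≡A (coprime-box Y′ L)
  L≤ : ∀ y → 1 ≤ y → y ≤ Y′ → L ≤ hyperbola A y
  L≤ y 1≤y y≤ = ≤-hyperbola 1≤y (subst (L * y ≤_) (trans (*-comm L Y′) 8ʲ⁺¹L≡A) (*-monoʳ-≤ L y≤))
  compare : length (region Y) + length (strip Y′) ≤ length (region Y′) + length (strip Y)
  compare = subst (λ Z → length (region Y) + length (strip Z) ≤ length (region Z) + length (strip Y))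
    (m+[n∸m]≡n (^-monoʳ-≤ 8 (n≤1+n j)))
    (region-strip (hyperbola A) L Y (Y′ ∸ Y) λ y 1≤y y≤ → L≤ y 1≤y (subst (y ≤_) (m+[n∸m]≡n (^-monoʳ-≤ 8 (n≤1+n j))) y≤))
  lemma : ∀ x A → A + x + A ≡ x + 2 * A
  lemma = ℕ-solve
  lemma′ : ∀ x y → 8 * x + 2 * (4 * y) ≡ 8 * (x + y)
  lemma′ = ℕ-solve

-- Growth

-- The cube root and the square root of N both enter the count; with 2^(6l) as the size of N they
-- become 2^(2l) and 2^(3l).
sixth-root : ∀ N → 1 ≤ N → ∃ λ l → 2 ^ (6 * l) ≤ N × N < 2 ^ (6 * l + 6)
sixth-root N 1≤N with dyadic N 1≤N
... | i , lo , hi = i / 6 ,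
  ≤-trans (^-monoʳ-≤ 2 (subst (_≤ i) (*-comm (i / 6) 6) (m/n*n≤m i 6))) lo ,
  <-≤-trans hi (^-monoʳ-≤ 2 (begin
    suc i                      ≡⟨ cong suc (m≡m%n+[m/n]*n i 6) ⟩
    suc (i % 6) + i / 6 * 6    ≤⟨ +-monoˡ-≤ (i / 6 * 6) (m%n<n i 6) ⟩
    6 + i / 6 * 6              ≡⟨ trans (+-comm 6 _) (cong (_+ 6) (*-comm (i / 6) 6)) ⟩
    6 * (i / 6) + 6            ∎))
  where open ≤-Reasoning

sixth-root-≥ : ∀ {N l l₀} → N < 2 ^ (6 * l + 6) → 2 ^ (6 * l₀) ≤ N → l₀ ≤ l
sixth-root-≥ {N} {l} {l₀} hi lo with l₀ ≤? l
... | yes p = p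
... | no l₀≰l = contradiction (≤-trans (^-monoʳ-≤ 2 (subst (_≤ 6 * l₀) (lemma l) (*-monoʳ-≤ 6 (≰⇒> l₀≰l)))) lo) (<⇒≱ hi)
  where
  lemma : ∀ l → 6 * suc l ≡ 6 * l + 6
  lemma = ℕ-solve

-- With t = l/4 rounded down, 2^l ≥ (2^t)⁴ ≥ t⁴ while 3l + c ≤ (24 + c)t. As soon as t exceeds A(24
-- + c), two of the four factors t absorb the constants.
square-below-exponential : ∀ A c → ∃ λ l₀ → ∀ l → l₀ ≤ l → A * ((3 * l + c) * (3 * l + c)) ≤ 2 ^ l
square-below-exponential A c = 4 * suc (A * (24 + c)) , bound
  where
  bound : ∀ l → 4 * suc (A * (24 + c)) ≤ l → A * ((3 * l + c) * (3 * l + c)) ≤ 2 ^ l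
  bound l l₀≤l = begin
    A * ((3 * l + c) * (3 * l + c))              ≤⟨ *-monoʳ-≤ A (*-mono-≤ 3l+c≤ 3l+c≤) ⟩
    A * ((24 + c) * t * ((24 + c) * t))          ≤⟨ square-scale A (24 + c) t ⟩
    (A * (24 + c)) * (A * (24 + c)) * (t * t)    ≤⟨ *-monoˡ-≤ (t * t) (*-mono-≤ A[24+c]≤t A[24+c]≤t) ⟩
    t * t * (t * t)                              ≤⟨ *-mono-≤ (*-mono-≤ t≤ t≤) (*-mono-≤ t≤ t≤) ⟩
    2 ^ t * 2 ^ t * (2 ^ t * 2 ^ t)              ≡⟨ powers ⟩
    2 ^ (t + t + (t + t))                        ≤⟨ ^-monoʳ-≤ 2 (subst (_≤ l) (four t) (m/n*n≤m l 4)) ⟩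
    2 ^ l                                        ∎
    where
    open ≤-Reasoning
    t = l / 4
    1+A[24+c]≤t : suc (A * (24 + c)) ≤ t
    1+A[24+c]≤t = subst (_≤ t) (m*n/n≡m (suc (A * (24 + c))) 4)
      (/-monoˡ-≤ 4 (subst (_≤ l) (*-comm 4 (suc (A * (24 + c)))) l₀≤l))
    A[24+c]≤t : A * (24 + c) ≤ t
    A[24+c]≤t = ≤-trans (n≤1+n _) 1+A[24+c]≤t
    1≤t : 1 ≤ t
    1≤t = ≤-trans (s≤s z≤n) 1+A[24+c]≤t
    t≤ : t ≤ 2 ^ t
    t≤ = <⇒≤ (n<2^n t)
    four : ∀ t → t * 4 ≡ t + t + (t + t)
    four = ℕ-solve
    powers : 2 ^ t * 2 ^ t * (2 ^ t * 2 ^ t) ≡ 2 ^ (t + t + (t + t))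
    powers = sym (trans (^-distribˡ-+-* 2 (t + t) (t + t)) (cong₂ _*_ (^-distribˡ-+-* 2 t t) (^-distribˡ-+-* 2 t t)))
    3l+c≤ : 3 * l + c ≤ (24 + c) * t
    3l+c≤ = begin
      3 * l + c                       ≡⟨ cong (λ l → 3 * l + c) (m≡m%n+[m/n]*n l 4) ⟩
      3 * (l % 4 + t * 4) + c         ≤⟨ +-monoˡ-≤ c (*-monoʳ-≤ 3 (+-monoˡ-≤ (t * 4) (<⇒≤ (m%n<n l 4)))) ⟩
      3 * (4 + t * 4) + c             ≡⟨ lemma c t ⟩
      (12 + c) * 1 + 12 * t           ≤⟨ +-monoˡ-≤ (12 * t) (*-monoʳ-≤ (12 + c) 1≤t) ⟩
      (12 + c) * t + 12 * t           ≡⟨ lemma′ c t ⟩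
      (24 + c) * t                    ∎
      where
      lemma : ∀ c t → 3 * (4 + t * 4) + c ≡ (12 + c) * 1 + 12 * t
      lemma = ℕ-solve
      lemma′ : ∀ c t → (12 + c) * t + 12 * t ≡ (24 + c) * t
      lemma′ = ℕ-solve
    square-scale : ∀ A d t → A * (d * t * (d * t)) ≤ A * d * (A * d) * (t * t)
    square-scale zero d t = z≤n
    square-scale A@(suc _) d t = subst₂ _≤_ (lemma A d t) (lemma′ A d t) (*-monoˡ-≤ (A * (d * d) * (t * t)) {1} {A} (s≤s z≤n))
      where
      lemma : ∀ A d t → 1 * (A * (d * d) * (t * t)) ≡ A * (d * t * (d * t))
      lemma = ℕ-solve
      lemma′ : ∀ A d t → A * (A * (d * d) * (t * t)) ≡ A * d * (A * d) * (t * t)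
      lemma′ = ℕ-solve

distance-≤ : ∀ {x y e} → x ≤ y + e → y ≤ x + e → ∣ x - y ∣ ≤ e
distance-≤ {x} {y} {e} p q with ≤-total x y
... | inj₁ x≤y = subst (_≤ e) (sym (m≤n⇒∣m-n∣≡n∸m x≤y)) (subst (y ∸ x ≤_) (m+n∸m≡n x e) (∸-monoˡ-≤ x q))
... | inj₂ y≤x = subst (_≤ e) (sym (trans (∣-∣-comm x y) (m≤n⇒∣m-n∣≡n∸m y≤x))) (subst (x ∸ y ≤_) (m+n∸m≡n y e) (∸-monoˡ-≤ y p))

Eventually : (ℕ → Set) → Set
Eventually P = ∃ λ N₀ → ∀ N → N₀ ≤ N → P N

-- Membership in the lists counted by `D₂` and `D₃`

module _ (n : ℤ) where
  D-pairs : ℕ → List (ℕ × ℕ)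
  D-pairs N = filter (λ p → DCond? n (proj₁ p) (proj₂ p)) (pairsUpTo N)

  D-triples : ℕ → List (ℕ × ℕ × ℕ)
  D-triples N = filter (λ t → DCond? n (proj₁ t) (proj₁ (proj₂ t))
                        ×-dec DCond? n (proj₁ t) (proj₂ (proj₂ t))
                        ×-dec DCond? n (proj₁ (proj₂ t)) (proj₂ (proj₂ t)))
                       (triplesUpTo N)

  ∈-D-pairs⁺ : ∀ {N a b} → 1 ≤ a → a < b → b ≤ N → DCond n a b → (a , b) ∈ D-pairs N
  ∈-D-pairs⁺ p q r d = ∈-filter⁺ _ (∈-pairsUpTo⁺ p q r) d

  ∈-D-pairs⁻ : ∀ {N a b} → (a , b) ∈ D-pairs N → 1 ≤ a × a < b × b ≤ N × DCond n a b
  ∈-D-pairs⁻ {N} p with ∈-filter⁻ (λ p → DCond? n (proj₁ p) (proj₂ p)) {xs = pairsUpTo N} p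
  ... | q , d with ∈-pairsUpTo⁻ q
  ... | x , y , z = x , y , z , d

  D-pairs-unique : ∀ N → Unique (D-pairs N)
  D-pairs-unique N = Uniqueₚ.filter⁺ _ (pairsUpTo-unique N)

  ∈-D-triples⁺ : ∀ {N a b c} → 1 ≤ a → a < b → b < c → c ≤ N →
    DCond n a b → DCond n a c → DCond n b c → (a , b , c) ∈ D-triples N
  ∈-D-triples⁺ p q r s d e f = ∈-filter⁺ _ (∈-triplesUpTo⁺ p q r s) (d , e , f)

  ∈-D-triples⁻ : ∀ {N a b c} → (a , b , c) ∈ D-triples N →
    (1 ≤ a × a < b × b < c × c ≤ N) × DCond n a b × DCond n a c × DCond n b c
  ∈-D-triples⁻ {N} p with ∈-filter⁻ _ {xs = triplesUpTo N} p
  ... | q , d = ∈-triplesUpTo⁻ q , d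

  D-triples-unique : ∀ N → Unique (D-triples N)
  D-triples-unique N = Uniqueₚ.filter⁺ _ (triplesUpTo-unique N)

-- Regular triples

module Asymptotics (n : ℤ) (n≢0 : n ≢ 0ℤ) where

  -- A ≤ -1 would force |n| ≥ c, and A ≥ c would force c² ≤ (c - 1)² + (c - 1). The value A = 0
  -- remains possible; it means n = s² and gives no pair.
  cofactor-bounds : ∀ {c s A} → ℤ.∣ n ∣ < c → s < c → + (s * s) ≡ + c ℤ.* A ℤ.+ n →
    ∃ λ a → A ≡ + a × a < c
  cofactor-bounds {suc d} {s} {+ a} (s≤s n≤d) (s≤s s≤d) e with a <? suc d
  ... | yes a<c = a , refl , a<c
  ... | no a≮c = contradiction (begin-strict
    d * d + d           <⟨ m<m+n (d * d + d) (s≤s z≤n) ⟩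
    d * d + d + suc d   ≡⟨ lemma d ⟩
    suc d * suc d       ≤⟨ *-monoʳ-≤ (suc d) (≮⇒≥ a≮c) ⟩
    suc d * a           ≤⟨ pos-≥ n (trans e (cong (ℤ._+ n) (sym (ℤₚ.pos-* (suc d) a)))) ⟩
    s * s + ℤ.∣ n ∣     ≤⟨ +-mono-≤ (*-mono-≤ s≤d s≤d) n≤d ⟩
    d * d + d           ∎) (<-irrefl refl)
    where
    open ≤-Reasoning
    lemma : ∀ d → d * d + d + suc d ≡ suc d * suc d
    lemma = ℕ-solve
  cofactor-bounds {c} {s} { -[1+ a ]} n<c s<c e = contradiction n<c (≤⇒≯ (begin
    c                          ≤⟨ m≤m*n c (suc a) ⟩
    c * suc a                  ≤⟨ m≤n+m _ (s * s) ⟩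
    s * s + c * suc a          ≡⟨ sym (cong ℤ.∣_∣ e′) ⟩
    ℤ.∣ n ∣                    ∎))
    where
    open ≤-Reasoning
    lemma : ∀ s² c a n → n ℤ.- (s² ℤ.+ c ℤ.* a) ≡ (ℤ.- + 1) ℤ.* (s² ℤ.- (c ℤ.* (ℤ.- a) ℤ.+ n))
    lemma = ℤ-solve
    e′ : n ≡ + (s * s + c * suc a)
    e′ = trans (linear₁ (ℤ.- + 1) e (lemma (+ (s * s)) (+ c) (+ suc a) n))
           (trans (cong (λ z → + (s * s) ℤ.+ z) (sym (ℤₚ.pos-* c (suc a)))) (sym (ℤₚ.pos-+ (s * s) _)))

  record Root (a b k : ℕ) : Set where
    constructor root
    field is-root : + (k * k) ≡ + (a * b) ℤ.+ n
  open Root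

  root-cond : ∀ {a b k} → Root a b k → DCond n a b
  root-cond {k = k} p = k , is-root p

  root-unique : ∀ {a b k k′} → Root a b k → Root a b k′ → k ≡ k′
  root-unique (root p) (root q) = square-injective (ℤₚ.+-injective (trans p (sym q)))

  root-sym : ∀ {a b k} → Root a b k → Root b a k
  root-sym {a} {b} (root p) = root (trans p (cong (λ z → + z ℤ.+ n) (*-comm a b)))

  root-ℤ : ∀ {a b k} → Root a b k → + k ℤ.* + k ≡ + a ℤ.* + b ℤ.+ n
  root-ℤ {a} {b} {k} (root p) = trans (sym (pos-sq k)) (trans p (cong (ℤ._+ n) (ℤₚ.pos-* a b)))

  ∣∣-root : ∀ {a b} z → z ℤ.* z ≡ + a ℤ.* + b ℤ.+ n → Root a b ℤ.∣ z ∣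
  ∣∣-root {a} {b} z p = root (trans (∣∣-square z) (trans p (cong (ℤ._+ n) (sym (ℤₚ.pos-* a b)))))

  ℤ-root : ∀ {a b k} → + k ℤ.* + k ≡ + a ℤ.* + b ℤ.+ n → Root a b k
  ℤ-root {k = k} p = ∣∣-root (+ k) p

  -- If s² = ac + n then (c − s)² = bc + n with b = a + c − 2s, and ab + n = (a − s)².
  record Conjugate (c a b : ℕ) : Set where
    constructor conjugate
    field
      s       : ℕ
      ac-root : Root a c s
      sum     : b + 2 * s ≡ a + c

  conjugate-unique : ∀ {c a b b′} → Conjugate c a b → Conjugate c a b′ → b ≡ b′
  conjugate-unique {c} {a} {b} {b′} (conjugate s p e) (conjugate s′ p′ e′) =
    +-cancelʳ-≡ (2 * s) b b′ (trans e (trans (sym e′) (cong (λ z → b′ + 2 * z) (sym s≡s′))))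
    where
    s≡s′ : s ≡ s′
    s≡s′ = root-unique p p′

  root-< : ∀ {a c s} → ℤ.∣ n ∣ < c → a < c → Root a c s → s < c
  root-< {a} {suc d} {s} (s≤s n≤d) (s≤s a≤d) p = square-cancel-< (begin-strict
    s * s                     ≤⟨ pos-≤ n (is-root p) ⟩
    a * suc d + ℤ.∣ n ∣       ≤⟨ +-mono-≤ (*-monoˡ-≤ (suc d) a≤d) n≤d ⟩
    d * suc d + d             <⟨ m<m+n _ (s≤s z≤n) ⟩
    d * suc d + d + 1         ≡⟨ lemma d ⟩
    suc d * suc d             ∎)
    where
    open ≤-Reasoning
    lemma : ∀ d → d * suc d + d + 1 ≡ suc d * suc d
    lemma = ℕ-solve

  root-positive : ∀ {a c s} → ℤ.∣ n ∣ < c → 1 ≤ a → Root a c s → 1 ≤ s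
  root-positive {s = suc s} _ _ _ = s≤s z≤n
  root-positive {suc a} {c} {zero} n<c _ (root p) = contradiction (pos-≥ n p) (<⇒≱ (≤-trans n<c (m≤m+n c (a * c))))

  -- If b = a then 2s = c, so 4n = 4s² - 4ac = c(c - 4a). As n ≠ 0, this makes c a divisor of 4n and
  -- hence at most 4|n|.
  conjugate-≢ : ∀ {c a b} → 4 * ℤ.∣ n ∣ < c → Conjugate c a b → b ≢ a
  conjugate-≢ {c} {a} c>4n (conjugate s p e) refl = impossible z refl
    where
    2s≡c : 2 * s ≡ c
    2s≡c = +-cancelˡ-≡ a (2 * s) c e
    z = + c ℤ.- + 4 ℤ.* + a
    4n≡cz : + 4 ℤ.* n ≡ + c ℤ.* z
    4n≡cz = linear₂ (ℤ.- + 4) (+ c ℤ.+ + 2 ℤ.* + s) (root-ℤ p)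
      (trans (sym (ℤₚ.pos-* 2 s)) (cong +_ 2s≡c)) (lemma n (+ a) (+ c) (+ s))
      where
      lemma : ∀ n a c s → + 4 ℤ.* n ℤ.- c ℤ.* (c ℤ.- + 4 ℤ.* a) ≡
        (ℤ.- + 4) ℤ.* (s ℤ.* s ℤ.- (a ℤ.* c ℤ.+ n)) ℤ.+ (c ℤ.+ + 2 ℤ.* s) ℤ.* (+ 2 ℤ.* s ℤ.- c)
      lemma = ℤ-solve
    ∣4n∣ : 4 * ℤ.∣ n ∣ ≡ c * ℤ.∣ z ∣
    ∣4n∣ = trans (sym (ℤₚ.abs-* (+ 4) n)) (trans (cong ℤ.∣_∣ 4n≡cz) (ℤₚ.abs-* (+ c) z))
    impossible : ∀ y → z ≡ y → ⊥
    impossible y z≡y with ℤ.∣ y ∣ in eq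
    ... | zero = n≢0 (ℤₚ.∣i∣≡0⇒i≡0 (m*n≡0⇒m≡0 ℤ.∣ n ∣ 4 (trans (*-comm ℤ.∣ n ∣ 4)
      (trans ∣4n∣ (trans (cong (c *_) (trans (cong ℤ.∣_∣ z≡y) eq)) (*-zeroʳ c))))))
    ... | suc k = <⇒≱ c>4n (begin
      c              ≤⟨ m≤m*n c (suc k) ⟩
      c * suc k      ≡⟨ cong (c *_) (sym (trans (cong ℤ.∣_∣ z≡y) eq)) ⟩
      c * ℤ.∣ z ∣    ≡⟨ sym ∣4n∣ ⟩
      4 * ℤ.∣ n ∣    ∎)
      where open ≤-Reasoning

  -- The conjugate may be 0, and then it completes no triple. `zero-case` records that n is then a
  -- square f² and a = c - 2f, so that each c loses at most one pair in this way.
  record ConjugateOf (c a : ℕ) : Set where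
    field
      b          : ℕ
      b<c        : b < c
      b≢a        : b ≢ a
      conj       : Conjugate c a b
      conj⁻      : Conjugate c b a
      r          : ℕ
      ab-root    : Root a b r
      zero-case  : b ≡ 0 → ∃ λ f → + (f * f) ≡ n × a + 2 * f ≡ c

  conjugate-of : ∀ {c a s} → 4 * ℤ.∣ n ∣ < c → 1 ≤ a → a < c → Root a c s → ConjugateOf c a
  conjugate-of {c} {a} {s} c>4n 1≤a a<c p with cofactor-bounds {c} {f} {A} n<c f<c f²
    where
    n<c : ℤ.∣ n ∣ < c
    n<c = ≤-trans (s≤s (m≤n*m ℤ.∣ n ∣ 4)) c>4n
    f = c ∸ s
    A = + a ℤ.+ + c ℤ.- + 2 ℤ.* + s
    s<c : s < c
    s<c = root-< {a = a} n<c a<c p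
    f+s : + f ℤ.+ + s ≡ + c
    f+s = trans (sym (ℤₚ.pos-+ f s)) (cong +_ (m∸n+n≡m (<⇒≤ s<c)))
    f<c : f < c
    f<c = ∸-monoʳ-< {c} (root-positive {a = a} n<c 1≤a p) (<⇒≤ s<c)
    f² : + (f * f) ≡ + c ℤ.* A ℤ.+ n
    f² = trans (pos-sq f) (linear₂ (+ 1) (+ f ℤ.- + s ℤ.+ + c) (root-ℤ p) f+s (lemma n (+ a) (+ c) (+ s) (+ f)))
      where
      lemma : ∀ n a c s f → f ℤ.* f ℤ.- (c ℤ.* (a ℤ.+ c ℤ.- + 2 ℤ.* s) ℤ.+ n) ≡
        + 1 ℤ.* (s ℤ.* s ℤ.- (a ℤ.* c ℤ.+ n)) ℤ.+ (f ℤ.- s ℤ.+ c) ℤ.* (f ℤ.+ s ℤ.- c)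
      lemma = ℤ-solve
  ... | b , A≡b , b<c = record
    { b = b ; b<c = b<c ; b≢a = conjugate-≢ c>4n conj
    ; conj = conj
    ; conj⁻ = conjugate f f-root f-eq
    ; ab-root = ∣∣-root (+ a ℤ.- + s) (linear₂ (+ 1) (ℤ.- + a) (root-ℤ p) b-eq (lemma₂ n (+ a) (+ b) (+ c) (+ s)))
    ; zero-case = λ b≡0 → f , zero-square b≡0 , trans f-eq (cong (_+ c) b≡0)
    }
    where
    f = c ∸ s
    s≤c : s ≤ c
    s≤c = <⇒≤ (root-< (≤-trans (s≤s (m≤n*m ℤ.∣ n ∣ 4)) c>4n) a<c p)
    f+s : + f ℤ.+ + s ≡ + c
    f+s = trans (sym (ℤₚ.pos-+ f s)) (cong +_ (m∸n+n≡m s≤c))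
    b-eq : + b ℤ.+ + 2 ℤ.* + s ≡ + a ℤ.+ + c
    b-eq = trans (cong (ℤ._+ + 2 ℤ.* + s) (sym A≡b)) (lemma (+ a) (+ c) (+ s))
      where
      lemma : ∀ a c s → a ℤ.+ c ℤ.- + 2 ℤ.* s ℤ.+ + 2 ℤ.* s ≡ a ℤ.+ c
      lemma = ℤ-solve
    conj : Conjugate c a b
    conj = conjugate s p (ℤₚ.+-injective (trans (ℤₚ.pos-+ b (2 * s)) (trans (cong (λ z → + b ℤ.+ z) (ℤₚ.pos-* 2 s)) (trans b-eq (sym (ℤₚ.pos-+ a c))))))
    f-root : Root b c f
    f-root = ℤ-root (linear₃ (+ 1) (+ f ℤ.- + s ℤ.+ + c) (ℤ.- + c) (root-ℤ p) f+s b-eq (lemma n (+ a) (+ b) (+ c) (+ s) (+ f)))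
      where
      lemma : ∀ n a b c s f → f ℤ.* f ℤ.- (b ℤ.* c ℤ.+ n) ≡
        + 1 ℤ.* (s ℤ.* s ℤ.- (a ℤ.* c ℤ.+ n)) ℤ.+ (f ℤ.- s ℤ.+ c) ℤ.* (f ℤ.+ s ℤ.- c)
          ℤ.+ (ℤ.- c) ℤ.* (b ℤ.+ + 2 ℤ.* s ℤ.- (a ℤ.+ c))
      lemma = ℤ-solve
    f-eq : a + 2 * f ≡ b + c
    f-eq = +-cancelʳ-≡ (2 * s) (a + 2 * f) (b + c) (begin
      a + 2 * f + 2 * s     ≡⟨ lemma a f s ⟩
      a + 2 * (f + s)       ≡⟨ cong (λ z → a + 2 * z) (m∸n+n≡m s≤c) ⟩
      a + 2 * c             ≡⟨ lemma′ a c ⟩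
      a + c + c             ≡⟨ cong (_+ c) (sym (Conjugate.sum conj)) ⟩
      b + 2 * s + c         ≡⟨ lemma″ b s c ⟩
      b + c + 2 * s         ∎)
      where
      open ≡-Reasoning
      lemma : ∀ a f s → a + 2 * f + 2 * s ≡ a + 2 * (f + s)
      lemma = ℕ-solve
      lemma′ : ∀ a c → a + 2 * c ≡ a + c + c
      lemma′ = ℕ-solve
      lemma″ : ∀ b s c → b + 2 * s + c ≡ b + c + 2 * s
      lemma″ = ℕ-solve
    zero-square : b ≡ 0 → + (f * f) ≡ n
    zero-square b≡0 = trans (is-root f-root) (trans (cong (λ z → + (z * c) ℤ.+ n) b≡0) (ℤₚ.+-identityˡ n))
    lemma₂ : ∀ n a b c s → (a ℤ.- s) ℤ.* (a ℤ.- s) ℤ.- (a ℤ.* b ℤ.+ n) ≡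
      + 1 ℤ.* (s ℤ.* s ℤ.- (a ℤ.* c ℤ.+ n)) ℤ.+ (ℤ.- a) ℤ.* (b ℤ.+ + 2 ℤ.* s ℤ.- (a ℤ.+ c))
    lemma₂ = ℤ-solve

  -- One threshold for two purposes: beyond 4|n| conjugates are distinct and stay below c, and
  -- beyond n² the number e cannot be negative.
  c₀ : ℕ
  c₀ = 4 * (ℤ.∣ n ∣ * ℤ.∣ n ∣)

  1≤∣n∣ : 1 ≤ ℤ.∣ n ∣
  1≤∣n∣ = n≢0⇒n>0 λ e → n≢0 (ℤₚ.∣i∣≡0⇒i≡0 e)

  4n≤c₀ : 4 * ℤ.∣ n ∣ ≤ c₀
  4n≤c₀ = *-monoʳ-≤ 4 (m≤m*n ℤ.∣ n ∣ ℤ.∣ n ∣ {{>-nonZero 1≤∣n∣}})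

  Triple : Set
  Triple = ℕ × ℕ × ℕ

  -- The Boolean tells whether the smaller member of the pair becomes the least or the middle
  -- element of the triple; this is the factor 2. A degenerate pair is coded by c alone, because f
  -- is determined by n.
  data TripleOfPair : ℕ × ℕ → (Bool × Triple) ⊎ ((ℕ × ℕ) ⊎ ℕ) → Set where
    below : ∀ {a b c} → TripleOfPair (a , c) (inj₁ (true , a , b , c))
    above : ∀ {a b c} → TripleOfPair (a , c) (inj₁ (false , b , a , c))
    small : ∀ {a c} → TripleOfPair (a , c) (inj₂ (inj₁ (a , c)))
    degenerate : ∀ {a c} f → + (f * f) ≡ n → a + 2 * f ≡ c → TripleOfPair (a , c) (inj₂ (inj₂ c))

  tripleOfPair-injective : ∀ {x x′ y} → TripleOfPair x y → TripleOfPair x′ y → x ≡ x′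
  tripleOfPair-injective below below = refl
  tripleOfPair-injective above above = refl
  tripleOfPair-injective small small = refl
  tripleOfPair-injective {a , c} {a′ , _} (degenerate f p e) (degenerate f′ p′ e′) = cong (_, c)
    (+-cancelʳ-≡ (2 * f) a a′ (trans e (trans (sym e′) (cong (λ z → a′ + 2 * z) (sym f≡f′)))))
    where
    f≡f′ : f ≡ f′
    f≡f′ = square-injective (ℤₚ.+-injective (trans p (sym p′)))

  -- The list `degenerates` is left open: it is empty for nonsquare n and is all of {1, ..., N} for
  -- square n.
  D₂≤2D₃ : (N : ℕ) (degenerates : List ℕ) →
    (∀ f c → + (f * f) ≡ n → 1 ≤ c → c ≤ N → c ∈ degenerates) →
    D₂ n N ≤ 2 * D₃ n N + (length (pairsUpTo c₀) + length degenerates)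
  D₂≤2D₃ N degenerates deg∈ = begin
    D₂ n N
      ≤⟨ length-≤-by-injection TripleOfPair (D-pairs n N) targets (D-pairs-unique n N) total
           (λ _ _ → tripleOfPair-injective) ⟩
    length targets
      ≡⟨ length-sum (cartesianProduct bools (D-triples n N)) _ ⟩
    length (cartesianProduct bools (D-triples n N)) + length (sum-list (pairsUpTo c₀) degenerates)
      ≡⟨ cong₂ _+_ (length-bools× (D-triples n N)) (length-sum (pairsUpTo c₀) degenerates) ⟩
    2 * D₃ n N + (length (pairsUpTo c₀) + length degenerates) ∎
    where
    open ≤-Reasoning
    targets : List ((Bool × Triple) ⊎ ((ℕ × ℕ) ⊎ ℕ))
    targets = sum-list (cartesianProduct bools (D-triples n N)) (sum-list (pairsUpTo c₀) degenerates)
    total : ∀ {x} → x ∈ D-pairs n N → ∃ λ y → y ∈ targets × TripleOfPair x y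
    total {a , c} x∈ with ∈-D-pairs⁻ n {N} x∈
    ... | 1≤a , a<c , c≤N , s , p with c ≤? c₀
    ... | yes c≤c₀ = _ , ∈-sumʳ (∈-sumˡ (∈-pairsUpTo⁺ 1≤a a<c c≤c₀)) , small
    ... | no c≰c₀ = go (conjugate-of (≤-<-trans 4n≤c₀ (≰⇒> c≰c₀)) 1≤a a<c (root {k = s} p))
      where
      go : ConjugateOf c a → ∃ λ y → y ∈ targets × TripleOfPair (a , c) y
      go C with ConjugateOf.b C | ConjugateOf.b<c C | ConjugateOf.b≢a C | ConjugateOf.conj⁻ C
              | ConjugateOf.ab-root C | ConjugateOf.zero-case C
      ... | zero | _ | _ | _ | _ | deg with deg refl
      ... | f , f² , e = _ , ∈-sumʳ (∈-sumʳ {xs = pairsUpTo c₀} (deg∈ f c f² (≤-trans 1≤a (<⇒≤ a<c)) c≤N)) , degenerate f f² e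
      go C | b@(suc _) | b<c | b≢a | conjugate t bc _ | ab | _ with <-cmp a b
      ... | tri< a<b _ _ = _ , ∈-sumˡ (∈-cartesianProduct⁺ (∈-bools true)
              (∈-D-triples⁺ n 1≤a a<b b<c c≤N (root-cond ab) (s , p) (root-cond bc))) , below
      ... | tri≈ _ a≡b _ = contradiction (sym a≡b) b≢a
      ... | tri> _ _ b<a = _ , ∈-sumˡ (∈-cartesianProduct⁺ (∈-bools false)
              (∈-D-triples⁺ n (s≤s z≤n) b<a a<c c≤N (root-cond (root-sym ab)) (root-cond bc) (s , p))) , above

  record Irregular (N : ℕ) (abc : Triple) : Set where
    constructor irregular
    a = proj₁ abc
    b = proj₁ (proj₂ abc)
    c = proj₂ (proj₂ abc)
    field
      1≤a : 1 ≤ a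
      a<b : a < b
      b<c : b < c
      c≤N : c ≤ N
      c₀<c : c₀ < c
      {r s t} : ℕ
      ab-root : Root a b r
      ac-root : Root a c s
      bc-root : Root b c t
      not-regular : b + 2 * s ≢ a + c

  module _ {K : Set} (Code : Triple → K → Set) (codes : List K) where

    -- A regular triple is sent to {a, c} or {b, c} according to the flag. The missing member is the
    -- conjugate of the one kept, and whether it is larger or smaller tells the two cases apart, so
    -- no pair is hit twice.
    data PairOfTriple : Bool × Triple → (ℕ × ℕ) ⊎ ((Bool × Triple) ⊎ (Bool × K)) → Set where
      lower : ∀ {a b c} → a < b → Conjugate c a b → PairOfTriple (true , a , b , c) (inj₁ (a , c))
      upper : ∀ {a b c} → a < b → Conjugate c b a → PairOfTriple (false , a , b , c) (inj₁ (b , c))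
      small : ∀ {t} → PairOfTriple t (inj₂ (inj₁ t))
      coded : ∀ {i t k} → Code t k → PairOfTriple (i , t) (inj₂ (inj₂ (i , k)))

    module _ {N : ℕ}
      (encode : ∀ {t} → Irregular N t → ∃ λ k → k ∈ codes × Code t k)
      (code-injective : ∀ {t t′ k} → Code t k → Code t′ k → t ≡ t′)
      where

      pairOfTriple-injective : ∀ {x x′ y} → PairOfTriple x y → PairOfTriple x′ y → x ≡ x′
      pairOfTriple-injective (lower _ p) (lower _ q) with conjugate-unique p q
      ... | refl = refl
      pairOfTriple-injective (upper _ p) (upper _ q) with conjugate-unique p q
      ... | refl = refl
      pairOfTriple-injective (lower a<b p) (upper b<a q) with conjugate-unique p q
      ... | refl = contradiction a<b (<-asym b<a)
      pairOfTriple-injective (upper b<a p) (lower a<b q) with conjugate-unique p q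
      ... | refl = contradiction a<b (<-asym b<a)
      pairOfTriple-injective small small = refl
      pairOfTriple-injective (coded {i} p) (coded q) = cong (i ,_) (code-injective p q)

      2D₃≤D₂ : 2 * D₃ n N ≤ D₂ n N + (2 * length (triplesUpTo c₀) + 2 * length codes)
      2D₃≤D₂ = begin
        2 * D₃ n N
          ≡⟨ sym (length-bools× (D-triples n N)) ⟩
        length sources
          ≤⟨ length-≤-by-injection PairOfTriple sources targets
               (Uniqueₚ.cartesianProduct⁺ bools-unique (D-triples-unique n N)) total (λ _ _ → pairOfTriple-injective) ⟩
        length targets
          ≡⟨ length-sum (D-pairs n N) _ ⟩
        D₂ n N + length (sum-list (cartesianProduct bools (triplesUpTo c₀)) (cartesianProduct bools codes))
          ≡⟨ cong (λ z → D₂ n N + z) (trans (length-sum (cartesianProduct bools (triplesUpTo c₀)) _)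
               (cong₂ _+_ (length-bools× (triplesUpTo c₀)) (length-bools× codes))) ⟩
        D₂ n N + (2 * length (triplesUpTo c₀) + 2 * length codes) ∎
        where
        open ≤-Reasoning
        bools-unique : Unique bools
        bools-unique = ((λ ()) ∷ []) ∷ [] ∷ []
        sources : List (Bool × Triple)
        sources = cartesianProduct bools (D-triples n N)
        targets : List ((ℕ × ℕ) ⊎ ((Bool × Triple) ⊎ (Bool × K)))
        targets = sum-list (D-pairs n N) (sum-list (cartesianProduct bools (triplesUpTo c₀)) (cartesianProduct bools codes))
        total : ∀ {x} → x ∈ sources → ∃ λ y → y ∈ targets × PairOfTriple x y
        total {i , a , b , c} x∈ with ∈-cartesianProduct⁻ bools (D-triples n N) x∈
        ... | _ , t∈ with ∈-D-triples⁻ n {N} t∈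
        ... | (1≤a , a<b , b<c , c≤N) , (r , ab) , (s , ac) , (t , bc) with c ≤? c₀
        ... | yes c≤c₀ = _ , ∈-sumʳ {xs = D-pairs n N} (∈-sumˡ (∈-cartesianProduct⁺ (∈-bools i) (∈-triplesUpTo⁺ 1≤a a<b b<c c≤c₀))) , small
        ... | no c≰c₀ with b + 2 * s ≟ a + c
        ... | no ≢ = _ , ∈-sumʳ {xs = D-pairs n N} (∈-sumʳ {xs = cartesianProduct bools (triplesUpTo c₀)}
                       (∈-cartesianProduct⁺ (∈-bools i) (proj₁ (proj₂ code)))) , coded (proj₂ (proj₂ code))
          where
          code : ∃ λ k → k ∈ codes × Code (a , b , c) k
          code = encode (irregular 1≤a a<b b<c c≤N (≰⇒> c≰c₀) (root {k = r} ab) (root {k = s} ac) (root {k = t} bc) ≢)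
        ... | yes e with i
        ... | true = _ , ∈-sumˡ (∈-D-pairs⁺ n 1≤a (<-trans a<b b<c) c≤N (s , ac)) , lower a<b conj
          where
          conj : Conjugate c a b
          conj = conjugate s (root ac) e
        ... | false = _ , ∈-sumˡ (∈-D-pairs⁺ n (≤-trans 1≤a (<⇒≤ a<b)) b<c c≤N (t , bc)) , upper a<b (go C)
          where
          C : ConjugateOf c a
          C = conjugate-of (≤-<-trans 4n≤c₀ (≰⇒> c≰c₀)) 1≤a (<-trans a<b b<c) (root {k = s} ac)
          conj : Conjugate c a b
          conj = conjugate s (root ac) e
          go : ConjugateOf c a → Conjugate c b a
          go C = subst (λ z → Conjugate c z a) (conjugate-unique (ConjugateOf.conj C) conj) (ConjugateOf.conj⁻ C)

  -- Counting irregular triples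

  m : ℕ
  m = ℤ.∣ n ∣

  m²≡n² : + (m * m) ≡ n ℤ.* n
  m²≡n² = ∣∣-square n

  -- All that is kept of an irregular triple. X = at - rs and Y = bs - rt are roots of ae + n² and
  -- be + n², and rX + aY = s(ab - r²) = -ns. They are kept as signed integers because this
  -- relation, through which s and then c are recovered, depends on their signs.
  record Companion (N : ℕ) (abc : Triple) : Set where
    a = proj₁ abc
    b = proj₁ (proj₂ abc)
    c = proj₂ (proj₂ abc)
    field
      e r s   : ℕ
      X Y     : ℤ
      1≤a     : 1 ≤ a
      a<b     : a < b
      1≤e     : 1 ≤ e
      ab-root : Root a b r
      ac-root : Root a c s
      X²      : ℤ.∣ X ∣ * ℤ.∣ X ∣ ≡ a * e + m * m
      Y²      : ℤ.∣ Y ∣ * ℤ.∣ Y ∣ ≡ b * e + m * m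
      s-from-XY : n ℤ.* + s ≡ ℤ.- (+ r ℤ.* X ℤ.+ + a ℤ.* Y)
      abe≤    : a * b * e ≤ 27 * (m * m) * N

  companion : ∀ {N abc} → Irregular N abc → Companion N abc
  companion {N} {a , b , c} I = fromE E refl
    where
    open Irregular I hiding (a; b; c)
    A = + a
    B = + b
    C = + c
    R = + r
    S = + s
    T = + t
    E : ℤ
    E = n ℤ.* (A ℤ.+ B ℤ.+ C) ℤ.+ + 2 ℤ.* (A ℤ.* B ℤ.* C) ℤ.- + 2 ℤ.* (R ℤ.* S ℤ.* T)
    X = A ℤ.* T ℤ.- R ℤ.* S
    Y = B ℤ.* S ℤ.- R ℤ.* T
    Z = C ℤ.* R ℤ.- S ℤ.* T
    hab = root-ℤ ab-root
    hac = root-ℤ ac-root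
    hbc = root-ℤ bc-root
    square-identity : ∀ n a b c r s t →
      r ℤ.* r ≡ a ℤ.* b ℤ.+ n → s ℤ.* s ≡ a ℤ.* c ℤ.+ n → t ℤ.* t ≡ b ℤ.* c ℤ.+ n →
      (a ℤ.* t ℤ.- r ℤ.* s) ℤ.* (a ℤ.* t ℤ.- r ℤ.* s) ≡
      a ℤ.* (n ℤ.* (a ℤ.+ b ℤ.+ c) ℤ.+ + 2 ℤ.* (a ℤ.* b ℤ.* c) ℤ.- + 2 ℤ.* (r ℤ.* s ℤ.* t)) ℤ.+ n ℤ.* n
    square-identity n a b c r s t hr hs ht =
      linear₃ (s ℤ.* s) (a ℤ.* b ℤ.+ n) (a ℤ.* a) hr hs ht (lemma n a b c r s t)
      where
      lemma : ∀ n a b c r s t →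
        (a ℤ.* t ℤ.- r ℤ.* s) ℤ.* (a ℤ.* t ℤ.- r ℤ.* s)
          ℤ.- (a ℤ.* (n ℤ.* (a ℤ.+ b ℤ.+ c) ℤ.+ + 2 ℤ.* (a ℤ.* b ℤ.* c) ℤ.- + 2 ℤ.* (r ℤ.* s ℤ.* t)) ℤ.+ n ℤ.* n) ≡
        (s ℤ.* s) ℤ.* (r ℤ.* r ℤ.- (a ℤ.* b ℤ.+ n)) ℤ.+ (a ℤ.* b ℤ.+ n) ℤ.* (s ℤ.* s ℤ.- (a ℤ.* c ℤ.+ n))
          ℤ.+ (a ℤ.* a) ℤ.* (t ℤ.* t ℤ.- (b ℤ.* c ℤ.+ n))
      lemma = ℤ-solve
    X²ℤ : X ℤ.* X ≡ A ℤ.* E ℤ.+ n ℤ.* n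
    X²ℤ = square-identity n A B C R S T hab hac hbc
    Y²ℤ : Y ℤ.* Y ≡ B ℤ.* E ℤ.+ n ℤ.* n
    Y²ℤ = trans (square-identity n B A C R T S (trans hab (comm A B)) hbc hac) (lemma n A B C R S T)
      where
      comm : ∀ x y → x ℤ.* y ℤ.+ n ≡ y ℤ.* x ℤ.+ n
      comm x y = cong (ℤ._+ n) (ℤₚ.*-comm x y)
      lemma : ∀ n a b c r s t →
        b ℤ.* (n ℤ.* (b ℤ.+ a ℤ.+ c) ℤ.+ + 2 ℤ.* (b ℤ.* a ℤ.* c) ℤ.- + 2 ℤ.* (r ℤ.* t ℤ.* s)) ℤ.+ n ℤ.* n ≡
        b ℤ.* (n ℤ.* (a ℤ.+ b ℤ.+ c) ℤ.+ + 2 ℤ.* (a ℤ.* b ℤ.* c) ℤ.- + 2 ℤ.* (r ℤ.* s ℤ.* t)) ℤ.+ n ℤ.* n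
      lemma = ℤ-solve
    Z²ℤ : Z ℤ.* Z ≡ C ℤ.* E ℤ.+ n ℤ.* n
    Z²ℤ = trans (square-identity n C A B S T R (trans hac (comm A C)) (trans hbc (comm B C)) hab) (lemma n A B C R S T)
      where
      comm : ∀ x y → x ℤ.* y ℤ.+ n ≡ y ℤ.* x ℤ.+ n
      comm x y = cong (ℤ._+ n) (ℤₚ.*-comm x y)
      lemma : ∀ n a b c r s t →
        c ℤ.* (n ℤ.* (c ℤ.+ a ℤ.+ b) ℤ.+ + 2 ℤ.* (c ℤ.* a ℤ.* b) ℤ.- + 2 ℤ.* (s ℤ.* t ℤ.* r)) ℤ.+ n ℤ.* n ≡
        c ℤ.* (n ℤ.* (a ℤ.+ b ℤ.+ c) ℤ.+ + 2 ℤ.* (a ℤ.* b ℤ.* c) ℤ.- + 2 ℤ.* (r ℤ.* s ℤ.* t)) ℤ.+ n ℤ.* n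
      lemma = ℤ-solve
    d = a + c ∸ b
    b≤a+c : b ≤ a + c
    b≤a+c = ≤-trans (<⇒≤ b<c) (m≤n+m c a)
    d+b : d + b ≡ a + c
    d+b = m∸n+n≡m b≤a+c
    d≤c : d ≤ c
    d≤c = +-cancelʳ-≤ b d c (≤-trans (≤-reflexive (trans d+b (+-comm a c))) (+-monoʳ-≤ c (<⇒≤ a<b)))
    D≡ : A ℤ.+ C ℤ.- B ≡ + d
    D≡ = linear₁ (+ 1) (trans (sym (ℤₚ.pos-+ a c)) (trans (cong +_ (sym d+b)) (ℤₚ.pos-+ d b))) (lemma A B C (+ d))
      where
      lemma : ∀ a b c d → a ℤ.+ c ℤ.- b ℤ.- d ≡ + 1 ℤ.* (a ℤ.+ c ℤ.- (d ℤ.+ b))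
      lemma = ℤ-solve
    rst = r * s * t
    rst≡ : + rst ≡ R ℤ.* S ℤ.* T
    rst≡ = trans (ℤₚ.pos-* (r * s) t) (cong (ℤ._* T) (ℤₚ.pos-* r s))
    -- E·E′ = n²((a + c − b)² − 4s²) with E′ = E + 4rst.
    product-identity : E ℤ.* (E ℤ.+ + 4 ℤ.* (R ℤ.* S ℤ.* T)) ℤ.+ + 4 ℤ.* (n ℤ.* n ℤ.* (S ℤ.* S)) ≡
      n ℤ.* n ℤ.* ((A ℤ.+ C ℤ.- B) ℤ.* (A ℤ.+ C ℤ.- B))
    product-identity = linear₃ (ℤ.- (+ 4 ℤ.* (S ℤ.* S ℤ.* (T ℤ.* T))))
      (+ 4 ℤ.* (n ℤ.* n) ℤ.- + 4 ℤ.* ((A ℤ.* B ℤ.+ n) ℤ.* (T ℤ.* T)))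
      (ℤ.- (+ 4 ℤ.* ((A ℤ.* B ℤ.+ n) ℤ.* (A ℤ.* C ℤ.+ n)))) hab hac hbc (lemma n A B C R S T)
      where
      lemma : ∀ n a b c r s t → let e = n ℤ.* (a ℤ.+ b ℤ.+ c) ℤ.+ + 2 ℤ.* (a ℤ.* b ℤ.* c) ℤ.- + 2 ℤ.* (r ℤ.* s ℤ.* t) in
        e ℤ.* (e ℤ.+ + 4 ℤ.* (r ℤ.* s ℤ.* t)) ℤ.+ + 4 ℤ.* (n ℤ.* n ℤ.* (s ℤ.* s))
          ℤ.- n ℤ.* n ℤ.* ((a ℤ.+ c ℤ.- b) ℤ.* (a ℤ.+ c ℤ.- b)) ≡
        (ℤ.- (+ 4 ℤ.* (s ℤ.* s ℤ.* (t ℤ.* t)))) ℤ.* (r ℤ.* r ℤ.- (a ℤ.* b ℤ.+ n))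
          ℤ.+ (+ 4 ℤ.* (n ℤ.* n) ℤ.- + 4 ℤ.* ((a ℤ.* b ℤ.+ n) ℤ.* (t ℤ.* t))) ℤ.* (s ℤ.* s ℤ.- (a ℤ.* c ℤ.+ n))
          ℤ.+ (ℤ.- (+ 4 ℤ.* ((a ℤ.* b ℤ.+ n) ℤ.* (a ℤ.* c ℤ.+ n)))) ℤ.* (t ℤ.* t ℤ.- (b ℤ.* c ℤ.+ n))
      lemma = ℤ-solve
    m²≤c : m * m < c
    m²≤c = ≤-<-trans (m≤n*m (m * m) 4) c₀<c
    fromE : ∀ e → E ≡ e → Companion N (a , b , c)
    -- Z = cr - st is the third root, Z² = ce + n². With e ≤ -1 this would give c ≤ n².
    fromE -[1+ k ] E≡ = contradiction m²≤c (≤⇒≯ (begin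
      c                              ≤⟨ m≤m*n c (suc k) ⟩
      c * suc k                      ≤⟨ m≤n+m _ _ ⟩
      ℤ.∣ Z ∣ * ℤ.∣ Z ∣ + c * suc k  ≡⟨ ℤₚ.+-injective eq ⟩
      m * m                          ∎))
      where
      open ≤-Reasoning
      eq : + (ℤ.∣ Z ∣ * ℤ.∣ Z ∣ + c * suc k) ≡ + (m * m)
      eq = trans (ℤₚ.pos-+ (ℤ.∣ Z ∣ * ℤ.∣ Z ∣) (c * suc k)) (trans (cong₂ ℤ._+_ (trans (∣∣-square Z) (trans Z²ℤ (cong (λ e → C ℤ.* e ℤ.+ n ℤ.* n) E≡))) (ℤₚ.pos-* c (suc k)))
        (trans (lemma C (+ suc k) (n ℤ.* n)) (sym m²≡n²)))
        where
        lemma : ∀ c k q → c ℤ.* (ℤ.- k) ℤ.+ q ℤ.+ c ℤ.* k ≡ q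
        lemma = ℤ-solve
    fromE (+ e) E≡ = record
      { e = e ; r = r ; s = s ; X = X ; Y = Y ; 1≤a = 1≤a ; a<b = a<b ; 1≤e = n≢0⇒n>0 e≢0
      ; ab-root = ab-root ; ac-root = ac-root
      ; X² = root² X a X²ℤ ; Y² = root² Y b Y²ℤ
      ; s-from-XY = linear₁ (ℤ.- S) hab (lemma n A B R S T)
      ; abe≤ = ≤-trans abe≤c (*-monoʳ-≤ (27 * (m * m)) c≤N) }
      where
      root² : ∀ X a → X ℤ.* X ≡ + a ℤ.* E ℤ.+ n ℤ.* n → ℤ.∣ X ∣ * ℤ.∣ X ∣ ≡ a * e + m * m
      root² X a h = ℤₚ.+-injective (trans (∣∣-square X) (trans h (trans (cong₂ (λ e q → + a ℤ.* e ℤ.+ q) E≡ (sym m²≡n²)) (sym (pos-+* a e (m * m))))))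
      lemma : ∀ n a b r s t → n ℤ.* s ℤ.- (ℤ.- (r ℤ.* (a ℤ.* t ℤ.- r ℤ.* s) ℤ.+ a ℤ.* (b ℤ.* s ℤ.- r ℤ.* t))) ≡
        (ℤ.- s) ℤ.* (r ℤ.* r ℤ.- (a ℤ.* b ℤ.+ n))
      lemma = ℤ-solve
      product-ℕ : e * (e + 4 * rst) + 4 * (m * m * (s * s)) ≡ m * m * (d * d)
      product-ℕ = ℤₚ.+-injective (begin
        + (e * (e + 4 * rst) + 4 * (m * m * (s * s)))
          ≡⟨ ℤₚ.pos-+ (e * (e + 4 * rst)) _ ⟩
        + (e * (e + 4 * rst)) ℤ.+ + (4 * (m * m * (s * s)))
          ≡⟨ cong₂ ℤ._+_ (trans (ℤₚ.pos-* e _) (cong (+ e ℤ.*_) (trans (ℤₚ.pos-+ e _) (cong (λ z → + e ℤ.+ z) (trans (ℤₚ.pos-* 4 rst) (cong (+ 4 ℤ.*_) rst≡))))))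
               (trans (ℤₚ.pos-* 4 (m * m * (s * s))) (cong (+ 4 ℤ.*_) (trans (ℤₚ.pos-* (m * m) _) (cong₂ ℤ._*_ m²≡n² (pos-sq s))))) ⟩
        + e ℤ.* (+ e ℤ.+ + 4 ℤ.* (R ℤ.* S ℤ.* T)) ℤ.+ + 4 ℤ.* (n ℤ.* n ℤ.* (S ℤ.* S))
          ≡⟨ cong (λ e → e ℤ.* (e ℤ.+ + 4 ℤ.* (R ℤ.* S ℤ.* T)) ℤ.+ + 4 ℤ.* (n ℤ.* n ℤ.* (S ℤ.* S))) (sym E≡) ⟩
        E ℤ.* (E ℤ.+ + 4 ℤ.* (R ℤ.* S ℤ.* T)) ℤ.+ + 4 ℤ.* (n ℤ.* n ℤ.* (S ℤ.* S))
          ≡⟨ product-identity ⟩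
        n ℤ.* n ℤ.* ((A ℤ.+ C ℤ.- B) ℤ.* (A ℤ.+ C ℤ.- B))
          ≡⟨ cong₂ (λ q d → q ℤ.* (d ℤ.* d)) (sym m²≡n²) D≡ ⟩
        + (m * m) ℤ.* (+ d ℤ.* + d)
          ≡⟨ trans (cong (+ (m * m) ℤ.*_) (sym (pos-sq d))) (sym (ℤₚ.pos-* (m * m) (d * d))) ⟩
        + (m * m * (d * d)) ∎)
        where open ≡-Reasoning
      -- For e = 0 the product identity reads 4n²s² = n²(a + c - b)², which makes the triple
      -- regular.
      e≢0 : e ≢ 0
      e≢0 refl = not-regular (begin
        b + 2 * s  ≡⟨ cong (λ z → b + z) 2s≡d ⟩
        b + d      ≡⟨ trans (+-comm b d) d+b ⟩
        a + c      ∎)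
        where
        open ≡-Reasoning
        2s≡d : 2 * s ≡ d
        2s≡d = square-injective (*-cancelˡ-≡ (2 * s * (2 * s)) (d * d) (m * m) {{>-nonZero (*-mono-≤ 1≤∣n∣ 1≤∣n∣)}}
          (trans (lemma′ m s) product-ℕ))
          where
          lemma′ : ∀ m s → m * m * (2 * s * (2 * s)) ≡ 4 * (m * m * (s * s))
          lemma′ = ℕ-solve
      sum-identity : + (e + 2 * rst) ≡ + (2 * (a * b * c)) ℤ.+ n ℤ.* (A ℤ.+ B ℤ.+ C)
      sum-identity = begin
        + (e + 2 * rst)
          ≡⟨ trans (ℤₚ.pos-+ e _) (cong₂ ℤ._+_ (sym E≡) (trans (ℤₚ.pos-* 2 rst) (cong (+ 2 ℤ.*_) rst≡))) ⟩
        E ℤ.+ + 2 ℤ.* (R ℤ.* S ℤ.* T)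
          ≡⟨ lemma′ (n ℤ.* (A ℤ.+ B ℤ.+ C)) (+ 2 ℤ.* (A ℤ.* B ℤ.* C)) (+ 2 ℤ.* (R ℤ.* S ℤ.* T)) ⟩
        + 2 ℤ.* (A ℤ.* B ℤ.* C) ℤ.+ n ℤ.* (A ℤ.+ B ℤ.+ C)
          ≡⟨ cong (ℤ._+ n ℤ.* (A ℤ.+ B ℤ.+ C)) (sym (trans (ℤₚ.pos-* 2 (a * b * c)) (cong (+ 2 ℤ.*_) (trans (ℤₚ.pos-* (a * b) c) (cong (ℤ._* C) (ℤₚ.pos-* a b)))))) ⟩
        + (2 * (a * b * c)) ℤ.+ n ℤ.* (A ℤ.+ B ℤ.+ C) ∎
        where
        open ≡-Reasoning
        lemma′ : ∀ x y z → x ℤ.+ y ℤ.- z ℤ.+ z ≡ y ℤ.+ x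
        lemma′ = ℤ-solve
      nsum≤ : ℤ.∣ n ℤ.* (A ℤ.+ B ℤ.+ C) ∣ ≤ 3 * m * c
      nsum≤ = begin
        ℤ.∣ n ℤ.* (A ℤ.+ B ℤ.+ C) ∣  ≡⟨ ℤₚ.abs-* n (A ℤ.+ B ℤ.+ C) ⟩
        m * (a + b + c)
          ≤⟨ *-monoʳ-≤ m (+-monoˡ-≤ c (+-mono-≤ (<⇒≤ (<-trans a<b b<c)) (<⇒≤ b<c))) ⟩
        m * (c + c + c)              ≡⟨ lemma′ m c ⟩
        3 * m * c                    ∎
        where
        open ≤-Reasoning
        lemma′ : ∀ m c → m * (c + c + c) ≡ 3 * m * c
        lemma′ = ℕ-solve
      -- If ab ≥ 3m, then the n(a + b + c) term is at most abc, so e + 4rst ≥ abc and the product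
      -- identity gives e·abc ≤ m²c². Otherwise ab ≤ 3m and e ≤ 9mc directly; 27 is 3 times 9.
      abe≤c : a * b * e ≤ 27 * (m * m) * c
      abe≤c with 3 * m ≤? a * b
      ... | yes 3m≤ab = ≤-trans (*-cancelʳ-≤ (a * b * e) (m * m * c) c {{>-nonZero (≤-trans (s≤s z≤n) b<c)}} (begin
        a * b * e * c                              ≡⟨ lemma₁ a b c e ⟩
        e * (a * b * c)                            ≤⟨ *-monoʳ-≤ e abc≤ ⟩
        e * (e + 4 * rst)                          ≤⟨ m≤m+n _ _ ⟩
        e * (e + 4 * rst) + 4 * (m * m * (s * s))  ≡⟨ product-ℕ ⟩
        m * m * (d * d)                            ≤⟨ *-monoʳ-≤ (m * m) (*-mono-≤ d≤c d≤c) ⟩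
        m * m * (c * c)                            ≡⟨ sym (*-assoc (m * m) c c) ⟩
        m * m * c * c                              ∎)) (*-monoˡ-≤ c (m≤n*m (m * m) 27))
        where
        open ≤-Reasoning
        lemma₁ : ∀ a b c e → a * b * e * c ≡ e * (a * b * c)
        lemma₁ = ℕ-solve
        abc≤ : a * b * c ≤ e + 4 * rst
        abc≤ = +-cancelʳ-≤ (a * b * c) _ _ (begin
          a * b * c + a * b * c                    ≡⟨ lemma₂ (a * b * c) ⟩
          2 * (a * b * c)                          ≤⟨ pos-≥ (n ℤ.* (A ℤ.+ B ℤ.+ C)) sum-identity ⟩
          e + 2 * rst + ℤ.∣ n ℤ.* (A ℤ.+ B ℤ.+ C) ∣
            ≤⟨ +-mono-≤ (+-monoʳ-≤ e (*-monoˡ-≤ rst {2} {4} (s≤s (s≤s z≤n)))) (≤-trans nsum≤ (*-monoˡ-≤ c 3m≤ab)) ⟩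
          e + 4 * rst + a * b * c                  ∎)
          where
          lemma₂ : ∀ x → x + x ≡ 2 * x
          lemma₂ = ℕ-solve
      ... | no 3m≰ab = begin
        a * b * e                                  ≤⟨ *-mono-≤ ab≤ e≤ ⟩
        3 * m * (9 * m * c)                        ≡⟨ lemma₁ m c ⟩
        27 * (m * m) * c                           ∎
        where
        open ≤-Reasoning
        ab≤ : a * b ≤ 3 * m
        ab≤ = <⇒≤ (≰⇒> 3m≰ab)
        lemma₁ : ∀ m c → 3 * m * (9 * m * c) ≡ 27 * (m * m) * c
        lemma₁ = ℕ-solve
        lemma₂ : ∀ m c → 2 * (3 * m * c) + 3 * m * c ≡ 9 * m * c
        lemma₂ = ℕ-solve
        e≤ : e ≤ 9 * m * c
        e≤ = begin
          e                                        ≤⟨ m≤m+n e _ ⟩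
          e + 2 * rst                              ≤⟨ pos-≤ (n ℤ.* (A ℤ.+ B ℤ.+ C)) sum-identity ⟩
          2 * (a * b * c) + ℤ.∣ n ℤ.* (A ℤ.+ B ℤ.+ C) ∣ ≤⟨ +-mono-≤ (*-monoʳ-≤ 2 (*-monoˡ-≤ c ab≤)) nsum≤ ⟩
          2 * (3 * m * c) + 3 * m * c              ≡⟨ lemma₂ m c ⟩
          9 * m * c                                ∎

  -- Codes for irregular triples

  Code : Set
  Code = ((Bool × Bool) × (Sign × Sign)) × (ℕ × (ℕ × ℕ × ℕ))

  -- The smallest of a, b, e is a or e.  In the first case the other two numbers are recovered
  -- from the roots of ab + n and ae + n², in the second case from those of ea + n² and eb + n².
  record TripleCode (N : ℕ) (abc : Triple) (k : Code) : Set where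
    smallest-is-a = proj₁ (proj₁ (proj₁ k))
    tag = proj₂ (proj₁ (proj₁ k))
    p = proj₁ (proj₂ k)
    j = proj₁ (proj₂ (proj₂ k))
    ρ = proj₁ (proj₂ (proj₂ (proj₂ k)))
    z = proj₂ (proj₂ (proj₂ (proj₂ k)))
    field
      comp : Companion N abc
    open Companion comp public
    field
      signs : proj₂ (proj₁ k) ≡ (ℤ.sign X , ℤ.sign Y)
      p≡    : p ≡ (if smallest-is-a then a else e)
      ρ≡    : ρ ≡ (if smallest-is-a then r else ℤ.∣ X ∣)
      residue : ResidueCode m p (if smallest-is-a then ℤ.∣ X ∣ else ℤ.∣ Y ∣) tag j z

  root-cofactor-unique : ∀ {p q q′ k} → 1 ≤ p → Root p q k → Root p q′ k → q ≡ q′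
  root-cofactor-unique {p} {q} {q′} 1≤p (root h) (root h′) = *-cancelˡ-≡ q q′ p {{>-nonZero 1≤p}}
    (ℤₚ.+-injective (linear₁ (+ 1) (trans (sym h) h′) (lemma (+ (p * q)) (+ (p * q′)) n)))
    where
    lemma : ∀ x y n → x ℤ.- y ≡ + 1 ℤ.* (x ℤ.+ n ℤ.- (y ℤ.+ n))
    lemma = ℤ-solve

  -- a and b determine r, and with e and the signs also X and Y. Then ns = -(rX + aY) gives s
  -- because n ≠ 0, and s² = ac + n gives c.
  abe-determines : ∀ {N abc abc′} (C : Companion N abc) (C′ : Companion N abc′) →
    let open Companion in
    a C ≡ a C′ → b C ≡ b C′ → e C ≡ e C′ →
    ℤ.sign (X C) ≡ ℤ.sign (X C′) → ℤ.sign (Y C) ≡ ℤ.sign (Y C′) → abc ≡ abc′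
  abe-determines {N} {a , b , c} {_ , _ , c′} C C′ refl refl e≡ σ τ = cong (λ c → a , b , c) c≡c′
    where
    module C = Companion C
    module C′ = Companion C′
    r≡ : C.r ≡ C′.r
    r≡ = root-unique C.ab-root C′.ab-root
    X≡ : C.X ≡ C′.X
    X≡ = ∣∣-sign-injective (square-injective (trans C.X² (trans (cong (λ e → a * e + m * m) e≡) (sym C′.X²)))) σ
    Y≡ : C.Y ≡ C′.Y
    Y≡ = ∣∣-sign-injective (square-injective (trans C.Y² (trans (cong (λ e → b * e + m * m) e≡) (sym C′.Y²)))) τ
    s≡ : C.s ≡ C′.s
    s≡ = ℤₚ.+-injective (ℤₚ.*-cancelˡ-≡ n (+ C.s) (+ C′.s) {{ℤ.≢-nonZero n≢0}}
      (trans C.s-from-XY (trans (cong (ℤ.-_) (cong₂ ℤ._+_ (cong₂ (λ r X → + r ℤ.* X) r≡ X≡) (cong (+ a ℤ.*_) Y≡))) (sym C′.s-from-XY))))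
    c≡c′ : c ≡ c′
    c≡c′ = root-cofactor-unique {p = a} C.1≤a C.ac-root (subst (Root a c′) (sym s≡) C′.ac-root)

  tripleCode-injective : ∀ {N t t′ k} → TripleCode N t k → TripleCode N t′ k → t ≡ t′
  tripleCode-injective {N} {t} {t′} {((i , tag) , (σ , τ)) , (p , (j , ρ , z))} T T′ =
    go i (T.p≡) (T′.p≡) T.ρ≡ T′.ρ≡ T.residue T′.residue
    where
    module T = TripleCode T
    module T′ = TripleCode T′
    signs≡ : (ℤ.sign T.X , ℤ.sign T.Y) ≡ (ℤ.sign T′.X , ℤ.sign T′.Y)
    signs≡ = trans (sym T.signs) T′.signs
    finish : T.a ≡ T′.a → T.b ≡ T′.b → T.e ≡ T′.e → t ≡ t′
    finish a≡ b≡ e≡ = abe-determines T.comp T′.comp a≡ b≡ e≡ (cong proj₁ signs≡) (cong proj₂ signs≡)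
    go : ∀ i → p ≡ (if i then T.a else T.e) → p ≡ (if i then T′.a else T′.e) →
      ρ ≡ (if i then T.r else ℤ.∣ T.X ∣) → ρ ≡ (if i then T′.r else ℤ.∣ T′.X ∣) →
      ResidueCode m p (if i then ℤ.∣ T.X ∣ else ℤ.∣ T.Y ∣) tag j z →
      ResidueCode m p (if i then ℤ.∣ T′.X ∣ else ℤ.∣ T′.Y ∣) tag j z → t ≡ t′
    go true p≡a p≡a′ ρ≡ ρ≡′ R R′ = finish a≡ b≡ e≡
      where
      a≡ : T.a ≡ T′.a
      a≡ = trans (sym p≡a) p≡a′
      b≡ : T.b ≡ T′.b
      b≡ = root-cofactor-unique T.1≤a T.ab-root
        (subst₂ (λ a r → Root a T′.b r) (sym a≡) (trans (sym ρ≡′) ρ≡) T′.ab-root)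
      X≡ : ℤ.∣ T.X ∣ ≡ ℤ.∣ T′.X ∣
      X≡ = residueCode-injective 1≤∣n∣ (subst (1 ≤_) (sym p≡a) T.1≤a) R R′
      e≡ : T.e ≡ T′.e
      e≡ = cofactor-unique T.1≤a T.X² (trans (cong₂ _*_ X≡ X≡) (trans T′.X² (cong (λ a → a * T′.e + m * m) (sym a≡))))
    go false p≡e p≡e′ ρ≡ ρ≡′ R R′ = finish a≡ b≡ e≡
      where
      e≡ : T.e ≡ T′.e
      e≡ = trans (sym p≡e) p≡e′
      X≡ : ℤ.∣ T.X ∣ ≡ ℤ.∣ T′.X ∣
      X≡ = trans (sym ρ≡) ρ≡′
      Y≡ : ℤ.∣ T.Y ∣ ≡ ℤ.∣ T′.Y ∣
      Y≡ = residueCode-injective 1≤∣n∣ (subst (1 ≤_) (sym p≡e) T.1≤e) R R′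
      via-e : ∀ {b b′ y y′} → y * y ≡ b * T.e + m * m → y′ * y′ ≡ b′ * T′.e + m * m → y ≡ y′ → b ≡ b′
      via-e {b} {b′} h h′ refl = cofactor-unique T.1≤e (trans h (cong (_+ m * m) (*-comm b T.e)))
        (trans h′ (cong (_+ m * m) (trans (*-comm b′ T′.e) (cong (_* b′) (sym e≡)))))
      a≡ : T.a ≡ T′.a
      a≡ = via-e T.X² T′.X² X≡
      b≡ : T.b ≡ T′.b
      b≡ = via-e T.Y² T′.Y² Y≡

  sign-list : List Sign
  sign-list = Sign.+ ∷ Sign.- ∷ []

  ∈-signs : ∀ σ → σ ∈ sign-list
  ∈-signs Sign.+ = here refl
  ∈-signs Sign.- = there (here refl)

  -- The exponent L in j(ρ + 1)(z + 1) < 2^L, of the order of log N.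
  log-size : ℕ → ℕ
  log-size l = 3 * l + 4 * m + 9

  flags : List ((Bool × Bool) × (Sign × Sign))
  flags = cartesianProduct (cartesianProduct bools bools) (cartesianProduct sign-list sign-list)

  codes : ℕ → List Code
  codes l = cartesianProduct flags (cartesianProduct (upTo (2 ^ (2 * l + m + 4))) (hyperbolic (log-size l)))

  -- 2^(2l) values of p times 2^(3l) triples (j, ρ, z), up to logarithms, make 2^(5l). The 16 flags
  -- and the outer doubling contribute 2^5; the remaining constants are powers of 2 depending on m.
  length-codes : ∀ l → 2 * length (codes l) ≤ 2 ^ (5 * m + 20) * (log-size l * log-size l * 2 ^ (5 * l))
  length-codes l = begin
    2 * length (codes l)
      ≡⟨ cong (2 *_) (trans (length-cartesianProduct flags (cartesianProduct (upTo P) (hyperbolic L)))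
           (cong (16 *_) (trans (length-cartesianProduct (upTo P) (hyperbolic L)) (cong (_* length (hyperbolic L)) (length-upTo P))))) ⟩
    2 * (16 * (2 ^ (2 * l + m + 4) * length (hyperbolic L)))
      ≤⟨ *-monoʳ-≤ 2 (*-monoʳ-≤ 16 (*-monoʳ-≤ (2 ^ (2 * l + m + 4)) (length-hyperbolic L))) ⟩
    2 * (16 * (2 ^ (2 * l + m + 4) * (L * (L * 2 ^ (2 + L)))))
      ≡⟨ lemma (2 ^ (2 * l + m + 4)) L (2 ^ (2 + L)) ⟩
    L * L * (32 * (2 ^ (2 * l + m + 4) * 2 ^ (2 + L)))
      ≡⟨ cong (L * L *_) (trans (cong (32 *_) (sym (^-distribˡ-+-* 2 (2 * l + m + 4) (2 + L)))) (trans (sym (^-distribˡ-+-* 2 5 (2 * l + m + 4 + (2 + L))))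
           (trans (cong (2 ^_) (exponents l m)) (^-distribˡ-+-* 2 (5 * m + 20) (5 * l))))) ⟩
    L * L * (2 ^ (5 * m + 20) * 2 ^ (5 * l))
      ≡⟨ lemma′ (L * L) (2 ^ (5 * m + 20)) (2 ^ (5 * l)) ⟩
    2 ^ (5 * m + 20) * (L * L * 2 ^ (5 * l)) ∎
    where
    open ≤-Reasoning
    L = log-size l
    P = 2 ^ (2 * l + m + 4)
    lemma : ∀ x L y → 2 * (16 * (x * (L * (L * y)))) ≡ L * L * (32 * (x * y))
    lemma = ℕ-solve
    lemma′ : ∀ x y z → x * (y * z) ≡ y * (x * z)
    lemma′ = ℕ-solve
    exponents : ∀ l m → 5 + (2 * l + m + 4 + (2 + (3 * l + 4 * m + 9))) ≡ 5 * m + 20 + 5 * l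
    exponents = ℕ-solve

  encode : ∀ {N l t} → N < 2 ^ (6 * l + 6) → Irregular N t → ∃ λ k → k ∈ codes l × TripleCode N t k
  encode {N} {l} {t} N< I with companion I
  ... | C with Companion.a C ≤? Companion.e C
  ... | yes a≤e = from (residueCode-exists C.1≤a 1≤∣n∣ C.X²)
    where
    module C = Companion C
    from : (∃ λ tag → ∃₂ λ j z → ResidueCode m C.a ℤ.∣ C.X ∣ tag j z × j * j ≤ C.a × z * C.a ≤ 2 * m * ℤ.∣ C.X ∣) →
      ∃ λ k → k ∈ codes l × TripleCode N t k
    from (tag , j , z , R , j²≤ , zp≤) = (((true , tag) , (ℤ.sign C.X , ℤ.sign C.Y)) , (C.a , (j , C.r , z))) ,
      ∈-codes , record { comp = C ; signs = refl ; p≡ = refl ; ρ≡ = refl ; residue = R }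
      where
      edges : Edges m N C.a C.b C.e C.r ℤ.∣ C.X ∣ j z
      edges = record { 1≤m = 1≤∣n∣ ; 1≤p = C.1≤a ; p≤q = <⇒≤ C.a<b ; p≤w = a≤e ; pqw≤ = C.abe≤
        ; ρ²≤ = ≤-trans (pos-≤ n (Root.is-root C.ab-root)) (+-monoʳ-≤ (C.a * C.b) (m≤m*n m m {{>-nonZero 1≤∣n∣}})) ; x² = C.X² ; j²≤p = j²≤ ; zp≤ = zp≤ }
      ∈-codes : (((true , tag) , (ℤ.sign C.X , ℤ.sign C.Y)) , (C.a , (j , C.r , z))) ∈ codes l
      ∈-codes = ∈-cartesianProduct⁺ (∈-cartesianProduct⁺ (∈-cartesianProduct⁺ (∈-bools true) (∈-bools tag)) (∈-cartesianProduct⁺ (∈-signs _) (∈-signs _)))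
        (∈-cartesianProduct⁺ (∈-upTo⁺ (p-bound {l = l} edges N<)) (∈-hyperbolic {log-size l} (residueCode-positive C.1≤a R) (product-bound {l = l} edges N<)))
  ... | no a≰e = from (residueCode-exists C.1≤e 1≤∣n∣ (trans C.Y² (cong (_+ m * m) (*-comm C.b C.e))))
    where
    module C = Companion C
    e≤a : C.e ≤ C.a
    e≤a = <⇒≤ (≰⇒> a≰e)
    from : (∃ λ tag → ∃₂ λ j z → ResidueCode m C.e ℤ.∣ C.Y ∣ tag j z × j * j ≤ C.e × z * C.e ≤ 2 * m * ℤ.∣ C.Y ∣) →
      ∃ λ k → k ∈ codes l × TripleCode N t k
    from (tag , j , z , R , j²≤ , zp≤) = (((false , tag) , (ℤ.sign C.X , ℤ.sign C.Y)) , (C.e , (j , ℤ.∣ C.X ∣ , z))) ,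
      ∈-codes , record { comp = C ; signs = refl ; p≡ = refl ; ρ≡ = refl ; residue = R }
      where
      edges : Edges m N C.e C.a C.b ℤ.∣ C.X ∣ ℤ.∣ C.Y ∣ j z
      edges = record { 1≤m = 1≤∣n∣ ; 1≤p = C.1≤e ; p≤q = e≤a ; p≤w = ≤-trans e≤a (<⇒≤ C.a<b)
        ; pqw≤ = subst (_≤ 27 * (m * m) * N) (rotate C.a C.b C.e) C.abe≤
        ; ρ²≤ = ≤-reflexive (trans C.X² (cong (_+ m * m) (*-comm C.a C.e)))
        ; x² = trans C.Y² (cong (_+ m * m) (*-comm C.b C.e)) ; j²≤p = j²≤ ; zp≤ = zp≤ }
        where
        rotate : ∀ a b e → a * b * e ≡ e * a * b
        rotate = ℕ-solve
      ∈-codes : (((false , tag) , (ℤ.sign C.X , ℤ.sign C.Y)) , (C.e , (j , ℤ.∣ C.X ∣ , z))) ∈ codes l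
      ∈-codes = ∈-cartesianProduct⁺ (∈-cartesianProduct⁺ (∈-cartesianProduct⁺ (∈-bools false) (∈-bools tag)) (∈-cartesianProduct⁺ (∈-signs _) (∈-signs _)))
        (∈-cartesianProduct⁺ (∈-upTo⁺ (p-bound {l = l} edges N<)) (∈-hyperbolic {log-size l} (residueCode-positive C.1≤e R) (product-bound {l = l} edges N<)))

  2D₃≤D₂+codes : ∀ {N l} → N < 2 ^ (6 * l + 6) →
    2 * D₃ n N ≤ D₂ n N + (2 * length (triplesUpTo c₀) + 2 ^ (5 * m + 20) * (log-size l * log-size l * 2 ^ (5 * l)))
  2D₃≤D₂+codes {N} {l} N< = ≤-trans (2D₃≤D₂ (TripleCode N) (codes l) (encode {l = l} N<) tripleCode-injective)
    (+-monoʳ-≤ (D₂ n N) (+-monoʳ-≤ (2 * length (triplesUpTo c₀)) (length-codes l)))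

  -- The lower bound for the number of pairs

  -- With n = k² − h, the form (y + kv)² − n v² = y² + 2k y v + h v² has discriminant 4n and
  -- nonnegative coefficients.  Each primitive representation of c gives a root s of s² ≡ n modulo c.
  module _ (k h : ℕ) (1≤k : 1 ≤ k) (k²≡h+n : + (k * k) ≡ + h ℤ.+ n) where

    form : ℕ → ℕ → ℕ
    form y v = y * y + 2 * k * y * v + h * (v * v)

    form-monotone : ∀ y {v v′} → 1 ≤ y → v < v′ → form y v < form y v′
    form-monotone y {v} {v′} 1≤y v<v′ = +-mono-<-≤
      (+-monoʳ-< (y * y) (*-monoʳ-< (2 * k * y) {{>-nonZero (*-mono-≤ (*-mono-≤ {1} {2} (s≤s z≤n) 1≤k) 1≤y)}} v<v′))
      (*-monoʳ-≤ h (*-mono-≤ (<⇒≤ v<v′) (<⇒≤ v<v′)))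

    form-injective : ∀ y {v v′} → 1 ≤ y → form y v ≡ form y v′ → v ≡ v′
    form-injective y {v} {v′} 1≤y e with <-cmp v v′
    ... | tri< lt _ _ = contradiction e (<⇒≢ (form-monotone y 1≤y lt))
    ... | tri≈ _ eq _ = eq
    ... | tri> _ _ gt = contradiction (sym e) (<⇒≢ (form-monotone y 1≤y gt))

    -- With x = y + kv the form is x² - nv², so s ≡ -x/v modulo c satisfies s² ≡ n. `kernel` is this
    -- congruence cleared of the inverse of v.
    record Represents (y v c s : ℕ) : Set where
      field
        1≤y : 1 ≤ y
        1≤v : 1 ≤ v
        yv-coprime : gcd y v ≡ 1
        form≡ : form y v ≡ c
        kernel : c ∣ s * v + (y + k * v)
    open Represents

    -- The vectors (y + kv, v) and (y′ + kv′, v′) lie in the same lattice x + sv ≡ 0 modulo c of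
    -- index c, so c divides their determinant, in which the terms with k cancel.
    cross-divides : ∀ {y v y′ v′ c s} → Represents y v c s → Represents y′ v′ c s → y′ * v ≤ y * v′ →
      c ∣ y * v′ ∸ y′ * v
    cross-divides {y} {v} {y′} {v′} {c} {s} P P′ le =
      ∣m+n∣m⇒∣n (subst (c ∣_) eq (∣n⇒∣m*n v′ (kernel P))) (subst (c ∣_) eq′ (∣n⇒∣m*n v (kernel P′)))
      where
      A = s * v * v′ + k * v * v′
      eq′ : v * (s * v′ + (y′ + k * v′)) ≡ A + y′ * v
      eq′ = lemma s v v′ y′ k
        where
        lemma : ∀ s v v′ y′ k → v * (s * v′ + (y′ + k * v′)) ≡ s * v * v′ + k * v * v′ + y′ * v
        lemma = ℕ-solve
      eq : v′ * (s * v + (y + k * v)) ≡ A + y′ * v + (y * v′ ∸ y′ * v)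
      eq = trans (lemma s v v′ y k) (trans (cong (λ z → A + z) (sym (m+[n∸m]≡n le))) (sym (+-assoc A (y′ * v) _)))
        where
        lemma : ∀ s v v′ y k → v′ * (s * v + (y + k * v)) ≡ s * v * v′ + k * v * v′ + y * v′
        lemma = ℕ-solve

    y²<c : ∀ {y v c s} → Represents y v c s → y * y < c
    y²<c {y} {v} {c} P = subst (y * y <_) (form≡ P) (≤-trans (m<m+n (y * y) (*-mono-≤ (*-mono-≤ (*-mono-≤ {1} {2} (s≤s z≤n) 1≤k) (1≤y P)) (1≤v P))) (m≤m+n _ (h * (v * v))))

    v²≤c : ∀ {y v c s} → 1 ≤ h → Represents y v c s → v * v ≤ c
    v²≤c {y} {v} {c} 1≤h P = subst (v * v ≤_) (form≡ P) (≤-trans (≤-trans (≤-reflexive (sym (*-identityˡ (v * v)))) (*-monoˡ-≤ (v * v) 1≤h)) (m≤n+m _ (y * y + 2 * k * y * v)))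

    ∣-from-cross : ∀ {y v} y′ → gcd y v ≡ 1 → y ∣ y′ * v → y ∣ y′
    ∣-from-cross {y} {v} y′ e d = coprime-divisor (gcd≡1⇒coprime e) (subst (y ∣_) (*-comm y′ v) d)

    -- For h ≥ 1 the bounds y² < c and v′² ≤ c put the determinant below c, so it is 0 and
    -- coprimality applies. For h = 0 the second bound fails, but c = y(y + 2kv), so y and y′ both
    -- divide c and with it the determinant.
    mutually-divide : ∀ {y v y′ v′ c s} → Represents y v c s → Represents y′ v′ c s → y′ * v ≤ y * v′ → y ∣ y′ × y′ ∣ y
    mutually-divide {y} {v} {y′} {v′} {c} {s} P P′ le = by-h h refl
      where
      D = y * v′ ∸ y′ * v
      c∣D : c ∣ D
      c∣D = cross-divides P P′ le
      1≤h-case : 1 ≤ h → y ∣ y′ × y′ ∣ y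
      1≤h-case 1≤h = ∣-from-cross y′ (yv-coprime P) (divides v′ (trans y′v≡yv′ (*-comm y v′))) ,
        ∣-from-cross y (yv-coprime P′) (divides v (trans (sym y′v≡yv′) (*-comm y′ v)))
        where
        D<c : D < c
        D<c = ≤-<-trans (m∸n≤m (y * v′) (y′ * v)) (square-cancel-< (begin-strict
          y * v′ * (y * v′)    ≡⟨ lemma y v′ ⟩
          y * y * (v′ * v′)    ≤⟨ *-monoʳ-≤ (y * y) (v²≤c 1≤h P′) ⟩
          y * y * c            <⟨ *-monoˡ-< c {{>-nonZero (≤-trans (s≤s z≤n) (y²<c P))}} (y²<c P) ⟩
          c * c                ∎))
          where
          open ≤-Reasoning
          lemma : ∀ y v → y * v * (y * v) ≡ y * y * (v * v)
          lemma = ℕ-solve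
        D≡0 : D ≡ 0
        D≡0 with D in eq
        ... | zero = refl
        ... | suc _ = contradiction (∣⇒≤ (subst (c ∣_) eq c∣D)) (<⇒≱ (subst (_< c) eq D<c))
        y′v≡yv′ : y′ * v ≡ y * v′
        y′v≡yv′ = ≤-antisym le (m∸n≡0⇒m≤n D≡0)
      by-h : ∀ h′ → h ≡ h′ → y ∣ y′ × y′ ∣ y
      by-h (suc _) refl = 1≤h-case (s≤s z≤n)
      by-h zero refl = ∣-from-cross y′ (yv-coprime P) (∣m+n∣m⇒∣n (subst (y ∣_) (sym (m∸n+n≡m le)) (∣m⇒∣m*n v′ ∣-refl)) (∣-trans (y∣c P) c∣D)) ,
        ∣-from-cross y (yv-coprime P′) (subst (y′ ∣_) (m∸n+n≡m le) (∣m∣n⇒∣m+n (∣-trans (y∣c P′) c∣D) (∣m⇒∣m*n v ∣-refl)))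
        where
        y∣c : ∀ {y v} → Represents y v c s → y ∣ c
        y∣c {y} {v} P = subst (y ∣_) (form≡ P) (divides (y + 2 * k * v) (lemma y k v))
          where
          lemma : ∀ y k v → y * y + 2 * k * y * v + 0 * (v * v) ≡ (y + 2 * k * v) * y
          lemma = ℕ-solve

    represents-injective : ∀ {y v y′ v′ c s} → Represents y v c s → Represents y′ v′ c s → (y , v) ≡ (y′ , v′)
    represents-injective {y} {v} {y′} {v′} P P′ = cong₂ _,_ y≡y′ (form-injective y (1≤y P)
      (trans (form≡ P) (trans (sym (form≡ P′)) (cong (λ y → form y v′) (sym y≡y′)))))
      where
      y≡y′ : y ≡ y′
      y≡y′ with ≤-total (y′ * v) (y * v′)
      ... | inj₁ le = let d , d′ = mutually-divide P P′ le in ∣-antisym d d′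
      ... | inj₂ le = let d , d′ = mutually-divide P′ P le in ∣-antisym d′ d

    form-coprime : ∀ {y v} → gcd y v ≡ 1 → Coprime (form y v) v
    form-coprime {y} {v} e {d} (d∣c , d∣v) = y⊥v (d∣y , d∣v)
      where
      y⊥v : Coprime y v
      y⊥v = gcd≡1⇒coprime e
      d⊥y : Coprime d y
      d⊥y (x∣d , x∣y) = y⊥v (x∣y , ∣-trans x∣d d∣v)
      d∣y² : d ∣ y * y
      d∣y² = ∣m+n∣m⇒∣n (subst (d ∣_) (lemma y k v h) d∣c) (∣-trans d∣v (divides (2 * k * y + h * v) refl))
        where
        lemma : ∀ y k v h → y * y + 2 * k * y * v + h * (v * v) ≡ (2 * k * y + h * v) * v + y * y
        lemma = ℕ-solve
      d∣y : d ∣ y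
      d∣y = coprime-divisor d⊥y d∣y²

    solve-linear : ∀ c v t → .{{_ : NonZero c}} → Coprime c v → ∃ λ s → s < c × c ∣ s * v + t
    solve-linear c@(suc c-1) v t c⊥v = reduce (start (coprime-Bézout (Coprimality.sym c⊥v)))
      where
      start : Bézout.Identity 1 v c → ∃ λ s → c ∣ s * v + t
      start (Bézout.-+ x w eq) = x * t , divides (w * t) (begin
        x * t * v + t        ≡⟨ lemma x t v ⟩
        (1 + x * v) * t      ≡⟨ cong (_* t) eq ⟩
        w * c * t            ≡⟨ lemma′ w c t ⟩
        w * t * c            ∎)
        where
        open ≡-Reasoning
        lemma : ∀ x t v → x * t * v + t ≡ (1 + x * v) * t
        lemma = ℕ-solve
        lemma′ : ∀ w c t → w * c * t ≡ w * t * c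
        lemma′ = ℕ-solve
      -- Here xv ≡ 1 instead of -1 modulo c, and `c-1` plays the part of -1.
      start (Bézout.+- x w eq) = c-1 * x * t , divides ((1 + c-1 * w) * t) (begin
        c-1 * x * t * v + t              ≡⟨ lemma c-1 x t v ⟩
        (c-1 * (x * v) + 1) * t          ≡⟨ cong (λ z → (c-1 * z + 1) * t) (sym eq) ⟩
        (c-1 * (1 + w * suc c-1) + 1) * t ≡⟨ lemma′ c-1 w t ⟩
        (1 + c-1 * w) * t * suc c-1      ∎)
        where
        open ≡-Reasoning
        lemma : ∀ c x t v → c * x * t * v + t ≡ (c * (x * v) + 1) * t
        lemma = ℕ-solve
        lemma′ : ∀ c w t → (c * (1 + w * (1 + c)) + 1) * t ≡ (1 + c * w) * t * (1 + c)
        lemma′ = ℕ-solve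
      reduce : (∃ λ s → c ∣ s * v + t) → ∃ λ s → s < c × c ∣ s * v + t
      reduce (s , d) = s % c , m%n<n s c , ∣m+n∣m⇒∣n (subst (c ∣_) eq d) (divides (s / c * v) refl)
        where
        eq : s * v + t ≡ s / c * v * c + (s % c * v + t)
        eq = trans (cong (λ z → z * v + t) (m≡m%n+[m/n]*n s c)) (lemma (s % c) (s / c) c v t)
          where
          lemma : ∀ r q c v t → (r + q * c) * v + t ≡ q * v * c + (r * v + t)
          lemma = ℕ-solve

    -- Put T = y + kv. From sv = qc - T and T² - nv² = c follows v²(s² - n) = c(q²c - 2qT + 1), and
    -- v² cancels because c is coprime to v.
    kernel-root : ∀ {y v c s} → Represents y v c s → ∃ λ A → + (s * s) ≡ + c ℤ.* A ℤ.+ n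
    kernel-root {y} {v} {c} {s} P with kernel P
    ... | divides q sv+t≡qc = from (ℤ∣.∣ᵤ⇒∣ {+ c} {Z} c∣Z)
      where
      t = y + k * v
      Z = + s ℤ.* + s ℤ.- n
      C = + c
      V = + v
      hyp₁ : + s ℤ.* V ℤ.+ (+ y ℤ.+ + k ℤ.* V) ≡ + q ℤ.* C
      hyp₁ = trans (cong₂ ℤ._+_ (sym (ℤₚ.pos-* s v)) (trans (cong (λ z → + y ℤ.+ z) (sym (ℤₚ.pos-* k v))) (sym (ℤₚ.pos-+ y (k * v)))))
        (trans (sym (ℤₚ.pos-+ (s * v) t)) (trans (cong +_ sv+t≡qc) (ℤₚ.pos-* q c)))
      hyp₂ : + y ℤ.* + y ℤ.+ + 2 ℤ.* + k ℤ.* + y ℤ.* V ℤ.+ + h ℤ.* (V ℤ.* V) ≡ C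
      hyp₂ = trans (sym (trans (ℤₚ.pos-+ (y * y + 2 * k * y * v) (h * (v * v)))
        (cong₂ ℤ._+_ (trans (ℤₚ.pos-+ (y * y) (2 * k * y * v)) (cong₂ ℤ._+_ (pos-sq y) (trans (ℤₚ.pos-* (2 * k * y) v) (cong (ℤ._* V) (trans (ℤₚ.pos-* (2 * k) y) (cong (ℤ._* + y) (ℤₚ.pos-* 2 k)))))))
          (trans (ℤₚ.pos-* h (v * v)) (cong (+ h ℤ.*_) (pos-sq v)))))) (cong +_ (form≡ P))
      hyp₃ : + k ℤ.* + k ≡ + h ℤ.+ n
      hyp₃ = trans (sym (pos-sq k)) k²≡h+n
      T = + y ℤ.+ + k ℤ.* V
      W = + q ℤ.* + q ℤ.* C ℤ.- + 2 ℤ.* + q ℤ.* T ℤ.+ + 1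
      v²Z≡cW : V ℤ.* V ℤ.* Z ≡ C ℤ.* W
      v²Z≡cW = linear₃ (+ s ℤ.* V ℤ.+ + q ℤ.* C ℤ.- T) (+ 1) (V ℤ.* V) hyp₁ hyp₂ hyp₃ (lemma (+ s) V (+ y) (+ k) (+ h) (+ q) C n)
        where
        lemma : ∀ s v y k h q c n →
          v ℤ.* v ℤ.* (s ℤ.* s ℤ.- n) ℤ.- c ℤ.* (q ℤ.* q ℤ.* c ℤ.- + 2 ℤ.* q ℤ.* (y ℤ.+ k ℤ.* v) ℤ.+ + 1) ≡
          (s ℤ.* v ℤ.+ q ℤ.* c ℤ.- (y ℤ.+ k ℤ.* v)) ℤ.* (s ℤ.* v ℤ.+ (y ℤ.+ k ℤ.* v) ℤ.- q ℤ.* c)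
            ℤ.+ + 1 ℤ.* (y ℤ.* y ℤ.+ + 2 ℤ.* k ℤ.* y ℤ.* v ℤ.+ h ℤ.* (v ℤ.* v) ℤ.- c)
            ℤ.+ (v ℤ.* v) ℤ.* (k ℤ.* k ℤ.- (h ℤ.+ n))
        lemma = ℤ-solve
      c⊥v : Coprime c v
      c⊥v = subst (λ c → Coprime c v) (form≡ P) (form-coprime {y} (yv-coprime P))
      c∣Z : c ∣ ℤ.∣ Z ∣
      c∣Z = coprime-divisor c⊥v (coprime-divisor c⊥v (divides ℤ.∣ W ∣ (begin
        v * (v * ℤ.∣ Z ∣)         ≡⟨ sym (*-assoc v v ℤ.∣ Z ∣) ⟩
        v * v * ℤ.∣ Z ∣           ≡⟨ cong (_* ℤ.∣ Z ∣) (sym (ℤₚ.abs-* V V)) ⟩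
        ℤ.∣ V ℤ.* V ∣ * ℤ.∣ Z ∣   ≡⟨ sym (ℤₚ.abs-* (V ℤ.* V) Z) ⟩
        ℤ.∣ V ℤ.* V ℤ.* Z ∣       ≡⟨ cong ℤ.∣_∣ v²Z≡cW ⟩
        ℤ.∣ C ℤ.* W ∣             ≡⟨ ℤₚ.abs-* C W ⟩
        c * ℤ.∣ W ∣               ≡⟨ *-comm c ℤ.∣ W ∣ ⟩
        ℤ.∣ W ∣ * c               ∎)))
        where open ≡-Reasoning
      from : + c ℤ∣.∣ Z → ∃ λ A → + (s * s) ≡ + c ℤ.* A ℤ.+ n
      from (ℤ∣.divides A Z≡) = A , trans (pos-sq s) (linear₁ (+ 1) Z≡ (lemma (+ s) A C n))
        where
        lemma : ∀ s A c n → s ℤ.* s ℤ.- (c ℤ.* A ℤ.+ n) ≡ + 1 ℤ.* (s ℤ.* s ℤ.- n ℤ.- A ℤ.* c)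
        lemma = ℤ-solve

    PairOrDegenerate : ℕ → ℕ → Set
    PairOrDegenerate y v = (∃₂ λ a s → 1 ≤ a × a < form y v × Root a (form y v) s × Represents y v (form y v) s)
                         ⊎ (∃ λ s → + (s * s) ≡ n × Represents y v (form y v) s)

    pair-or-degenerate : ∀ {y v} → 1 ≤ y → 1 ≤ v → gcd y v ≡ 1 → c₀ < form y v → PairOrDegenerate y v
    pair-or-degenerate {y} {v} 1≤y 1≤v e c₀<c = with-kernel (solve-linear c v (y + k * v) {{>-nonZero 1≤c}} (form-coprime {y} e))
      where
      c = form y v
      1≤c : 1 ≤ c
      1≤c = ≤-trans (s≤s z≤n) c₀<c
      n<c : ℤ.∣ n ∣ < c
      n<c = ≤-<-trans (≤-trans (m≤n*m ℤ.∣ n ∣ 4) 4n≤c₀) c₀<c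
      with-cofactor : ∀ {s A} → Represents y v c s → + (s * s) ≡ + c ℤ.* A ℤ.+ n → (∃ λ a → A ≡ + a × a < c) → PairOrDegenerate y v
      with-cofactor {s} P s² (zero , refl , _) = inj₂ (s , trans s² (trans (cong (ℤ._+ n) (ℤₚ.*-zeroʳ (+ c))) (ℤₚ.+-identityˡ n)) , P)
      with-cofactor {s} P s² (a@(suc _) , refl , a<c) =
        inj₁ (a , s , s≤s z≤n , a<c , root (trans s² (cong (ℤ._+ n) (trans (ℤₚ.*-comm (+ c) (+ a)) (sym (ℤₚ.pos-* a c))))) , P)
      with-kernel : (∃ λ s → s < c × c ∣ s * v + (y + k * v)) → PairOrDegenerate y v
      with-kernel (s , s<c , d) = with-cofactor P (proj₂ (kernel-root P)) (cofactor-bounds n<c s<c (proj₂ (kernel-root P)))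
        where
        P : Represents y v c s
        P = record { 1≤y = 1≤y ; 1≤v = 1≤v ; yv-coprime = e ; form≡ = refl ; kernel = d }

    data PairOfForm : ℕ × ℕ → (ℕ × ℕ) ⊎ ((ℕ × ℕ) ⊎ ℕ) → Set where
      paired : ∀ {y v a c s} → Root a c s → Represents y v c s → PairOfForm (y , v) (inj₁ (a , c))
      small : ∀ {x} → PairOfForm x (inj₂ (inj₁ x))
      degenerate : ∀ {y v c s} → + (s * s) ≡ n → Represents y v c s → PairOfForm (y , v) (inj₂ (inj₂ c))

    pairOfForm-injective : ∀ {x x′ t} → PairOfForm x t → PairOfForm x′ t → x ≡ x′
    pairOfForm-injective (paired {y} {v} {a} {c} {s} r P) (paired r′ P′) =
      represents-injective P (subst (λ s → Represents _ _ c s) (sym (root-unique r r′)) P′)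
    pairOfForm-injective small small = refl
    pairOfForm-injective (degenerate {c = c} {s} e P) (degenerate e′ P′) =
      represents-injective P (subst (λ s → Represents _ _ c s) (square-injective (ℤₚ.+-injective (trans e′ (sym e)))) P′)

    -- The profile `w` is chosen later: constant for nonsquare n, a hyperbola for square n. The c₀²
    -- accounts for values of the form up to c₀, since y and v never exceed the value.
    D₂-lower-bound : ∀ w Y N (degenerates : List ℕ) →
      (∀ f c → + (f * f) ≡ n → 1 ≤ c → c ≤ N → c ∈ degenerates) →
      (∀ {y v} → 1 ≤ y → y ≤ Y → v ≤ w y → form y v ≤ N) →
      length (coprime-region w Y) ≤
      D₂ n N + (c₀ * c₀ + length degenerates)
    D₂-lower-bound w Y N degenerates deg∈ form≤N = begin
      length region
        ≤⟨ length-≤-by-injection PairOfForm region targets (region-unique w Y) total (λ _ _ → pairOfForm-injective) ⟩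
      length targets
        ≡⟨ trans (length-sum (D-pairs n N) others) (cong (λ z → D₂ n N + z) (trans (length-sum smalls degenerates)
             (cong (_+ length degenerates) (trans (length-cartesianProduct (range c₀) (range c₀)) (cong₂ _*_ (length-range c₀) (length-range c₀)))))) ⟩
      D₂ n N + (c₀ * c₀ + length degenerates) ∎
      where
      open ≤-Reasoning
      region = coprime-region w Y
      smalls = cartesianProduct (range c₀) (range c₀)
      others = sum-list smalls degenerates
      targets = sum-list (D-pairs n N) others
      total : ∀ {x} → x ∈ region → ∃ λ t → t ∈ targets × PairOfForm x t
      total {y , v} x∈ with ∈-region⁻ {w} {Y} x∈
      ... | (1≤y , y≤Y) , (1≤v , v≤) , e with form y v ≤? c₀
      ... | yes c≤c₀ = _ , ∈-sumʳ {xs = D-pairs n N} (∈-sumˡ (∈-cartesianProduct⁺ (∈-range⁺ 1≤y (≤-trans y≤c c≤c₀)) (∈-range⁺ 1≤v (≤-trans v≤c c≤c₀)))) , small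
        where
        y≤c : y ≤ form y v
        y≤c = ≤-trans (m≤m*n y y {{>-nonZero 1≤y}}) (≤-trans (m≤m+n (y * y) (2 * k * y * v)) (m≤m+n _ _))
        v≤c : v ≤ form y v
        v≤c = ≤-trans (m≤n*m v (2 * k * y) {{>-nonZero (*-mono-≤ (*-mono-≤ {1} {2} (s≤s z≤n) 1≤k) 1≤y)}})
          (≤-trans (m≤n+m (2 * k * y * v) (y * y)) (m≤m+n _ _))
      ... | no c≰c₀ = code (pair-or-degenerate 1≤y 1≤v e (≰⇒> c≰c₀))
        where
        code : PairOrDegenerate y v → ∃ λ t → t ∈ targets × PairOfForm (y , v) t
        code (inj₁ (a , s , 1≤a , a<c , r , P)) = _ , ∈-sumˡ (∈-D-pairs⁺ n 1≤a a<c (form≤N 1≤y y≤Y v≤) (root-cond r)) , paired r P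
        code (inj₂ (s , s² , P)) = _ ,
          ∈-sumʳ {xs = D-pairs n N} (∈-sumʳ {xs = smalls} (deg∈ s (form y v) s² (≤-trans (s≤s z≤n) (≰⇒> c≰c₀)) (form≤N 1≤y y≤Y v≤))) , degenerate s² P

  -- Comparison of the error with the number of pairs

  code-size : ℕ → ℕ
  code-size l = log-size l * log-size l * 2 ^ (5 * l)

  1≤code-size : ∀ l → 1 ≤ code-size l
  1≤code-size l = *-mono-≤ (*-mono-≤ 1≤L 1≤L) (m^n>0 2 (5 * l))
    where
    1≤L : 1 ≤ log-size l
    1≤L = ≤-trans (s≤s z≤n) (m≤n+m 9 (3 * l + 4 * m))

  -- Between 2^(5l) and 2^(6l) there is a factor 2^l, which outgrows the squared logarithm.
  code-size-negligible : ∀ A → ∃ λ l₀ → ∀ l → l₀ ≤ l → A * code-size l ≤ 2 ^ (6 * l)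
  code-size-negligible A = proj₁ exponential , λ l l₀≤l → begin
    A * (log-size l * log-size l * 2 ^ (5 * l))
      ≡⟨ sym (*-assoc A (log-size l * log-size l) (2 ^ (5 * l))) ⟩
    A * (log-size l * log-size l) * 2 ^ (5 * l)
      ≤⟨ *-monoˡ-≤ (2 ^ (5 * l)) (subst (λ L → A * (L * L) ≤ 2 ^ l) (sym (+-assoc (3 * l) (4 * m) 9)) (proj₂ exponential l l₀≤l)) ⟩
    2 ^ l * 2 ^ (5 * l)
      ≡⟨ sym (^-distribˡ-+-* 2 l (5 * l)) ⟩
    2 ^ (6 * l) ∎
    where
    open ≤-Reasoning
    exponential = square-below-exponential A (4 * m + 9)

  c₀-pairs c₀-triples : ℕ
  c₀-pairs = length (pairsUpTo c₀)
  c₀-triples = 2 * length (triplesUpTo c₀)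

  error-constant : ℕ
  error-constant = c₀-pairs + (c₀-triples + 2 ^ (5 * m + 20))

  distance-bound : ∀ {N l} (degenerates : List ℕ) → N < 2 ^ (6 * l + 6) →
    (∀ f c → + (f * f) ≡ n → 1 ≤ c → c ≤ N → c ∈ degenerates) →
    ∣ 2 * D₃ n N - D₂ n N ∣ ≤ error-constant * code-size l + length degenerates
  distance-bound {N} {l} degenerates N< deg∈ = distance-≤
    (≤-trans (2D₃≤D₂+codes {N} {l} N<) (+-monoʳ-≤ (D₂ n N) (begin
      c₀-triples + B * Z                      ≤⟨ +-monoˡ-≤ (B * Z) (scale c₀-triples) ⟩
      c₀-triples * Z + B * Z                  ≡⟨ sym (*-distribʳ-+ Z c₀-triples B) ⟩
      (c₀-triples + B) * Z                    ≤⟨ *-monoˡ-≤ Z (m≤n+m (c₀-triples + B) c₀-pairs) ⟩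
      error-constant * Z                      ≤⟨ m≤m+n _ _ ⟩
      error-constant * Z + length degenerates ∎)))
    (≤-trans (D₂≤2D₃ N degenerates deg∈) (+-monoʳ-≤ (2 * D₃ n N) (+-monoˡ-≤ (length degenerates) (begin
      c₀-pairs                                ≤⟨ scale c₀-pairs ⟩
      c₀-pairs * Z                            ≤⟨ *-monoˡ-≤ Z (m≤m+n c₀-pairs _) ⟩
      error-constant * Z                      ∎))))
    where
    open ≤-Reasoning
    B = 2 ^ (5 * m + 20)
    Z = code-size l
    scale : ∀ x → x ≤ x * Z
    scale x = m≤m*n x Z {{>-nonZero (1≤code-size l)}}

  -- On the square y, v ≤ M the form is at most qM² with q = 1 + 2k + h. Since q ≤ 2^(2q), the side
  -- M = 2^(3l - q) keeps it below 2^(6l) ≤ N, and a quarter of the pairs in the square are coprime.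
  D₂-linear : (k h : ℕ) → 1 ≤ k → + (k * k) ≡ + h ℤ.+ n → ¬ IsSquare n →
    ∃ λ C → ∃ λ l₀ → ∀ {N l} → l₀ ≤ l → 2 ^ (6 * l) ≤ N → 2 ^ (6 * l) ≤ C * (D₂ n N + c₀ * c₀)
  D₂-linear k h 1≤k e nonsquare = 2 ^ (q + q) * 4 , q , bound
    where
    q = 1 + 2 * k + h
    bound : ∀ {N l} → q ≤ l → 2 ^ (6 * l) ≤ N → 2 ^ (6 * l) ≤ 2 ^ (q + q) * 4 * (D₂ n N + c₀ * c₀)
    bound {N} {l} q≤l lo = begin
      2 ^ (6 * l)                                         ≡⟨ sym scale ⟩
      2 ^ (q + q) * (M * M)                               ≤⟨ *-monoʳ-≤ (2 ^ (q + q)) (coprime-box M M) ⟩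
      2 ^ (q + q) * (4 * length (coprime-region w M))
        ≤⟨ *-monoʳ-≤ (2 ^ (q + q)) (*-monoʳ-≤ 4 (subst (length (coprime-region w M) ≤_) (cong (λ z → D₂ n N + z) (+-identityʳ (c₀ * c₀))) counted)) ⟩
      2 ^ (q + q) * (4 * (D₂ n N + c₀ * c₀))              ≡⟨ sym (*-assoc (2 ^ (q + q)) 4 _) ⟩
      2 ^ (q + q) * 4 * (D₂ n N + c₀ * c₀)                ∎
      where
      open ≤-Reasoning
      M = 2 ^ (3 * l ∸ q)
      w : ℕ → ℕ
      w _ = M
      q≤3l : q ≤ 3 * l
      q≤3l = ≤-trans q≤l (m≤n*m l 3)
      2^qM : 2 ^ q * M ≡ 2 ^ (3 * l)
      2^qM = trans (sym (^-distribˡ-+-* 2 q _)) (cong (2 ^_) (m+[n∸m]≡n q≤3l))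
      scale : 2 ^ (q + q) * (M * M) ≡ 2 ^ (6 * l)
      scale = ≡.begin
        2 ^ (q + q) * (M * M)           ≡.≡⟨ cong (_* (M * M)) (^-distribˡ-+-* 2 q q) ⟩
        2 ^ q * 2 ^ q * (M * M)         ≡.≡⟨ lemma (2 ^ q) M ⟩
        2 ^ q * M * (2 ^ q * M)         ≡.≡⟨ cong₂ _*_ 2^qM 2^qM ⟩
        2 ^ (3 * l) * 2 ^ (3 * l)       ≡.≡⟨ sym (^-distribˡ-+-* 2 (3 * l) (3 * l)) ⟩
        2 ^ (3 * l + 3 * l)             ≡.≡⟨ cong (2 ^_) (lemma′ l) ⟩
        2 ^ (6 * l)                     ≡.∎
        where
        module ≡ = ≡-Reasoning
        lemma : ∀ x M → x * x * (M * M) ≡ x * M * (x * M)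
        lemma = ℕ-solve
        lemma′ : ∀ l → 3 * l + 3 * l ≡ 6 * l
        lemma′ = ℕ-solve
      form≤N : ∀ {y v} → 1 ≤ y → y ≤ M → v ≤ M → form k h 1≤k e y v ≤ N
      form≤N {y} {v} _ y≤ v≤ = ≤-trans (begin
        y * y + 2 * k * y * v + h * (v * v)
          ≤⟨ +-mono-≤ (+-mono-≤ (*-mono-≤ y≤ y≤) (*-mono-≤ (*-monoʳ-≤ (2 * k) y≤) v≤)) (*-monoʳ-≤ h (*-mono-≤ v≤ v≤)) ⟩
        M * M + 2 * k * M * M + h * (M * M)  ≡⟨ lemma M k h ⟩
        q * (M * M)
          ≤⟨ *-monoˡ-≤ (M * M) (≤-trans (<⇒≤ (n<2^n q)) (^-monoʳ-≤ 2 (m≤m+n q q))) ⟩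
        2 ^ (q + q) * (M * M)                ≡⟨ scale ⟩
        2 ^ (6 * l)                          ∎) lo
        where
        lemma : ∀ M k h → M * M + 2 * k * M * M + h * (M * M) ≡ (1 + 2 * k + h) * (M * M)
        lemma = ℕ-solve
      counted : length (coprime-region w M) ≤ D₂ n N + (c₀ * c₀ + 0)
      counted = D₂-lower-bound k h 1≤k e w M N [] (λ f _ f² _ _ → contradiction (f , f²) nonsquare) form≤N

  nonsquare-case : ¬ IsSquare n → (k h : ℕ) → 1 ≤ k → + (k * k) ≡ + h ℤ.+ n → ∀ κ →
    Eventually (λ N → κ * ∣ 2 * D₃ n N - D₂ n N ∣ ≤ D₂ n N)
  nonsquare-case nonsquare k h 1≤k e κ = from (D₂-linear k h 1≤k e nonsquare)
    where
    from : (∃ λ C → ∃ λ l₀ → ∀ {N l} → l₀ ≤ l → 2 ^ (6 * l) ≤ N → 2 ^ (6 * l) ≤ C * (D₂ n N + c₀ * c₀)) →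
      Eventually (λ N → κ * ∣ 2 * D₃ n N - D₂ n N ∣ ≤ D₂ n N)
    from (C , l₁ , linear) = 2 ^ (6 * (l₁ + l₂)) , λ N N≥ → bound N N≥ (sixth-root N (≤-trans (m^n>0 2 (6 * (l₁ + l₂))) N≥))
      where
      l₂ = proj₁ (code-size-negligible (C * (κ * error-constant + c₀ * c₀)))
      negligible = proj₂ (code-size-negligible (C * (κ * error-constant + c₀ * c₀)))
      bound : ∀ N → 2 ^ (6 * (l₁ + l₂)) ≤ N → (∃ λ l → 2 ^ (6 * l) ≤ N × N < 2 ^ (6 * l + 6)) →
        κ * ∣ 2 * D₃ n N - D₂ n N ∣ ≤ D₂ n N
      bound N N≥ (l , lo , hi) = +-cancelʳ-≤ (c₀ * c₀) _ _ (begin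
        κ * ∣ 2 * D₃ n N - D₂ n N ∣ + c₀ * c₀
          ≤⟨ +-mono-≤ (*-monoʳ-≤ κ dist≤) (m≤m*n (c₀ * c₀) Z {{>-nonZero (1≤code-size l)}}) ⟩
        κ * (error-constant * Z) + c₀ * c₀ * Z     ≡⟨ lemma κ error-constant Z (c₀ * c₀) ⟩
        (κ * error-constant + c₀ * c₀) * Z         ≤⟨ *-cancelˡ-≤ C {{C≢0}} (begin
          C * ((κ * error-constant + c₀ * c₀) * Z)   ≡⟨ sym (*-assoc C _ Z) ⟩
          C * (κ * error-constant + c₀ * c₀) * Z     ≤⟨ negligible l (≤-trans (m≤n+m l₂ l₁) l≥) ⟩
          2 ^ (6 * l)                                ≤⟨ linear (≤-trans (m≤m+n l₁ l₂) l≥) lo ⟩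
          C * (D₂ n N + c₀ * c₀)                     ∎) ⟩
        D₂ n N + c₀ * c₀                           ∎)
        where
        open ≤-Reasoning
        Z = code-size l
        l≥ : l₁ + l₂ ≤ l
        l≥ = sixth-root-≥ {l = l} hi N≥
        dist≤ : ∣ 2 * D₃ n N - D₂ n N ∣ ≤ error-constant * Z
        dist≤ = subst (∣ 2 * D₃ n N - D₂ n N ∣ ≤_) (+-identityʳ _)
          (distance-bound {N} {l} [] hi (λ f _ f² _ _ → contradiction (f , f²) nonsquare))
        C≢0 : NonZero C
        C≢0 = >-nonZero (n≢0⇒n>0 λ C≡0 → <⇒≱ (m^n>0 2 (6 * l)) (subst (λ C → 2 ^ (6 * l) ≤ C * (D₂ n N + c₀ * c₀)) C≡0 (linear (≤-trans (m≤m+n l₁ l₂) l≥) lo)))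
        lemma : ∀ κ B Z c → κ * (B * Z) + c * Z ≡ (κ * B + c) * Z
        lemma = ℕ-solve

  -- The case of a square n

  module _ (k : ℕ) (1≤k : 1 ≤ k) (k²≡n : + (k * k) ≡ n) where

    k²≡0+n : + (k * k) ≡ + 0 ℤ.+ n
    k²≡0+n = trans k²≡n (sym (ℤₚ.+-identityˡ n))

    all-degenerate : ∀ N f c → + (f * f) ≡ n → 1 ≤ c → c ≤ N → c ∈ range N
    all-degenerate N _ _ _ 1≤c c≤N = ∈-range⁺ 1≤c c≤N

    -- The value y² + 2kyv is at most N for y ≤ U and yv ≤ MU, as y² and 2kyv are each at most N/2.
    -- The J strips under this hyperbola each hold a fixed proportion of N, and J can be taken as
    -- large as desired.
    D₂-superlinear : ∀ K → Eventually (λ N → K * N ≤ D₂ n N)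
    D₂-superlinear K = 8 * k * U + 2 * (U * U) + c₀ * c₀ , bound
      where
      -- 64k is 8 for the proportion in a strip times 8k from N ≤ 8k·MU. The 2 pays for the N
      -- degenerate values and for c₀² ≤ N.
      J = 64 * k * (K + 2)
      U = 8 ^ J
      1≤U : 1 ≤ U
      1≤U = m^n>0 8 J
      instance
        d≢0 : NonZero (4 * k * U)
        d≢0 = >-nonZero (*-mono-≤ (*-mono-≤ {1} {4} (s≤s z≤n) 1≤k) 1≤U)
      bound : ∀ N → 8 * k * U + 2 * (U * U) + c₀ * c₀ ≤ N → K * N ≤ D₂ n N
      bound N N≥ = +-cancelʳ-≤ (c₀ * c₀ + N) _ _ (begin
        K * N + (c₀ * c₀ + N)      ≤⟨ +-monoʳ-≤ (K * N) (+-monoˡ-≤ N (≤-trans (m≤n+m (c₀ * c₀) _) N≥)) ⟩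
        K * N + (N + N)            ≡⟨ lemma K N ⟩
        (K + 2) * N                ≤⟨ *-cancelˡ-≤ (64 * k) {{>-nonZero (*-mono-≤ {1} {64} (s≤s z≤n) 1≤k)}} (begin
          64 * k * ((K + 2) * N)     ≡⟨ sym (*-assoc (64 * k) (K + 2) N) ⟩
          J * N                      ≤⟨ *-monoʳ-≤ J N≤ ⟩
          J * (2 * (M * (4 * k * U))) ≡⟨ lemma₁ J M k U ⟩
          8 * k * (J * (M * U))      ≤⟨ *-monoʳ-≤ (8 * k) (coprime-hyperbola M J J ≤-refl) ⟩
          8 * k * (8 * length region) ≡⟨ lemma₂ k (length region) ⟩
          64 * k * length region     ∎) ⟩
        length region
          ≤⟨ D₂-lower-bound k 0 1≤k k²≡0+n (hyperbola (M * U)) U N (range N) (all-degenerate N) form≤N ⟩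
        D₂ n N + (c₀ * c₀ + length (range N)) ≡⟨ cong (λ z → D₂ n N + (c₀ * c₀ + z)) (length-range N) ⟩
        D₂ n N + (c₀ * c₀ + N)     ∎)
        where
        open ≤-Reasoning
        M = N / (4 * k * U)
        region = coprime-region (hyperbola (M * U)) U
        lemma : ∀ K N → K * N + (N + N) ≡ (K + 2) * N
        lemma = ℕ-solve
        lemma₁ : ∀ J M k U → J * (2 * (M * (4 * k * U))) ≡ 8 * k * (J * (M * U))
        lemma₁ = ℕ-solve
        lemma₂ : ∀ k l → 8 * k * (8 * l) ≡ 64 * k * l
        lemma₂ = ℕ-solve
        N≤ : N ≤ 2 * (M * (4 * k * U))
        N≤ = +-cancelʳ-≤ N _ _ (begin
          N + N                                                ≡⟨ cong₂ _+_ N≡ N≡ ⟩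
          N % d + M * d + (N % d + M * d)
            ≤⟨ +-mono-≤ (+-monoˡ-≤ (M * d) (<⇒≤ (m%n<n N d))) (+-monoˡ-≤ (M * d) (<⇒≤ (m%n<n N d))) ⟩
          d + M * d + (d + M * d)                              ≡⟨ lemma₃ k U (M * d) ⟩
          2 * (M * d) + 8 * k * U
            ≤⟨ +-monoʳ-≤ (2 * (M * d)) (≤-trans (m≤m+n _ _) (≤-trans (m≤m+n _ _) N≥)) ⟩
          2 * (M * d) + N                                      ∎)
          where
          d = 4 * k * U
          N≡ : N ≡ N % d + M * d
          N≡ = m≡m%n+[m/n]*n N d
          lemma₃ : ∀ k U x → 4 * k * U + x + (4 * k * U + x) ≡ 2 * x + 8 * k * U
          lemma₃ = ℕ-solve
        form≤N : ∀ {y v} → 1 ≤ y → y ≤ U → v ≤ hyperbola (M * U) y → form k 0 1≤k k²≡0+n y v ≤ N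
        form≤N {y} {v} 1≤y y≤ v≤ = *-cancelˡ-≤ 2 (begin
          2 * (y * y + 2 * k * y * v + 0 * (v * v))  ≡⟨ lemma₃ k y v ⟩
          2 * (y * y) + 4 * k * (y * v)
            ≤⟨ +-mono-≤ (*-monoʳ-≤ 2 (*-mono-≤ y≤ y≤)) (*-monoʳ-≤ (4 * k) (≤-trans (*-monoʳ-≤ y v≤) (hyperbola-≤ (M * U) y))) ⟩
          2 * (U * U) + 4 * k * (M * U)
            ≤⟨ +-mono-≤ (≤-trans (m≤n+m _ (8 * k * U)) (≤-trans (m≤m+n _ (c₀ * c₀)) N≥)) (≤-trans (≤-reflexive (lemma₄ k M U)) (m/n*n≤m N (4 * k * U))) ⟩
          N + N                                      ≡⟨ cong (λ z → N + z) (sym (+-identityʳ N)) ⟩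
          2 * N                                      ∎)
          where
          lemma₃ : ∀ k y v → 2 * (y * y + 2 * k * y * v + 0 * (v * v)) ≡ 2 * (y * y) + 4 * k * (y * v)
          lemma₃ = ℕ-solve
          lemma₄ : ∀ k M U → 4 * k * (M * U) ≡ M * (4 * k * U)
          lemma₄ = ℕ-solve

    square-case : ∀ κ → Eventually (λ N → κ * ∣ 2 * D₃ n N - D₂ n N ∣ ≤ D₂ n N)
    square-case κ = N₁ + 2 ^ (6 * l₂) , λ N N≥ →
      bound N N≥ (sixth-root N (≤-trans (m^n>0 2 (6 * l₂)) (≤-trans (m≤n+m _ N₁) N≥)))
      where
      N₁ = proj₁ (D₂-superlinear (κ * 2))
      superlinear = proj₂ (D₂-superlinear (κ * 2))
      l₂ = proj₁ (code-size-negligible error-constant)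
      negligible = proj₂ (code-size-negligible error-constant)
      bound : ∀ N → N₁ + 2 ^ (6 * l₂) ≤ N → (∃ λ l → 2 ^ (6 * l) ≤ N × N < 2 ^ (6 * l + 6)) →
        κ * ∣ 2 * D₃ n N - D₂ n N ∣ ≤ D₂ n N
      bound N N≥ (l , lo , hi) = begin
        κ * ∣ 2 * D₃ n N - D₂ n N ∣
          ≤⟨ *-monoʳ-≤ κ (distance-bound {N} {l} (range N) hi (all-degenerate N)) ⟩
        κ * (error-constant * code-size l + length (range N))
          ≤⟨ *-monoʳ-≤ κ (+-mono-≤ (≤-trans (negligible l l≥) lo) (≤-reflexive (length-range N))) ⟩
        κ * (N + N)                                          ≡⟨ lemma κ N ⟩
        κ * 2 * N                                            ≤⟨ superlinear N (≤-trans (m≤m+n N₁ _) N≥) ⟩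
        D₂ n N                                               ∎
        where
        open ≤-Reasoning
        l≥ : l₂ ≤ l
        l≥ = sixth-root-≥ {l = l} hi (≤-trans (m≤n+m _ N₁) N≥)
        lemma : ∀ κ N → κ * (N + N) ≡ κ * 2 * N
        lemma = ℕ-solve

  -- The choice k = |n|, h = n² - n has h ≥ 0 for either sign of n.
  nonsquare-representation : ∃₂ λ k h → 1 ≤ k × + (k * k) ≡ + h ℤ.+ n
  nonsquare-representation = m , k²-n n n≢0
    where
    k²-n : ∀ n → n ≢ 0ℤ → ∃ λ h → 1 ≤ ℤ.∣ n ∣ × + (ℤ.∣ n ∣ * ℤ.∣ n ∣) ≡ + h ℤ.+ n
    k²-n (+ zero) ne = contradiction refl ne
    k²-n (+ suc j) _ = j * suc j , s≤s z≤n , cong +_ (+-comm (suc j) (j * suc j))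
    k²-n -[1+ j ] _ = suc j * suc j + suc j , s≤s z≤n ,
      trans (lemma (+ (suc j * suc j)) (+ suc j)) (cong (ℤ._- + suc j) (sym (ℤₚ.pos-+ (suc j * suc j) (suc j))))
      where
      lemma : ∀ x y → x ≡ x ℤ.+ y ℤ.- y
      lemma = ℤ-solve

  asymptotic : ∀ κ → Eventually (λ N → κ * ∣ 2 * D₃ n N - D₂ n N ∣ ≤ D₂ n N)
  asymptotic κ with isSquare? n
  ... | yes (zero , 0≡n) = contradiction (sym 0≡n) n≢0
  ... | yes (k@(suc _) , k²≡n) = square-case k (s≤s z≤n) k²≡n κ
  ... | no nonsquare =
    let k , h , 1≤k , k²≡h+n = nonsquare-representation in nonsquare-case nonsquare k h 1≤k k²≡h+n κ

-- Convergence of 2D₃/D₂ to 1 with denominators cleared: from N₀ on, the error relative to D₂ is at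
-- most 1/(k + 1).
theorem3 : (n : ℤ) → n ≢ 0ℤ → (k : ℕ) →
    ∃ λ (N₀ : ℕ) → (N : ℕ) → N₀ ≤ N →
    suc k * ∣ 2 * D₃ n N - D₂ n N ∣ ≤ D₂ n N
theorem3 n n≢0 k = Asymptotics.asymptotic n n≢0 (suc k)
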